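{- For a simple graph $G$ the following are equivalent: (1) $G$ is $(2,1)$-tight; (2) $G$ can be derived from $K_5\setminus e$ or from $K_4\sqcup K_4$ by a finite sequence of Henneberg 1, Henneberg 2, vertex-to-$K_4$, edge joining and edge-to-$K_3$ moves; (3) $G$ is the edge-disjoint union of a spanning tree $T$ and a spanning subgraph $P$ in which every connected component contains exactly one cycle.
   Context: For a graph $H$ let $f(H)=2|V(H)|-|E(H)|$. For $\ell\in\{1,2,3\}$, a simple graph $G$ is $(2,\ell)$-sparse if $f(H)\ge \ell$ for every subgraph $H$ of $G$ with at least one edge, and $(2,\ell)$-tight if it is $(2,\ell)$-sparse and $f(G)=\ell$. $K_5\setminus e$ is the complete graph on $5$ vertices with one edge removed; $K_4\sqcup K_4$ is the graph formed by two copies of $K_4$ whose intersection is a copy of $K_2$ (one shared edge with its two endpoints). Moves: Henneberg 1 adds a new vertex of degree $2$. Henneberg 2 removes an edge $uv$ and adds a new vertex $x$ with edges $xu,xv,xw$ for some further vertex $w$. Vertex-to-$K_4$ is the inverse of the $K_4$-to-vertex move, which contracts a copy of $K_4$ in $G$ to a single new vertex $v_*$: vertices of the $K_4$ are replaced by $v_*$, edges of the $K_4$ are deleted, and each edge $vw$ with $v\notin K_4$, $w\in K_4$ becomes an edge $vv_*$. Edge-to-$K_3$: given an edge $uv$ where $v$ has neighbours $a_1,\dots,a_n$, delete $v$ and its incident edges, add new vertices $v_1,v_2$ with edges $uv_1,uv_2,v_1v_2$, and join each remaining former neighbour $a_j$ of $v$ to exactly one of $v_1,v_2$ (according to some bipartition,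 one side possibly empty). Edge joining: given $(2,1)$-tight graphs $K$ and $H$ (vertex-disjoint) and vertices $u\in K$, $v\in H$, form $G$ with $V(G)=V(K)\cup V(H)$ and $E(G)=E(K)\cup E(H)\cup\{uv\}$. -}

module Defs where

open import Data.Bool using (Bool; true; false; not; _∧_; _∨_; if_then_else_)
open import Data.Bool.Properties using (∨-comm)
open import Data.Nat using (ℕ; zero; suc; _+_; _*_; _≤_; _<ᵇ_; _≡ᵇ_)
open import Data.Nat.ListAction using (sum)
open import Data.Fin using (Fin; toℕ; _↑ˡ_; _↑ʳ_)
import Data.Fin as F
open import Data.List using (List; []; _∷_; _++_; [_]; length; map; allFin)
open import Data.List.Relation.Unary.All using (All)
open import Data.List.Relation.Unary.Unique.Propositional using (Unique)
open import Data.List.Membership.Propositional using (_∈_)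
open import Data.Product using (Σ; Σ-syntax; _×_; _,_)
open import Data.Sum using (_⊎_)
open import Data.Empty using (⊥)
open import Relation.Nullary using (¬_)
open import Relation.Binary.PropositionalEquality using (_≡_; refl; cong; cong₂)
open import Function.Definitions using (Injective)

record Graph (n : ℕ) : Set where
  field
    adj : Fin n → Fin n → Bool
    adj-sym : ∀ i j → adj i j ≡ adj j i
    adj-irr : ∀ i → adj i i ≡ false
open Graph public

_=ᵛ_ : ∀ {n} → Fin n → Fin n → Bool
i =ᵛ j = toℕ i ≡ᵇ toℕ j

≡ᵇ-sym : ∀ m n → (m ≡ᵇ n) ≡ (n ≡ᵇ m)
≡ᵇ-sym zero zero = refl
≡ᵇ-sym zero (suc n) = refl
≡ᵇ-sym (suc m) zero = refl
≡ᵇ-sym (suc m) (suc n) = ≡ᵇ-sym m n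

≡ᵇ-refl : ∀ m → (m ≡ᵇ m) ≡ true
≡ᵇ-refl zero = refl
≡ᵇ-refl (suc m) = ≡ᵇ-refl m

mkGraph : ∀ {n} → (Fin n → Fin n → Bool) → Graph n
mkGraph e = record
  { adj = λ i j → not (i =ᵛ j) ∧ (e i j ∨ e j i)
  ; adj-sym = λ i j → cong₂ (λ a b → not a ∧ b) (≡ᵇ-sym (toℕ i) (toℕ j)) (∨-comm (e i j) (e j i))
  ; adj-irr = λ i → cong (λ a → not a ∧ (e i i ∨ e i i)) (≡ᵇ-refl (toℕ i))
  }

b2n : Bool → ℕ
b2n true = 1
b2n false = 0

edgeCount : ∀ {n} → Graph n → ℕ
edgeCount {n} G =
  sum (map (λ i → sum (map (λ j → b2n ((toℕ i <ᵇ toℕ j) ∧ adj G i j)) (allFin n))) (allFin n))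

IsSubgraphVia : ∀ {m n} → Graph m → Graph n → (Fin m → Fin n) → Set
IsSubgraphVia H G φ =
  Injective _≡_ _≡_ φ × (∀ i j → adj H i j ≡ true → adj G (φ i) (φ j) ≡ true)

Sparse : ℕ → ∀ {n} → Graph n → Set
Sparse ℓ {n} G =
  ∀ m (H : Graph m) (φ : Fin m → Fin n) → IsSubgraphVia H G φ →
  1 ≤ edgeCount H → edgeCount H + ℓ ≤ 2 * m

Tight : ℕ → ∀ {n} → Graph n → Set
Tight ℓ {n} G = Sparse ℓ G × (edgeCount G + ℓ ≡ 2 * n)

Iso : ∀ {m n} → Graph m → Graph n → Set
Iso {m} {n} G H =
  Σ[ f ∈ (Fin m → Fin n) ] Σ[ g ∈ (Fin n → Fin m) ]
    (∀ i → g (f i) ≡ i) × (∀ j → f (g j) ≡ j) ×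
    (∀ i j → adj H (f i) (f j) ≡ adj G i j)

K5-e : Graph 5
K5-e = mkGraph (λ i j → not (((toℕ i ≡ᵇ 0) ∧ (toℕ j ≡ᵇ 1)) ∨ ((toℕ i ≡ᵇ 1) ∧ (toℕ j ≡ᵇ 0))))

-- K4 ⊔ K4: K4 on {0,1,2,3} and K4 on {2,3,4,5}, sharing the edge 23
K4⊔K4 : Graph 6
K4⊔K4 = mkGraph (λ i j → not ((toℕ i <ᵇ 2) ∧ (3 <ᵇ toℕ j)) ∧ not ((toℕ j <ᵇ 2) ∧ (3 <ᵇ toℕ i)))

-- Moves.  A move takes G : Graph n to G' : Graph (n + k); the old vertices of
-- G' are  a ↑ˡ k  and the k new vertices are  n ↑ʳ i.  For vertex-to-K4 and
-- edge-to-K3 the replaced vertex v keeps the name  v ↑ˡ k  and plays the role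
-- of one of the new K4 / K3 vertices (its old incidences are redistributed).

module _ {n k : ℕ} where
  old : Fin n → Fin (n + k)
  old a = a ↑ˡ k
  new : Fin k → Fin (n + k)
  new i = n ↑ʳ i

Henneberg1 : ∀ {n} → Graph n → Graph (n + 1) → Set
Henneberg1 {n} G G' =
  (∀ a b → adj G' (old a) (old b) ≡ adj G a b) ×
  Σ[ p ∈ Fin n ] Σ[ q ∈ Fin n ] (¬ p ≡ q) ×
    (∀ a → adj G' (new F.zero) (old a) ≡ ((a =ᵛ p) ∨ (a =ᵛ q)))

Henneberg2 : ∀ {n} → Graph n → Graph (n + 1) → Set
Henneberg2 {n} G G' =
  Σ[ u ∈ Fin n ] Σ[ v ∈ Fin n ] Σ[ w ∈ Fin n ]
    (adj G u v ≡ true) × (¬ w ≡ u) × (¬ w ≡ v) ×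
    (∀ a b → adj G' (old a) (old b) ≡
              (adj G a b ∧ not (((a =ᵛ u) ∧ (b =ᵛ v)) ∨ ((a =ᵛ v) ∧ (b =ᵛ u))))) ×
    (∀ a → adj G' (new F.zero) (old a) ≡ ((a =ᵛ u) ∨ (a =ᵛ v) ∨ (a =ᵛ w)))

-- Vertex-to-K4 at v: v is replaced by a K4 on {v, x0, x1, x2}; every former
-- neighbour a of v is joined to exactly one K4 vertex, non-neighbours to none
-- (so that contracting the K4 gives back G).
VertexToK4 : ∀ {n} → Graph n → Graph (n + 3) → Set
VertexToK4 {n} G G' =
  Σ[ v ∈ Fin n ]
    (∀ a b → ¬ a ≡ v → ¬ b ≡ v → adj G' (old a) (old b) ≡ adj G a b) ×
    (∀ (i : Fin 3) → adj G' (old v) (new i) ≡ true) ×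
    (∀ (i j : Fin 3) → ¬ i ≡ j → adj G' (new i) (new j) ≡ true) ×
    (∀ a → ¬ a ≡ v →
       b2n (adj G' (old a) (old v)) + b2n (adj G' (old a) (new F.zero))
       + b2n (adj G' (old a) (new (F.suc F.zero)))
       + b2n (adj G' (old a) (new (F.suc (F.suc F.zero))))
       ≡ b2n (adj G a v))

-- Edge-to-K3 on the edge uv: v is replaced by v1 = v, v2 = x; u v1 v2 is a
-- triangle and each former neighbour a ≠ u of v is joined to exactly one of
-- v1, v2 (non-neighbours to neither).
EdgeToK3 : ∀ {n} → Graph n → Graph (n + 1) → Set
EdgeToK3 {n} G G' =
  Σ[ u ∈ Fin n ] Σ[ v ∈ Fin n ]
    (adj G u v ≡ true) ×
    (∀ a b → ¬ a ≡ v → ¬ b ≡ v → adj G' (old a) (old b) ≡ adj G a b) ×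
    (adj G' (old v) (new F.zero) ≡ true) ×
    (adj G' (old u) (old v) ≡ true) ×
    (adj G' (old u) (new F.zero) ≡ true) ×
    (∀ a → ¬ a ≡ v → ¬ a ≡ u →
       b2n (adj G' (old a) (old v)) + b2n (adj G' (old a) (new F.zero)) ≡ b2n (adj G a v))

EdgeJoin : ∀ {n m} → Graph n → Graph m → Graph (n + m) → Set
EdgeJoin {n} {m} K H G =
  Σ[ u ∈ Fin n ] Σ[ v ∈ Fin m ]
    (∀ a b → adj G (old a) (old b) ≡ adj K a b) ×
    (∀ i j → adj G (new i) (new j) ≡ adj H i j) ×
    (∀ a j → adj G (old a) (new j) ≡ ((a =ᵛ u) ∧ (j =ᵛ v)))

data Derivable : ∀ {n} → Graph n → Set where
  base-K5-e : ∀ {n} {G : Graph n} → Iso K5-e G → Derivable G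
  base-K4⊔K4 : ∀ {n} {G : Graph n} → Iso K4⊔K4 G → Derivable G
  iso : ∀ {m n} {G : Graph m} {G' : Graph n} → Derivable G → Iso G G' → Derivable G'
  henneberg1 : ∀ {n} {G : Graph n} {G' : Graph (n + 1)} → Derivable G → Henneberg1 G G' → Derivable G'
  henneberg2 : ∀ {n} {G : Graph n} {G' : Graph (n + 1)} → Derivable G → Henneberg2 G G' → Derivable G'
  vertexToK4 : ∀ {n} {G : Graph n} {G' : Graph (n + 3)} → Derivable G → VertexToK4 G G' → Derivable G'
  edgeToK3 : ∀ {n} {G : Graph n} {G' : Graph (n + 1)} → Derivable G → EdgeToK3 G G' → Derivable G'
  edgeJoin : ∀ {n m} {K : Graph n} {H : Graph m} {G : Graph (n + m)} →
             Derivable K → Derivable H → EdgeJoin K H G → Derivable G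

data Reach {n} (G : Graph n) : Fin n → Fin n → Set where
  here : ∀ {x} → Reach G x x
  step : ∀ {x y z} → adj G x y ≡ true → Reach G y z → Reach G x z

-- a tree / connected graph has at least one vertex
Connected : ∀ {n} → Graph n → Set
Connected {n} G = Fin n × (∀ x y → Reach G x y)

consecPairs : ∀ {A : Set} → List A → List (A × A)
consecPairs [] = []
consecPairs (x ∷ []) = []
consecPairs (x ∷ y ∷ xs) = (x , y) ∷ consecPairs (y ∷ xs)

cycleEdges : ∀ {A : Set} → List A → List (A × A)
cycleEdges [] = []
cycleEdges (v ∷ vs) = consecPairs ((v ∷ vs) ++ [ v ])

IsCycle : ∀ {n} → Graph n → List (Fin n) → Set
IsCycle G vs = Unique vs × (3 ≤ length vs) × All (λ e → adj G (Data.Product.proj₁ e) (Data.Product.proj₂ e) ≡ true) (cycleEdges vs)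

UsesEdge : ∀ {n} → List (Fin n) → Fin n → Fin n → Set
UsesEdge vs a b = ((a , b) ∈ cycleEdges vs) ⊎ ((b , a) ∈ cycleEdges vs)

SameCycle : ∀ {n} → List (Fin n) → List (Fin n) → Set
SameCycle vs ws = ∀ a b → (UsesEdge vs a b → UsesEdge ws a b) × (UsesEdge ws a b → UsesEdge vs a b)

Acyclic : ∀ {n} → Graph n → Set
Acyclic G = ∀ vs → ¬ IsCycle G vs

IsTree : ∀ {n} → Graph n → Set
IsTree G = Connected G × Acyclic G

ComponentsUnicyclic : ∀ {n} → Graph n → Set
ComponentsUnicyclic {n} P =
  ∀ (x : Fin n) →
    (Σ[ vs ∈ List (Fin n) ] IsCycle P vs × All (Reach P x) vs) ×
    (∀ vs ws → IsCycle P vs → All (Reach P x) vs →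
               IsCycle P ws → All (Reach P x) ws → SameCycle vs ws)

TreePlusUnicyclic : ∀ {n} → Graph n → Set
TreePlusUnicyclic {n} G =
  Σ[ T ∈ Graph n ] Σ[ P ∈ Graph n ]
    (∀ i j → adj G i j ≡ (adj T i j ∨ adj P i j)) ×
    (∀ i j → (adj T i j ∧ adj P i j) ≡ false) ×
    IsTree T × ComponentsUnicyclic P

private
  _ : edgeCount K5-e ≡ 9
  _ = refl
  _ : edgeCount K4⊔K4 ≡ 11
  _ = refl

{-# OPTIONS --safe #-}
-- For a vertex set X of a graph put f(X) = 2|X| − |E(X)|; f is submodular, and X is tight when f(X) = 1.
--
-- (1) ⇒ (2). In a tight graph a vertex of degree 2 is removed by an inverse Henneberg 1 move. At a vertex of degree 3 with two
-- nonadjacent neighbours an inverse Henneberg 2 move exists, because tight sets blocking the new edges would unite to a tight set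
-- containing all three neighbours. Any other vertex of degree 3 lies in a K4. If this K4 cannot be contracted, some outside vertex
-- sees two or three of its vertices. Contracting an edge of a triangle that grows out of such a configuration can only fail
-- because the edge lies in a second triangle; following these triangles produces a contractible edge unless the K4 lies in a copy
-- of K5∖e or K4⊔K4. Such copies D are minimal tight sets, hence disjoint. Now Σ_{v ∈ V} (4 − deg v) = 2 whereas
-- Σ_{v ∈ D} (4 − deg v) = 2 − d(D), where d(D) is the number of edges leaving D; so some D is the whole graph or has d(D) = 1,
-- in which case the complement of D is tight as well and G is an edge joining.
--
-- (2) ⇒ (3). Each move preserves the existence of a root r, a parent function π and a function s without fixed points or
-- 2-cycles such that the edges of G are, without repetition, the pairs {i, π i} (i ≠ r) and {i, s i}.
--
-- (3) ⇒ (1). Leaves can be deleted from either part, so it suffices to count edges in the case of minimum degree 2; for the upper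
-- bounds, the end of a maximal path then has degree 2 and lies on the only cycle of its component.
module Submission where

open import Defs
open import Data.Bool using (Bool; true; false; not; _∧_; _∨_; if_then_else_)
import Data.Bool as Bool
open import Data.Bool.Properties using (∨-comm; ∧-comm; ∧-zeroʳ; ∧-identityʳ; ∨-zeroʳ; ∨-identityʳ; ∧-distribʳ-∨)
open import Data.Empty using (⊥; ⊥-elim)
open import Data.Fin using (Fin; zero; suc; toℕ; _≟_; splitAt; _↑ˡ_; _↑ʳ_)
open import Data.Fin.Patterns
open import Data.Fin.Permutation using (Permutation; permutation; _⟨$⟩ʳ_)
open import Data.Fin.Properties using (toℕ-injective; any?; all?; splitAt-↑ˡ; splitAt-↑ʳ; splitAt⁻¹-↑ˡ; splitAt⁻¹-↑ʳ; toℕ-↑ˡ; toℕ-↑ʳ)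
  renaming (suc-injective to Fin-suc-injective)
open import Data.Fin.Subset.Properties using (anySubset?)
open import Data.List using (List; []; _∷_; _++_; [_]; map; tabulate; allFin; length; lookup; filter)
open import Data.List.Membership.Propositional using (_∈_; _∉_)
open import Data.List.Membership.Propositional.Properties using (∈-++⁺ˡ; ∈-++⁺ʳ; ∈-++⁻; ∈-filter⁺; ∈-filter⁻; ∈-allFin; ∈-lookup)
import Data.List.Membership.DecPropositional as DecMem
open import Data.List.Properties using (map-tabulate)
open import Data.List.Relation.Unary.All as All using (All; []; _∷_)
import Data.List.Relation.Unary.All.Properties as AllP
open import Data.List.Relation.Unary.AllPairs using ([]; _∷_)
open import Data.List.Relation.Unary.Any using (here; there; index)
import Data.List.Relation.Unary.Any.Properties as AnyP
open import Data.List.Relation.Unary.Linked as Linked using (Linked; []; [-]; _∷_)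
open import Data.List.Relation.Unary.Unique.Propositional using (Unique)
import Data.List.Relation.Unary.Unique.Propositional.Properties as UniqueP
open import Data.Nat using (ℕ; zero; suc; _+_; _*_; _∸_; _≤_; _<_; z≤n; s≤s; _≤?_; _<ᵇ_)
import Data.Nat as ℕ
open import Data.Nat.Induction using (<-wellFounded)
import Data.Nat.ListAction as LA
open import Data.Nat.Properties hiding (_≟_; _≤?_)
open import Algebra.Properties.CommutativeMonoid.Sum +-0-commutativeMonoid
  using (sum-replicate-zero) renaming (sum to sumᶠ; sum-cong-≗ to sumᶠ-cong; ∑-distrib-+ to sumᶠ-distrib; ∑-comm to sumᶠ-comm; sum-permute to sumᶠ-permute)
open import Data.Nat.Tactic.RingSolver using (solve-∀)
open import Data.Product using (Σ; Σ-syntax; _×_; _,_; proj₁; proj₂)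
open import Data.Sum using (_⊎_; inj₁; inj₂; [_,_]′; swap)
open import Data.Vec as Vec using (Vec; []; _∷_)
open import Data.Vec.Functional using () renaming (_++_ to _⊕_)
open import Data.Vec.Functional.Properties using () renaming (lookup-++ˡ to ⊕-old; lookup-++ʳ to ⊕-new)
import Data.Vec.Properties as VecP
open import Function using (_∘_; id)
open import Function.Bundles using (_⇔_; mk⇔)
open import Induction.WellFounded using (Acc; acc)
open import Relation.Binary.PropositionalEquality
  using (_≡_; _≢_; _≗_; refl; sym; trans; cong; cong₂; subst; subst₂; ≢-sym; module ≡-Reasoning)
open import Relation.Nullary using (¬_; Dec; yes; no; does; ¬?)
open import Relation.Nullary.Decidable using (True; toWitness; from-yes; dec-true; dec-false; _×-dec_; _⊎-dec_; _→-dec_)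

-- Vertex sets, degrees and edge counts

-- Contracting `zp` in a triangle `zpq` removes one vertex and two edges if `q` is the only common
-- neighbour of `z` and `p`. It keeps `f` on sets through `q`, but lowers it by one on sets that
-- contain `z` and `p` and miss `q`. So there are two obstacles: a second common neighbour, and a
-- tight set through `zp` that misses `q`. The second one never occurs if `p`, `q` are the only
-- neighbours of `z` in a set `M` none of whose nonempty subsets has a smaller `f`, such as a tight
-- set or a K4. The first one supplies the next triangle, and the growth of `M` ends because the
-- graph is finite. The decomposition in (3) is carried through the moves by pointers, since a move
-- affects only pointers into or out of the vertices it changes. Connectedness, acyclicity and the
-- uniqueness of cycles are read off once, at the end, instead of being restored by surgery on walks
-- after each move. The edge bounds for the tree and for the unicyclic part come from one induction
-- each: a set of marked vertices records how many units the bound `card S` may be improved.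

VSet : ℕ → Set
VSet n = Fin n → Bool

_==_ : ∀ {n} → Fin n → Fin n → Bool
i == j = does (i ≟ j)

==-refl : ∀ {n} (i : Fin n) → (i == i) ≡ true
==-refl i = dec-true (i ≟ i) refl

==-≢ : ∀ {n} {i j : Fin n} → i ≢ j → (i == j) ≡ false
==-≢ {i = i} {j} = dec-false (i ≟ j)

==⇒≡ : ∀ {n} {i j : Fin n} → (i == j) ≡ true → i ≡ j
==⇒≡ {i = i} {j} e with i ≟ j
... | yes p = p

==⇒≢ : ∀ {n} {i j : Fin n} → (i == j) ≡ false → i ≢ j
==⇒≢ {i = i} e refl with () ← trans (sym e) (==-refl i)

T≢F : ∀ {b : Bool} → b ≡ true → b ≡ false → ⊥
T≢F refl ()

∧-split : ∀ {a b : Bool} → a ∧ b ≡ true → a ≡ true × b ≡ true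
∧-split {true} {true} _ = refl , refl

∨-split : ∀ {a b : Bool} → a ∨ b ≡ true → a ≡ true ⊎ b ≡ true
∨-split {true} _ = inj₁ refl
∨-split {false} e = inj₂ e

dichotomy : ∀ (b : Bool) → b ≡ true ⊎ b ≡ false
dichotomy true = inj₁ refl
dichotomy false = inj₂ refl

≢true : ∀ {b : Bool} → b ≢ true → b ≡ false
≢true {true} h = ⊥-elim (h refl)
≢true {false} _ = refl

does-true : ∀ {p} {P : Set p} (d : Dec P) → does d ≡ true → P
does-true (yes p) _ = p

does-false : ∀ {p} {P : Set p} (d : Dec P) → does d ≡ false → ¬ P
does-false (no p) _ = p

not-true : ∀ {b : Bool} → not b ≡ true → b ≡ false
not-true {false} _ = refl

not-false : ∀ {b : Bool} → not b ≡ false → b ≡ true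
not-false {true} _ = refl

bool-ext : ∀ {a b : Bool} → (a ≡ true → b ≡ true) → (b ≡ true → a ≡ true) → a ≡ b
bool-ext {true} {b} f g = sym (f refl)
bool-ext {false} {true} f g = g refl
bool-ext {false} {false} f g = refl

-- Linear arithmetic: to derive L ≤ R, add up hypotheses to l ≤ r and check L + r + k ≡ R + l.
lin≤ : ∀ {l r L R} k → l ≤ r → L + r + k ≡ R + l → L ≤ R
lin≤ {l} {r} {L} {R} k p e = +-cancelʳ-≤ l L R (≤-trans (+-monoʳ-≤ L p) (≤-trans (m≤m+n (L + r) k) (≤-reflexive e)))

opaque
  ∑ : ∀ {n} → (Fin n → ℕ) → ℕ
  ∑ = sumᶠ

  ∑-cong : ∀ {n} {f g : Fin n → ℕ} → f ≗ g → ∑ f ≡ ∑ g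
  ∑-cong = sumᶠ-cong

  ∑-+ : ∀ {n} (f g : Fin n → ℕ) → ∑ (λ i → f i + g i) ≡ ∑ f + ∑ g
  ∑-+ = sumᶠ-distrib

  ∑-comm : ∀ {m n} (f : Fin m → Fin n → ℕ) → ∑ (λ i → ∑ (f i)) ≡ ∑ (λ j → ∑ (λ i → f i j))
  ∑-comm = sumᶠ-comm

  ∑-permute : ∀ {m n} (f : Fin n → ℕ) (π : Permutation m n) → ∑ f ≡ ∑ (λ i → f (π ⟨$⟩ʳ i))
  ∑-permute f π = sumᶠ-permute f π

  ∑-*ʳ : ∀ {n} (f : Fin n → ℕ) k → ∑ f * k ≡ ∑ (λ i → f i * k)
  ∑-*ʳ {zero} f k = refl
  ∑-*ʳ {suc n} f k = trans (*-distribʳ-+ k (f zero) _) (cong (f zero * k +_) (∑-*ʳ (f ∘ suc) k))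

  ∑-ones : ∀ n → ∑ {n} (λ _ → 1) ≡ n
  ∑-ones zero = refl
  ∑-ones (suc n) = cong suc (∑-ones n)

  ∑-mono : ∀ {n} {f g : Fin n → ℕ} → (∀ i → f i ≤ g i) → ∑ f ≤ ∑ g
  ∑-mono {zero} h = z≤n
  ∑-mono {suc n} h = +-mono-≤ (h zero) (∑-mono (h ∘ suc))

  ∑-zero : ∀ {n} {f : Fin n → ℕ} → (∀ i → f i ≡ 0) → ∑ f ≡ 0
  ∑-zero {n} h = trans (∑-cong h) (sum-replicate-zero n)

  ∑-≥ : ∀ {n} (f : Fin n → ℕ) i → f i ≤ ∑ f
  ∑-≥ {suc n} f zero = m≤m+n _ _
  ∑-≥ {suc n} f (suc i) = ≤-trans (∑-≥ (f ∘ suc) i) (m≤n+m _ _)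

  ∑-if : ∀ {n} (b : Bool) (h : Fin n → ℕ) → ∑ (λ j → if b then h j else 0) ≡ (if b then ∑ h else 0)
  ∑-if true h = refl
  ∑-if {n} false h = ∑-zero {n} (λ _ → refl)

  ∑-δ : ∀ {n} (z : Fin n) (h : Fin n → ℕ) → ∑ (λ i → if i == z then h i else 0) ≡ h z
  ∑-δ {suc n} zero h = trans (cong (h zero +_) (∑-zero {n} (λ _ → refl))) (+-identityʳ _)
  ∑-δ {suc n} (suc z) h = ∑-δ z (h ∘ suc)

  sum-allFin : ∀ {n} (f : Fin n → ℕ) → LA.sum (map f (allFin n)) ≡ ∑ f
  sum-allFin {n} f = trans (cong LA.sum (map-tabulate {n = n} id f)) (go f)
    where
    go : ∀ {n} (f : Fin n → ℕ) → LA.sum (tabulate f) ≡ ∑ f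
    go {zero} f = refl
    go {suc n} f = cong (f zero +_) (go (f ∘ suc))

full : ∀ {n} → VSet n
full _ = true

∁ : ∀ {n} → VSet n → VSet n
∁ X i = not (X i)

_∪_ _∩_ _∖_ : ∀ {n} → VSet n → VSet n → VSet n
(X ∪ Y) i = X i ∨ Y i
(X ∩ Y) i = X i ∧ Y i
(X ∖ Y) i = X i ∧ not (Y i)

_⊆_ : ∀ {n} → VSet n → VSet n → Set
X ⊆ Y = ∀ i → X i ≡ true → Y i ≡ true

opaque
  add rem : ∀ {n} → Fin n → VSet n → VSet n
  add z X i = (i == z) ∨ X i
  rem z X i = not (i == z) ∧ X i

  add-new : ∀ {n} (z : Fin n) X → add z X z ≡ true
  add-new z X rewrite ==-refl z = refl

  add-old : ∀ {n} (z : Fin n) X {i} → X i ≡ true → add z X i ≡ true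
  add-old z X {i} h rewrite h = ∨-zeroʳ _

  add-inv : ∀ {n} {z : Fin n} {X i} → add z X i ≡ true → i ≡ z ⊎ X i ≡ true
  add-inv {z = z} {X} {i} h with ∨-split {i == z} h
  ... | inj₁ e = inj₁ (==⇒≡ e)
  ... | inj₂ e = inj₂ e

  add-≢ : ∀ {n} {z : Fin n} X {i} → i ≢ z → add z X i ≡ X i
  add-≢ X h rewrite ==-≢ h = refl

  rem-self : ∀ {n} (z : Fin n) X → rem z X z ≡ false
  rem-self z X rewrite ==-refl z = refl

  rem-≢ : ∀ {n} {z : Fin n} X {i} → i ≢ z → rem z X i ≡ X i
  rem-≢ X h rewrite ==-≢ h = refl

  rem-inv : ∀ {n} {z : Fin n} {X i} → rem z X i ≡ true → i ≢ z × X i ≡ true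
  rem-inv {z = z} {X} {i} h with i ≟ z
  ... | no p = p , h

add-out : ∀ {n} {z : Fin n} X {i} → i ≢ z → X i ≡ false → add z X i ≡ false
add-out X h e = trans (add-≢ X h) e

rem-in : ∀ {n} {z : Fin n} X {i} → i ≢ z → X i ≡ true → rem z X i ≡ true
rem-in X h e = trans (rem-≢ X h) e

rem-⊆ : ∀ {n} {z : Fin n} {X} → rem z X ⊆ X
rem-⊆ {X = X} i p = proj₂ (rem-inv {X = X} p)

add-rem : ∀ {n} {z : Fin n} X → X z ≡ true → add z (rem z X) ≗ X
add-rem {z = z} X h i with i ≟ z
... | yes refl = trans (add-new i _) (sym h)
... | no p = trans (add-≢ _ p) (rem-≢ X p)

rem-add : ∀ {n} {z : Fin n} X → X z ≡ false → rem z (add z X) ≗ X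
rem-add {z = z} X h i with i ≟ z
... | yes refl = trans (rem-self i _) (sym h)
... | no p = trans (rem-≢ _ p) (add-≢ X p)

opaque
  card : ∀ {n} → VSet n → ℕ
  card X = ∑ λ i → b2n (X i)

  deg : ∀ {n} → Graph n → Fin n → VSet n → ℕ
  deg G z X = card (λ j → adj G z j ∧ X j)

  E : ∀ {n} → Graph n → VSet n → ℕ
  E G X = ∑ λ i → ∑ λ j → b2n (((toℕ i <ᵇ toℕ j) ∧ adj G i j) ∧ (X i ∧ X j))

  -- The number of ordered adjacent pairs from `X` to `Y`: an edge with both ends in `X ∩ Y` counts
  -- twice, and `vol G X (∁ X)` is the number of edges leaving `X`.
  vol : ∀ {n} → Graph n → VSet n → VSet n → ℕ
  vol G X Y = ∑ λ i → if X i then deg G i Y else 0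

b2n-mono : ∀ {a b : Bool} → (a ≡ true → b ≡ true) → b2n a ≤ b2n b
b2n-mono {false} h = z≤n
b2n-mono {true} h rewrite h refl = ≤-refl

opaque
  unfolding card

  card-cong : ∀ {n} {X Y : VSet n} → X ≗ Y → card X ≡ card Y
  card-cong h = ∑-cong (λ i → cong b2n (h i))

  card-mono : ∀ {n} {X Y : VSet n} → X ⊆ Y → card X ≤ card Y
  card-mono h = ∑-mono (λ i → b2n-mono (h i))

  card-add : ∀ {n} {z : Fin n} X → X z ≡ false → card (add z X) ≡ suc (card X)
  card-add {n} {z} X h = begin
    card (add z X)                                        ≡⟨ ∑-cong pt ⟩
    ∑ (λ i → (if i == z then 1 else 0) + b2n (X i))       ≡⟨ ∑-+ _ _ ⟩
    ∑ (λ i → if i == z then 1 else 0) + card X            ≡⟨ cong (_+ card X) (∑-δ z (λ _ → 1)) ⟩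
    suc (card X)                                          ∎
    where
    open ≡-Reasoning
    pt : ∀ i → b2n (add z X i) ≡ (if i == z then 1 else 0) + b2n (X i)
    pt i with i ≟ z
    ... | yes refl rewrite h = cong b2n (add-new i X)
    ... | no p = cong b2n (add-≢ X p)

  card-empty : ∀ {n} {X : VSet n} → (∀ i → X i ≡ false) → card X ≡ 0
  card-empty h = ∑-zero (λ i → cong b2n (h i))

  card-∈ : ∀ {n} {X : VSet n} {i} → X i ≡ true → 1 ≤ card X
  card-∈ {X = X} {i} h = ≤-trans (≤-reflexive (sym (cong b2n h))) (∑-≥ (λ i → b2n (X i)) i)

  card-full : ∀ n → card (full {n}) ≡ n
  card-full n = ∑-ones n

  card-∪-∩ : ∀ {n} (X Y : VSet n) → card (X ∪ Y) + card (X ∩ Y) ≡ card X + card Y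
  card-∪-∩ X Y = trans (sym (∑-+ _ _)) (trans (∑-cong (λ i → pt (X i) (Y i))) (∑-+ _ _))
    where
    pt : ∀ a b → b2n (a ∨ b) + b2n (a ∧ b) ≡ b2n a + b2n b
    pt true true = refl
    pt true false = refl
    pt false true = refl
    pt false false = refl

  card-part : ∀ {n} (X Y : VSet n) → card X ≡ card (X ∩ Y) + card (X ∖ Y)
  card-part X Y = trans (∑-cong (λ i → pt (X i) (Y i))) (∑-+ _ _)
    where
    pt : ∀ a b → b2n a ≡ b2n (a ∧ b) + b2n (a ∧ not b)
    pt true true = refl
    pt true false = refl
    pt false b = refl

card-rem : ∀ {n} {z : Fin n} X → X z ≡ true → card X ≡ suc (card (rem z X))
card-rem {z = z} X h = trans (card-cong (λ i → sym (add-rem {z = z} X h i))) (card-add (rem z X) (rem-self z X))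

card≡0 : ∀ {n} {X : VSet n} → card X ≡ 0 → ∀ i → X i ≡ false
card≡0 {X = X} e i with X i in q
... | false = refl
... | true with () ← ≤-trans (card-∈ {X = X} q) (≤-reflexive e)

pick : ∀ {n} (X : VSet n) → (∀ i → X i ≡ false) ⊎ Σ[ i ∈ Fin n ] X i ≡ true
pick {zero} X = inj₁ λ ()
pick {suc n} X with X zero in e
... | true = inj₂ (zero , e)
... | false with pick (X ∘ suc)
...   | inj₂ (i , p) = inj₂ (suc i , p)
...   | inj₁ h = inj₁ λ { zero → e ; (suc i) → h i }

card-pick : ∀ {n} (X : VSet n) → 1 ≤ card X → Σ[ i ∈ Fin n ] X i ≡ true
card-pick X h with pick X
... | inj₂ p = p
... | inj₁ e with () ← ≤-trans h (≤-reflexive (card-empty {X = X} e))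

card≤n : ∀ {n} (X : VSet n) → card X ≤ n
card≤n {n} X = ≤-trans (card-mono {X = X} {full} (λ _ _ → refl)) (≤-reflexive (card-full n))

-- Through `list≤deg`, lower bounds on degrees are obtained by listing distinct neighbours.
list≤card : ∀ {n} (X : VSet n) {xs : List (Fin n)} → Unique xs → All (λ x → X x ≡ true) xs → length xs ≤ card X
list≤card X [] [] = z≤n
list≤card X {x ∷ xs} (x∉ ∷ u) (p ∷ ps) =
  ≤-trans (s≤s (list≤card (rem x X) u (All.zipWith (λ { (x≢y , q) → rem-in X (λ e → x≢y (sym e)) q }) (x∉ , ps))))
          (≤-reflexive (sym (card-rem X p)))

⊆-card-≗ : ∀ {n} {X Y : VSet n} → X ⊆ Y → card Y ≤ card X → X ≗ Y
⊆-card-≗ {X = X} {Y} s h i = bool-ext (s i) back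
  where
  back : Y i ≡ true → X i ≡ true
  back y with X i in e
  ... | true = refl
  ... | false = ⊥-elim (<-irrefl refl (≤-trans (≤-trans (s≤s (card-mono {X = X} {rem i Y}
                   (λ j p → rem-in Y (λ { refl → T≢F p e }) (s j p)))) (≤-reflexive (sym (card-rem Y y)))) h))

module _ {n} (G : Graph n) where

  opaque
    unfolding deg

    deg-mono : ∀ {z X Y} → X ⊆ Y → deg G z X ≤ deg G z Y
    deg-mono {z} {X} {Y} h = card-mono {X = λ j → adj G z j ∧ X j}
      λ i p → let (a , x) = ∧-split p in cong₂ _∧_ a (h i x)

    deg-cong : ∀ {z X Y} → X ≗ Y → deg G z X ≡ deg G z Y
    deg-cong {z} h = card-cong (λ i → cong (adj G z i ∧_) (h i))

    deg-def : ∀ z X → deg G z X ≡ card (λ j → adj G z j ∧ X j)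
    deg-def z X = refl

  list≤deg : ∀ {z} X {xs : List (Fin n)} → Unique xs → All (λ x → adj G z x ≡ true × X x ≡ true) xs → length xs ≤ deg G z X
  list≤deg {z} X u ps = ≤-trans (list≤card _ u (All.map (λ { (a , b) → cong₂ _∧_ a b }) ps)) (≤-reflexive (sym (deg-def z X)))

  deg-rem : ∀ {z X} → deg G z (rem z X) ≡ deg G z X
  deg-rem {z} {X} = trans (deg-def _ _) (trans (card-cong pt) (sym (deg-def _ _)))
    where
    pt : ∀ j → (adj G z j ∧ rem z X j) ≡ (adj G z j ∧ X j)
    pt j with j ≟ z
    ... | yes refl rewrite adj-irr G j = refl
    ... | no p = cong (adj G z j ∧_) (rem-≢ X p)

  private
    c : Fin n → Fin n → Bool
    c i j = (toℕ i <ᵇ toℕ j) ∧ adj G i j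

    <ᵇ-irr : ∀ m → (m <ᵇ m) ≡ false
    <ᵇ-irr zero = refl
    <ᵇ-irr (suc m) = <ᵇ-irr m

    tri : ∀ a b → a ≢ b → b2n (a <ᵇ b) + b2n (b <ᵇ a) ≡ 1
    tri zero zero h = ⊥-elim (h refl)
    tri zero (suc b) h = refl
    tri (suc a) zero h = refl
    tri (suc a) (suc b) h = tri a b (h ∘ cong suc)

    both-orders : ∀ i j (d : Bool) → b2n (c i j ∧ d) + b2n (c j i ∧ d) ≡ b2n (adj G i j ∧ d)
    both-orders i j d rewrite adj-sym G j i with i ≟ j
    ... | yes refl rewrite adj-irr G i | <ᵇ-irr (toℕ i) = refl
    ... | no i≢j = begin
        b2n ((l ∧ a) ∧ d) + b2n ((m ∧ a) ∧ d) ≡⟨ cong₂ _+_ (e l) (e m) ⟩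
        b2n l * b2n (a ∧ d) + b2n m * b2n (a ∧ d) ≡⟨ sym (*-distribʳ-+ (b2n (a ∧ d)) (b2n l) (b2n m)) ⟩
        (b2n l + b2n m) * b2n (a ∧ d) ≡⟨ cong (_* b2n (a ∧ d)) (tri _ _ (i≢j ∘ toℕ-injective)) ⟩
        b2n (a ∧ d) + 0 ≡⟨ +-identityʳ _ ⟩
        b2n (a ∧ d) ∎
      where
      open ≡-Reasoning
      l = toℕ i <ᵇ toℕ j
      m = toℕ j <ᵇ toℕ i
      a = adj G i j
      e : ∀ l → b2n ((l ∧ a) ∧ d) ≡ b2n l * b2n (a ∧ d)
      e true = sym (+-identityʳ _)
      e false = refl

  opaque
    unfolding E

    E-cong : ∀ {X Y} → X ≗ Y → E G X ≡ E G Y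
    E-cong {X} {Y} h = ∑-cong λ i → ∑-cong λ j → cong b2n (cong₂ (λ x y → c i j ∧ (x ∧ y)) (h i) (h j))

    E-full : E G full ≡ edgeCount G
    E-full = sym (trans (sum-allFin (λ i → LA.sum (map (λ j → b2n (c i j)) (allFin n))))
      (∑-cong λ i → trans (sum-allFin (λ j → b2n (c i j))) (∑-cong λ j → cong b2n (sym (∧-identityʳ (c i j))))))

    E-empty : ∀ {X} → (∀ i → X i ≡ false) → E G X ≡ 0
    E-empty {X} h = ∑-zero λ i → ∑-zero λ j → cong b2n (trans (cong (λ x → c i j ∧ (x ∧ X j)) (h i)) (∧-zeroʳ (c i j)))

    E-add : ∀ {z} X → X z ≡ false → E G (add z X) ≡ E G X + deg G z X
    E-add {z} X h = begin
      E G (add z X)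
        ≡⟨ (∑-cong λ i → trans (∑-cong (pt i)) (∑-+ (t i) _)) ⟩
      ∑ (λ i → ∑ (λ j → t i j) + ∑ (λ j → (if i == z then u j else 0) + (if j == z then w i else 0)))
        ≡⟨ ∑-+ _ _ ⟩
      E G X + ∑ (λ i → ∑ (λ j → (if i == z then u j else 0) + (if j == z then w i else 0)))
        ≡⟨ cong (E G X +_) (trans (∑-cong λ i → trans (∑-+ (λ j → if i == z then u j else 0) _)
            (cong₂ _+_ (∑-if (i == z) u) (∑-δ z (λ _ → w i)))) (∑-+ _ _)) ⟩
      E G X + (∑ (λ i → if i == z then ∑ u else 0) + ∑ w)
        ≡⟨ cong (λ k → E G X + (k + ∑ w)) (∑-δ z (λ _ → ∑ u)) ⟩
      E G X + (∑ u + ∑ w)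
        ≡⟨ cong (E G X +_) (trans (sym (∑-+ u w)) (∑-cong (λ j → both-orders z j (X j)))) ⟩
      E G X + deg G z X ∎
      where
      open ≡-Reasoning
      t : Fin n → Fin n → ℕ
      t i j = b2n (c i j ∧ (X i ∧ X j))
      u w : Fin n → ℕ
      u j = b2n (c z j ∧ X j)
      w i = b2n (c i z ∧ X i)
      pt : ∀ i j → b2n (c i j ∧ (add z X i ∧ add z X j))
                 ≡ t i j + ((if i == z then u j else 0) + (if j == z then w i else 0))
      pt i j with i ≟ z | j ≟ z
      ... | yes refl | yes refl rewrite h | adj-irr G i | ∧-zeroʳ (toℕ i <ᵇ toℕ i) = refl
      ... | yes refl | no q rewrite h | ∧-zeroʳ (c i j) | add-new i X | add-≢ X q = sym (+-identityʳ _)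
      ... | no p | yes refl rewrite h | add-≢ X p | add-new j X | ∧-zeroʳ (X i) | ∧-zeroʳ (c i j) | ∧-identityʳ (X i) = refl
      ... | no p | no q rewrite add-≢ X p | add-≢ X q = sym (+-identityʳ _)

    -- A pair inside `X` or inside `Y` lies inside the union, and a pair inside both lies inside the
    -- intersection as well. Edges between `X ∖ Y` and `Y ∖ X` form the surplus on the right. This
    -- is the source of the submodularity of `f`.
    E-sub : ∀ X Y → E G X + E G Y ≤ E G (X ∪ Y) + E G (X ∩ Y)
    E-sub X Y = ≤-trans (≤-reflexive (two _ _))
        (≤-trans (∑-mono λ i → ∑-mono λ j → pt (c i j) (X i) (X j) (Y i) (Y j)) (≤-reflexive (sym (two _ _))))
      where
      two : ∀ (f g : Fin n → Fin n → ℕ) → ∑ (λ i → ∑ (f i)) + ∑ (λ i → ∑ (g i)) ≡ ∑ (λ i → ∑ (λ j → f i j + g i j))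
      two f g = trans (sym (∑-+ _ _)) (∑-cong λ i → sym (∑-+ (f i) (g i)))
      pt : ∀ c x y x′ y′ → b2n (c ∧ (x ∧ y)) + b2n (c ∧ (x′ ∧ y′)) ≤ b2n (c ∧ ((x ∨ x′) ∧ (y ∨ y′))) + b2n
          (c ∧ ((x ∧ x′) ∧ (y ∧ y′)))
      pt false x y x′ y′ = z≤n
      pt true true true x′ y′ = ≤-refl
      pt true true false true true = ≤-refl
      pt true true false true false = z≤n
      pt true true false false y′ = z≤n
      pt true false true true true = ≤-refl
      pt true false true true false = z≤n
      pt true false true false y′ = z≤n
      pt true false false x′ y′ = m≤m+n _ 0

    vol-∑∑ : ∀ X Y → vol G X Y ≡ ∑ λ i → ∑ λ j → b2n (adj G i j ∧ (X i ∧ Y j))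
    vol-∑∑ X Y = ∑-cong λ i → pt i (X i)
      where
      pt : ∀ i (b : Bool) → (if b then deg G i Y else 0) ≡ ∑ (λ j → b2n (adj G i j ∧ (b ∧ Y j)))
      pt i true = refl
      pt i false = sym (∑-zero λ j → cong b2n (∧-zeroʳ (adj G i j)))

    handshake : ∀ X → vol G X X ≡ E G X + E G X
    handshake X = begin
      vol G X X ≡⟨ vol-∑∑ X X ⟩
      ∑ (λ i → ∑ λ j → b2n (adj G i j ∧ (X i ∧ X j)))
        ≡⟨ (∑-cong λ i → trans (∑-cong λ j → trans (sym (both-orders i j (X i ∧ X j)))
             (cong (λ d → t i j + b2n (c j i ∧ d)) (∧-comm (X i) (X j)))) (∑-+ (t i) (λ j → t j i))) ⟩
      ∑ (λ i → ∑ (λ j → t i j) + ∑ (λ j → t j i)) ≡⟨ ∑-+ _ _ ⟩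
      E G X + ∑ (λ i → ∑ (λ j → t j i)) ≡⟨ cong (E G X +_) (∑-comm (λ i j → t j i)) ⟩
      E G X + E G X ∎
      where
      open ≡-Reasoning
      t : Fin n → Fin n → ℕ
      t i j = b2n (c i j ∧ (X i ∧ X j))

    vol-partˡ : ∀ X Y Z → vol G X Z ≡ vol G (X ∩ Y) Z + vol G (X ∖ Y) Z
    vol-partˡ X Y Z = trans (∑-cong (λ i → pt (X i) (Y i) (deg G i Z))) (∑-+ _ _)
      where
      pt : ∀ a b k → (if a then k else 0) ≡ (if a ∧ b then k else 0) + (if a ∧ not b then k else 0)
      pt true true k = sym (+-identityʳ k)
      pt true false k = refl
      pt false b k = refl

    vol-cong : ∀ {X X′ Y Y′} → X ≗ X′ → Y ≗ Y′ → vol G X Y ≡ vol G X′ Y′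
    vol-cong h k = ∑-cong λ i → cong₂ (λ b d → if b then d else 0) (h i) (deg-cong k)

    vol≥ : ∀ X Y k → (∀ i → X i ≡ true → k ≤ deg G i Y) → card X * k ≤ vol G X Y
    vol≥ X Y k h = ≤-trans (≤-reflexive (∑-*ʳ _ k)) (∑-mono λ i → pt i (X i) (h i))
      where
      pt : ∀ i (b : Bool) → (b ≡ true → k ≤ deg G i Y) → b2n b * k ≤ (if b then deg G i Y else 0)
      pt i true f = ≤-trans (≤-reflexive (+-identityʳ k)) (f refl)
      pt i false f = z≤n

    vol≤ : ∀ X Y k → (∀ i → X i ≡ true → deg G i Y ≤ k) → vol G X Y ≤ card X * k
    vol≤ X Y k h = ≤-trans (∑-mono λ i → pt i (X i) (h i)) (≤-reflexive (sym (∑-*ʳ _ k)))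
      where
      pt : ∀ i (b : Bool) → (b ≡ true → deg G i Y ≤ k) → (if b then deg G i Y else 0) ≤ b2n b * k
      pt i true f = ≤-trans (f refl) (≤-reflexive (sym (+-identityʳ k)))
      pt i false f = z≤n

  E-rem : ∀ {z} X → X z ≡ true → E G X ≡ E G (rem z X) + deg G z (rem z X)
  E-rem {z} X h = trans (E-cong (λ i → sym (add-rem {z = z} X h i))) (E-add (rem z X) (rem-self z X))

  vol-sym : ∀ X Y → vol G X Y ≡ vol G Y X
  vol-sym X Y = trans (vol-∑∑ X Y) (trans (∑-comm _) (trans (∑-cong λ j → ∑-cong λ i →
    cong b2n (cong₂ _∧_ (adj-sym G i j) (∧-comm (X i) (Y j)))) (sym (vol-∑∑ Y X))))

  vol-partʳ : ∀ Z X Y → vol G Z X ≡ vol G Z (X ∩ Y) + vol G Z (X ∖ Y)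
  vol-partʳ Z X Y = trans (vol-sym Z X) (trans (vol-partˡ X Y Z) (cong₂ _+_ (vol-sym _ Z) (vol-sym _ Z)))

-- Tree plus unicyclic graph implies sparse

adj-≢ : ∀ {n} (G : Graph n) {i j} → adj G i j ≡ true → i ≢ j
adj-≢ G p refl = T≢F p (adj-irr G _)

adj-swap : ∀ {n} (G : Graph n) {i j} → adj G i j ≡ true → adj G j i ≡ true
adj-swap G p = trans (adj-sym G _ _) p

-- Walks, cycles and maximal paths

module _ {A : Set} where

  consec⇒Linked : ∀ {R : A → A → Set} xs → All (λ e → R (proj₁ e) (proj₂ e)) (consecPairs xs) → Linked R xs
  consec⇒Linked [] _ = []
  consec⇒Linked (x ∷ []) _ = [-]
  consec⇒Linked (x ∷ y ∷ xs) (p ∷ ps) = p ∷ consec⇒Linked (y ∷ xs) ps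

  Linked⇒consec : ∀ {R : A → A → Set} {xs} → Linked R xs → All (λ e → R (proj₁ e) (proj₂ e)) (consecPairs xs)
  Linked⇒consec [] = []
  Linked⇒consec [-] = []
  Linked⇒consec (p ∷ l) = p ∷ Linked⇒consec l

  consec-∈ : ∀ {a b : A} xs → (a , b) ∈ consecPairs xs → a ∈ xs × b ∈ xs
  consec-∈ (x ∷ y ∷ xs) (here refl) = here refl , there (here refl)
  consec-∈ (x ∷ y ∷ xs) (there p) = let (a , b) = consec-∈ (y ∷ xs) p in there a , there b

  consec-last : ∀ {a z : A} {xs} y ys → xs ≡ ys ++ [ a ] → (a , z) ∈ consecPairs (y ∷ xs ++ [ z ])
  consec-last y [] refl = there (here refl)
  consec-last y (x ∷ ys) refl = there (consec-last x ys refl)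

  module _ {R : A → A → Set} where

    -- The two walk neighbours of an interior vertex can only coincide if they are the ends `a` and
    -- `z`. A cycle read as a closed walk has `a = z`, and then its length excludes the coincidence;
    -- hence the disjunction.
    linked-mid : ∀ {x} a xs z → Linked R (a ∷ xs ++ [ z ]) → Unique (a ∷ xs) → z ∉ xs → a ≢ z ⊎ 2 ≤ length xs → x ∈ xs →
                 Σ[ p ∈ A ] Σ[ q ∈ A ] p ≢ q × R p x × R x q × p ∈ (a ∷ xs) × q ∈ (xs ++ [ z ])
    linked-mid a (x ∷ []) z (r ∷ s ∷ [-]) u z∉ (inj₁ a≢z) (here refl) = a , z , a≢z , r , s , here refl , there (here refl)
    linked-mid a (x ∷ []) z l u z∉ (inj₂ (s≤s ())) p
    linked-mid a (x ∷ y ∷ xs) z (r ∷ s ∷ l) ((_ ∷ a≢y ∷ _) ∷ u) z∉ d (here refl) =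
      a , y , a≢y , r , s , here refl , there (here refl)
    linked-mid a (x ∷ xs@(_ ∷ _)) z (r ∷ l) (_ ∷ u) z∉ d (there p) =
      let (p , q , p≢q , r , s , p∈ , q∈) = linked-mid x xs z l u (z∉ ∘ there) (inj₁ (λ { refl → z∉ (here refl) })) p
      in p , q , p≢q , r , s , there p∈ , there q∈

    linked-last : ∀ x xs z → Linked R (x ∷ xs ++ [ z ]) → Σ[ p ∈ A ] p ∈ (x ∷ xs) × R p z
    linked-last x [] z (r ∷ [-]) = x , here refl , r
    linked-last x (y ∷ xs) z (_ ∷ l) = let (p , p∈ , r) = linked-last y xs z l in p , there p∈ , r

module _ {n} (G : Graph n) where

  Adj : Fin n → Fin n → Set
  Adj i j = adj G i j ≡ true

  cycle-nbrs : ∀ {vs x} → IsCycle G vs → x ∈ vs → Σ[ p ∈ Fin n ] Σ[ q ∈ Fin n ] p ≢ q × Adj x p × Adj x q × p ∈ vs × q ∈ vs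
  cycle-nbrs {_ ∷ []} (_ , s≤s () , _)
  cycle-nbrs {_ ∷ _ ∷ []} (_ , s≤s (s≤s ()) , _)
  cycle-nbrs {v ∷ w ∷ u ∷ vs} (uq , _ , es) x∈ with consec⇒Linked {R = Adj} _ es | uq | x∈
  ... | r ∷ s ∷ l | (_ ∷ _) ∷ (w∉ ∷ _) | here refl =
    let (p , p∈ , t) = linked-last u vs v l
    in w , p , (λ e → All.lookup w∉ p∈ e) , r , adj-swap G t , there (here refl) , there (there p∈)
  ... | l | v∉ ∷ _ | there x∈ =
    let (p , q , p≢q , r , s , p∈ , q∈) = linked-mid v (w ∷ u ∷ vs) v l uq (λ m → All.lookup v∉ m refl) (inj₂ (s≤s (s≤s z≤n))) x∈
    in p , q , p≢q , adj-swap G r , s , p∈ , back q∈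
    where
    back : ∀ {q} → q ∈ ((w ∷ u ∷ vs) ++ [ v ]) → q ∈ (v ∷ w ∷ u ∷ vs)
    back q∈ with ∈-++⁻ (w ∷ u ∷ vs) q∈
    ... | inj₁ m = there m
    ... | inj₂ (here refl) = here refl

  uses-∈ : ∀ (vs : List (Fin n)) {a b} → UsesEdge vs a b → a ∈ vs × b ∈ vs
  uses-∈ (v ∷ vs) u = go u
    where
    back : ∀ {q} → q ∈ (v ∷ vs ++ [ v ]) → q ∈ (v ∷ vs)
    back q∈ with ∈-++⁻ (v ∷ vs) q∈
    ... | inj₁ m = m
    ... | inj₂ (here refl) = here refl
    go : ∀ {a b} → UsesEdge (v ∷ vs) a b → a ∈ (v ∷ vs) × b ∈ (v ∷ vs)
    go (inj₁ p) = let (x , y) = consec-∈ _ p in back x , back y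
    go (inj₂ p) = let (x , y) = consec-∈ _ p in back y , back x
  uses-∈ [] (inj₁ ())
  uses-∈ [] (inj₂ ())

  -- Unlike `Reach`, the walk is confined to `S`: components have to be followed while vertices are
  -- deleted from `S`.
  data Path (S : VSet n) : Fin n → Fin n → Set where
    stop : ∀ {x} → S x ≡ true → Path S x x
    move : ∀ {x y z} → S x ≡ true → Adj x y → Path S y z → Path S x z

  path-src : ∀ {S x y} → Path S x y → S x ≡ true
  path-src (stop p) = p
  path-src (move p _ _) = p

  path-trans : ∀ {S x y z} → Path S x y → Path S y z → Path S x z
  path-trans (stop _) q = q
  path-trans (move a b p) q = move a b (path-trans p q)

  path-sym : ∀ {S x y} → Path S x y → Path S y x
  path-sym (stop p) = stop p
  path-sym (move a b p) = path-trans (path-sym p) (move (path-src p) (adj-swap G b) (stop a))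

  path-mono : ∀ {S S′ x y} → S ⊆ S′ → Path S x y → Path S′ x y
  path-mono h (stop p) = stop (h _ p)
  path-mono h (move p a q) = move (h _ p) a (path-mono h q)

  Reach⇒Path : ∀ {x y} → Reach G x y → Path full x y
  Reach⇒Path here = stop refl
  Reach⇒Path (step a r) = move refl a (Reach⇒Path r)

  Path⇒Reach : ∀ {S x y} → Path S x y → Reach G x y
  Path⇒Reach (stop _) = here
  Path⇒Reach (move _ a r) = step a (Path⇒Reach r)

  linked-path : ∀ {S x xs} → Linked Adj (x ∷ xs) → All (λ v → S v ≡ true) (x ∷ xs) → ∀ {y} → y ∈ (x ∷ xs) → Path S x y
  linked-path l (p ∷ ps) (here refl) = stop p
  linked-path (a ∷ l) (p ∷ ps) (there y∈) = move p a (linked-path l ps y∈)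

  cycle-path : ∀ {S vs x y} → IsCycle G vs → All (λ v → S v ≡ true) vs → x ∈ vs → y ∈ vs → Path S x y
  cycle-path {S} {v ∷ vs} (_ , _ , es) ps x∈ y∈ = path-trans (path-sym (from x∈)) (from y∈)
    where
    from : ∀ {y} → y ∈ (v ∷ vs) → Path S v y
    from m = linked-path (consec⇒Linked {R = Adj} _ es) (AllP.++⁺ ps (All.lookup ps (here refl) ∷ [])) (∈-++⁺ˡ m)

  upTo : ∀ {x : Fin n} {xs} → x ∈ xs → List (Fin n)
  upTo {x} (here _) = x ∷ []
  upTo {xs = y ∷ _} (there p) = y ∷ upTo p

  upTo-end : ∀ {x : Fin n} {xs} (p : x ∈ xs) → Σ[ ys ∈ List (Fin n) ] upTo p ≡ ys ++ [ x ]
  upTo-end (here _) = [] , refl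
  upTo-end {xs = y ∷ _} (there p) = let (ys , e) = upTo-end p in y ∷ ys , cong (y ∷_) e

  upTo-All : ∀ {ℓ} {P : Fin n → Set ℓ} {x xs} (p : x ∈ xs) → All P xs → All P (upTo p)
  upTo-All (here refl) (q ∷ _) = q ∷ []
  upTo-All (there p) (q ∷ qs) = q ∷ upTo-All p qs

  upTo-Unique : ∀ {x : Fin n} {xs} (p : x ∈ xs) → Unique xs → Unique (upTo p)
  upTo-Unique (here refl) (q ∷ _) = [] ∷ []
  upTo-Unique (there p) (q ∷ qs) = upTo-All p q ∷ upTo-Unique p qs

  upTo-Linked : ∀ {x a z xs} (p : x ∈ xs) → Linked Adj (a ∷ xs) → Adj x z → Linked Adj (a ∷ upTo p ++ [ z ])
  upTo-Linked (here refl) (r ∷ _) s = r ∷ s ∷ [-]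
  upTo-Linked (there p) (r ∷ l) s = r ∷ upTo-Linked p l s

  upTo-antisym : ∀ {x y : Fin n} {xs} → Unique xs → (p : x ∈ xs) (q : y ∈ xs) → x ∈ upTo q → y ∈ upTo p → x ≡ y
  upTo-antisym u (here refl) q _ (here refl) = refl
  upTo-antisym u (there p) (here refl) (here refl) _ = refl
  upTo-antisym (z∉ ∷ u) (there p) (there q) a b = upTo-antisym u p q (drop p a) (drop q b)
    where
    drop : ∀ {x} → x ∈ _ → ∀ {ys} → x ∈ (_ ∷ ys) → x ∈ ys
    drop m (here refl) = ⊥-elim (All.lookup z∉ m refl)
    drop m (there i) = i

  -- The cycle that a chord from the head `v` of the path `v, w, xs` to a later vertex `x` closes.
  loop : ∀ {v w x xs} → x ∈ xs → List (Fin n)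
  loop {v} {w} p = v ∷ w ∷ upTo p

  loop-cycle : ∀ {v w x xs} (p : x ∈ xs) → Unique (v ∷ w ∷ xs) → Linked Adj (v ∷ w ∷ xs) → Adj x v → IsCycle G (loop {v} {w} p)
  loop-cycle {v} {w} p (v∉@(v≢w ∷ v∉′) ∷ (w∉ ∷ u)) (r ∷ l) a =
    ((v≢w ∷ upTo-All p v∉′) ∷ (upTo-All p w∉ ∷ upTo-Unique p u)) , s≤s (s≤s (len p)) , Linked⇒consec (r ∷ upTo-Linked p l a)
    where
    len : ∀ {x : Fin n} {xs} (p : x ∈ xs) → 1 ≤ length (upTo p)
    len (here _) = s≤s z≤n
    len (there _) = s≤s z≤n

  loop-edge : ∀ {v w x xs} (p : x ∈ xs) → UsesEdge (loop {v} {w} p) v x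
  loop-edge {v} {w} p = let (ys , e) = upTo-end p in inj₂ (there (consec-last w ys e))

  -- The chord `vx` is an edge of the first cycle. Were it one of the second, `x` would come no
  -- later than `y` on the path; by symmetry `y` would come no later than `x`.
  loops-differ : ∀ {v w x y xs} (p : x ∈ xs) (q : y ∈ xs) → Unique (v ∷ w ∷ xs) → x ≢ y →
                 ¬ SameCycle (loop {v} {w} p) (loop {v} {w} q)
  loops-differ {v} {w} {x} {y} {xs} p q ((v≢w ∷ v∉) ∷ (w∉ ∷ u)) x≢y same = x≢y (upTo-antisym u p q
      (strip p (proj₂ (uses-∈ (loop {v} {w} q) (proj₁ (same v x) (loop-edge {v} {w} p)))))
      (strip q (proj₂ (uses-∈ (loop {v} {w} p) (proj₂ (same v y) (loop-edge {v} {w} q))))))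
    where
    strip : ∀ {x ys} → x ∈ xs → x ∈ (v ∷ w ∷ ys) → x ∈ ys
    strip m (here refl) = ⊥-elim (All.lookup v∉ m refl)
    strip m (there (here refl)) = ⊥-elim (All.lookup w∉ m refl)
    strip m (there (there i)) = i

  open DecMem {A = Fin n} _≟_ using (_∈?_)

  -- Maximality is asked for at the head only, since paths are prolonged only there.
  record MaxPath (S : VSet n) : Set where
    constructor maxPath
    field
      {v} : Fin n
      {vs} : List (Fin n)
      unique : Unique (v ∷ vs)
      linked : Linked Adj (v ∷ vs)
      inside : All (λ x → S x ≡ true) (v ∷ vs)
      maximal : ∀ {j} → Adj v j → S j ≡ true → j ∈ vs

  private
    grow : ∀ {S} fuel v vs → n ≤ fuel + length (v ∷ vs) → Unique (v ∷ vs) → Linked Adj (v ∷ vs) →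
           All (λ x → S x ≡ true) (v ∷ vs) → MaxPath S
    grow {S} fuel v vs h u l ins with pick (λ j → adj G v j ∧ (S j ∧ not (does (j ∈? (v ∷ vs)))))
    ... | inj₁ none = maxPath u l ins λ {j} a s → inj j a s (none j)
      where
      inj : ∀ j → Adj v j → S j ≡ true → (adj G v j ∧ (S j ∧ not (does (j ∈? (v ∷ vs))))) ≡ false → j ∈ vs
      inj j a s e with does-true (j ∈? (v ∷ vs)) (not-false (trans (sym (cong₂ (λ x y → x ∧ (y ∧ _)) a s)) e))
      ... | here refl = ⊥-elim (T≢F a (adj-irr G j))
      ... | there m = m
    grow {S} fuel v vs h u l ins | inj₂ (j , e) = next fuel h
      where
      a = proj₁ (∧-split {adj G v j} e)
      s = proj₁ (∧-split (proj₂ (∧-split {adj G v j} e)))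
      j∉ : j ∉ (v ∷ vs)
      j∉ = does-false (j ∈? (v ∷ vs)) (not-true (proj₂ (∧-split {S j} (proj₂ (∧-split {adj G v j} e)))))
      u′ : Unique (j ∷ v ∷ vs)
      u′ = AllP.¬Any⇒All¬ _ j∉ ∷ u
      next : ∀ fuel → n ≤ fuel + length (v ∷ vs) → MaxPath S
      -- The fuel and the length always add up to at least `n`, so without fuel there would be more
      -- than `n` distinct vertices.
      next zero h = ⊥-elim (<-irrefl refl (≤-trans (s≤s h)
          (≤-trans (list≤card full u′ (All.universal (λ _ → refl) _)) (card≤n full))))
      next (suc f) h = grow f j (v ∷ vs) (≤-trans h (≤-reflexive (sym (+-suc f _)))) u′ (adj-swap G a ∷ l) (s ∷ ins)

  max-path : ∀ {S v} → S v ≡ true → MaxPath S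
  max-path {v = v} p = grow n v [] (m≤m+n n 1) ([] ∷ []) [-] (p ∷ [])

  nbr : ∀ {v S} → 1 ≤ deg G v S → Σ[ w ∈ Fin n ] Adj v w × S w ≡ true
  nbr {v} {S} h = let (w , e) = card-pick (λ j → adj G v j ∧ S j) (≤-trans h (≤-reflexive (deg-def G v S))) in w , ∧-split e

  deg-rem-nbr : ∀ {v w} S → Adj v w → S w ≡ true → deg G v S ≡ suc (deg G v (rem w S))
  deg-rem-nbr {v} {w} S a s = trans (deg-def G v S) (trans (card-rem {z = w} _ (cong₂ _∧_ a s))
      (cong suc (trans (card-cong pt) (sym (deg-def G v (rem w S))))))
    where
    pt : rem w (λ j → adj G v j ∧ S j) ≗ (λ j → adj G v j ∧ rem w S j)
    pt j with j ≟ w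
    ... | yes refl = trans (rem-self j _) (sym (trans (cong (adj G v j ∧_) (rem-self j S)) (∧-zeroʳ (adj G v j))))
    ... | no p = trans (rem-≢ _ p) (cong (adj G v j ∧_) (sym (rem-≢ S p)))

  nbr-≢ : ∀ {v S} w → 2 ≤ deg G v S → Σ[ x ∈ Fin n ] x ≢ w × Adj v x × S x ≡ true
  nbr-≢ {v} {S} w h with dichotomy (adj G v w ∧ S w)
  ... | inj₁ e = let (a , s) = ∧-split {adj G v w} e
                     (x , b , t) = nbr {v} {rem w S} (≤-pred (≤-trans h (≤-reflexive (deg-rem-nbr S a s))))
                     (x≢w , sx) = rem-inv {X = S} t
                 in x , x≢w , b , sx
  ... | inj₂ e = let (x , b , t) = nbr {v} {S} (≤-trans (s≤s z≤n) h)
                 in x , (λ { refl → T≢F (cong₂ _∧_ b t) e }) , b , t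

  nbr-≢≢ : ∀ {v S} w u → 3 ≤ deg G v S → Σ[ x ∈ Fin n ] x ≢ w × x ≢ u × Adj v x × S x ≡ true
  nbr-≢≢ {v} {S} w u h with dichotomy (adj G v w ∧ S w)
  ... | inj₁ e = let (a , s) = ∧-split {adj G v w} e
                     (x , x≢u , b , t) = nbr-≢ {v} {rem w S} u (≤-pred (≤-trans h (≤-reflexive (deg-rem-nbr S a s))))
                     (x≢w , sx) = rem-inv {X = S} t
                 in x , x≢w , x≢u , b , sx
  ... | inj₂ e = let (x , x≢u , b , t) = nbr-≢ {v} {S} u (≤-trans (s≤s (s≤s z≤n)) h)
                 in x , (λ { refl → T≢F (cong₂ _∧_ b t) e }) , x≢u , b , t

  low-degree : ∀ S → (∀ v → S v ≡ true → 2 ≤ deg G v S) ⊎ Σ[ v ∈ Fin n ] S v ≡ true × deg G v S ≤ 1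
  low-degree S with pick (λ v → S v ∧ does (deg G v S ≤? 1))
  ... | inj₂ (v , e) = let (s , d) = ∧-split {S v} e in inj₂ (v , s , does-true (deg G v S ≤? 1) d)
  ... | inj₁ none = inj₁ λ v s → ≰⇒> (does-false (deg G v S ≤? 1) (trans (cong (λ x → x ∧ does (deg G v S ≤? 1)) (sym s)) (none v)))

  -- Each mark stands for a component of `S` without a cycle, and no component carries two marks;
  -- every mark improves the bound `card S` on the edges by one. One mark gives the bound for a
  -- forest, no mark the one for a graph with at most one cycle in each component.
  record Marks (S M : VSet n) : Set where
    constructor marks
    field
      sub : M ⊆ S
      apart : ∀ {x y} → M x ≡ true → M y ≡ true → Path S x y → x ≡ y
      acyclic : ∀ {x y vs} → M x ≡ true → IsCycle G vs → All (λ v → S v ≡ true) vs → y ∈ vs → ¬ Path S x y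

  CycleUnique : Set
  CycleUnique = ∀ {vs ws x y} → IsCycle G vs → IsCycle G ws → x ∈ vs → y ∈ ws → Path full x y → SameCycle vs ws

  module Upper (U : CycleUnique) where

    private
      -- All neighbours of the head `v` of a maximal path lie on the path. One chord closes a cycle;
      -- a third neighbour would close a different cycle in the same component, so `v` has degree 2.
      -- The only cycle of the component runs through `v`, so after the deletion of `v` the
      -- component of `w` is acyclic and `w` can be marked. The new mark pays for the second edge at
      -- `v`.
      tip : ∀ {S M} → Marks S M → (∀ v → S v ≡ true → 2 ≤ deg G v S) → MaxPath S →
            Σ[ v ∈ Fin n ] Σ[ w ∈ Fin n ] S v ≡ true × deg G v S ≡ 2 × Marks (rem v S) (add w M) × M v ≡ false × M w ≡ false
      tip {S} {M} (marks sub apart acyc) hi (maxPath {v} {[]} u l ins mx) with nbr {v} {S} (≤-trans (s≤s z≤n) (hi v (All.head ins)))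
      ... | w , a , s with () ← mx a s
      tip {S} {M} (marks sub apart acyc) hi (maxPath {v} {w ∷ vs} u l@(vw ∷ _) ins@(Sv ∷ Sw ∷ Svs) mx) =
        v , w , Sv , ≤-antisym (≮⇒≥ deg≮) (hi v Sv) , marks sub′ apart′ acyc′ , M∌ (here refl) , M∌ (there (here refl))
        where
        chord : ∀ {x} → x ≢ w → Adj v x → S x ≡ true → x ∈ vs
        chord x≢w a s with mx a s
        ... | here e = ⊥-elim (x≢w e)
        ... | there m = m
        x₁ = nbr-≢ {v} {S} w (hi v Sv)
        x₁≢w = proj₁ (proj₂ x₁)
        v~x₁ = proj₁ (proj₂ (proj₂ x₁))
        p₁ : proj₁ x₁ ∈ vs
        p₁ = chord x₁≢w v~x₁ (proj₂ (proj₂ (proj₂ x₁)))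
        c₁ : List (Fin n)
        c₁ = loop {v} {w} p₁
        cyc₁ : IsCycle G c₁
        cyc₁ = loop-cycle p₁ u l (adj-swap G v~x₁)
        ins₁ : All (λ x → S x ≡ true) c₁
        ins₁ = Sv ∷ Sw ∷ upTo-All p₁ Svs
        deg≮ : ¬ (2 < deg G v S)
        deg≮ h = let (x₂ , x₂≢w , x₂≢x₁ , a , s) = nbr-≢≢ {v} {S} w (proj₁ x₁) h
                     p₂ = chord x₂≢w a s
                 in loops-differ p₁ p₂ u (λ e → x₂≢x₁ (sym e))
                      (U cyc₁ (loop-cycle p₂ u l (adj-swap G a)) (here refl) (here refl) (stop refl))
        M∌ : ∀ {x} → x ∈ c₁ → M x ≡ false
        M∌ {x} m with M x in e
        ... | false = refl
        ... | true = ⊥-elim (acyc e cyc₁ ins₁ m (stop (sub x e)))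
        sub′ : add w M ⊆ rem v S
        sub′ i e with add-inv {X = M} e
        ... | inj₁ refl = rem-in S (λ q → adj-≢ G vw (sym q)) Sw
        ... | inj₂ m = rem-in S (λ { refl → T≢F m (M∌ (here refl)) }) (sub i m)
        far : ∀ {x} → M x ≡ true → ¬ Path (rem v S) x w
        far m p = acyc m cyc₁ ins₁ (there (here refl)) (path-mono rem-⊆ p)
        apart′ : ∀ {x y} → add w M x ≡ true → add w M y ≡ true → Path (rem v S) x y → x ≡ y
        apart′ a b p with add-inv {X = M} a | add-inv {X = M} b
        ... | inj₁ refl | inj₁ refl = refl
        ... | inj₁ refl | inj₂ m = ⊥-elim (far m (path-sym p))
        ... | inj₂ m | inj₁ refl = ⊥-elim (far m p)
        ... | inj₂ m | inj₂ m′ = apart m m′ (path-mono rem-⊆ p)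
        acyc′ : ∀ {x y vs} → add w M x ≡ true → IsCycle G vs → All (λ v′ → rem v S v′ ≡ true) vs → y ∈ vs → ¬ Path (rem v S) x y
        acyc′ {vs = vs} a cyc insd y∈ p with add-inv {X = M} a
        ... | inj₂ m = acyc m cyc (All.map (λ {x} → rem-⊆ x) insd) y∈ (path-mono rem-⊆ p)
        ... | inj₁ refl = T≢F (All.lookup insd (proj₁ (uses-∈ vs
            (proj₁ (U cyc₁ cyc (there (here refl)) y∈ (path-mono (λ _ _ → refl) p) v _) (loop-edge {v} {w} p₁)))))
                              (rem-self v S)

      drop-marks : ∀ {S M v} → Marks S M → M v ≡ false → Marks (rem v S) M
      drop-marks {S} {M} {v} (marks sub apart acyc) Mv = marks
        (λ i m → rem-in S (λ { refl → T≢F m Mv }) (sub i m))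
        (λ a b p → apart a b (path-mono rem-⊆ p))
        (λ a c ins y∈ p → acyc a c (All.map (λ {x} → rem-⊆ x) ins) y∈ (path-mono rem-⊆ p))

      rem-mark : ∀ {S M v} → Marks S M → Marks (rem v S) (rem v M)
      rem-mark {S} {M} {v} (marks sub apart acyc) = marks
        (λ i m → let (i≢v , m′) = rem-inv {X = M} m in rem-in S i≢v (sub i m′))
        (λ a b p → apart (rem-⊆ _ a) (rem-⊆ _ b) (path-mono rem-⊆ p))
        (λ a c ins y∈ p → acyc (rem-⊆ _ a) c (All.map (λ {x} → rem-⊆ x) ins) y∈ (path-mono rem-⊆ p))

      -- What remains of the component of `v` around `w` is still acyclic and free of other marks,
      -- so the mark survives the deletion of `v`.
      move-mark : ∀ {S M v w} → Marks S M → M v ≡ true → Adj v w → S w ≡ true →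
                  Marks (rem v S) (add w (rem v M)) × rem v M w ≡ false
      move-mark {S} {M} {v} {w} (marks sub apart acyc) Mv vw Sw = marks sub′ apart′ acyc′ , Mw
        where
        to : ∀ {y} → Path S w y → Path S v y
        to = move (sub v Mv) vw
        Mw : rem v M w ≡ false
        Mw = ≢true λ e → let (w≢v , m) = rem-inv {X = M} e in w≢v (sym (apart Mv m (to (stop Sw))))
        sub′ : add w (rem v M) ⊆ rem v S
        sub′ i e with add-inv {X = rem v M} e
        ... | inj₁ refl = rem-in S (λ q → adj-≢ G vw (sym q)) Sw
        ... | inj₂ m = let (i≢v , m′) = rem-inv {X = M} m in rem-in S i≢v (sub i m′)
        apart′ : ∀ {x y} → add w (rem v M) x ≡ true → add w (rem v M) y ≡ true → Path (rem v S) x y → x ≡ y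
        apart′ a b p with add-inv {X = rem v M} a | add-inv {X = rem v M} b
        ... | inj₁ refl | inj₁ refl = refl
        ... | inj₁ refl | inj₂ m = let (y≢v , m′) = rem-inv {X = M} m in ⊥-elim (y≢v (sym (apart Mv m′ (to (path-mono rem-⊆ p)))))
        ... | inj₂ m | inj₁ refl = let (x≢v , m′) = rem-inv {X = M} m in ⊥-elim (x≢v (sym (apart Mv m′ (to (path-sym (path-mono rem-⊆ p))))))
        ... | inj₂ m | inj₂ m′ = apart (rem-⊆ _ m) (rem-⊆ _ m′) (path-mono rem-⊆ p)
        acyc′ : ∀ {x y vs} → add w (rem v M) x ≡ true → IsCycle G vs → All (λ v′ → rem v S v′ ≡ true) vs → y ∈ vs → ¬ Path (rem v S)
            x y
        acyc′ a c ins y∈ p with add-inv {X = rem v M} a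
        ... | inj₁ refl = acyc Mv c (All.map (λ {x} → rem-⊆ x) ins) y∈ (to (path-mono rem-⊆ p))
        ... | inj₂ m = acyc (rem-⊆ _ m) c (All.map (λ {x} → rem-⊆ x) ins) y∈ (path-mono rem-⊆ p)

      bound : ∀ k {S M} → card S ≡ k → Marks S M → E G S + card M ≤ card S
      -- Deleting `v` lowers `card S` by one and the edge count by the degree of `v`; the change in
      -- the number of marks has to make up the difference.
      remove : ∀ k {S M v M′} → card S ≡ suc k → S v ≡ true → Marks (rem v S) M′ → deg G v S + card M ≤ suc (card M′) →
               E G S + card M ≤ card S
      remove k {S} {M} {v} {M′} e Sv mk h = begin
        E G S + card M                                   ≡⟨ cong (_+ card M)
            (trans (E-rem G S Sv) (cong (E G (rem v S) +_) (deg-rem G {v} {S}))) ⟩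
        E G (rem v S) + deg G v S + card M               ≡⟨ +-assoc (E G (rem v S)) _ _ ⟩
        E G (rem v S) + (deg G v S + card M)             ≤⟨ +-monoʳ-≤ (E G (rem v S)) h ⟩
        E G (rem v S) + suc (card M′)                    ≡⟨ +-suc _ _ ⟩
        suc (E G (rem v S) + card M′)                    ≤⟨ s≤s (bound k (suc-injective (trans (sym (card-rem S Sv)) e)) mk) ⟩
        suc (card (rem v S))                             ≡⟨ sym (card-rem S Sv) ⟩
        card S                                           ∎
        where open ≤-Reasoning
      bound zero {S} {M} e mk = ≤-trans (≤-reflexive (cong₂ _+_ (E-empty G Sø) (card-empty {X = M} Mø))) z≤n
        where
        Sø = card≡0 {X = S} e
        Mø : ∀ i → M i ≡ false
        Mø i = ≢true λ m → T≢F (Marks.sub mk i m) (Sø i)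
      bound (suc k) {S} {M} e mk with low-degree S
      ... | inj₁ hi = let (v , w , Sv , d , mk′ , Mv , Mw) = tip mk hi (max-path (proj₂ (card-pick S (≤-trans (s≤s z≤n) (≤-reflexive (sym e))))))
                      in remove k e Sv mk′ (≤-reflexive (trans (cong (_+ card M) d) (cong suc (sym (card-add M Mw)))))
      ... | inj₂ (v , Sv , d) with dichotomy (M v)
      ...   | inj₂ Mv = remove k e Sv (drop-marks mk Mv) (+-monoˡ-≤ (card M) d)
      ...   | inj₁ Mv with deg G v S in eq
      ...     | zero = remove k {S} {M} e Sv (rem-mark mk) (≤-reflexive (trans (cong (_+ card M) eq) (card-rem M Mv)))
      ...     | suc zero = let (w , vw , Sw) = nbr {v} {S} (≤-reflexive (sym eq))
                               (mk′ , Mw) = move-mark mk Mv vw Sw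
                           in remove k {S} {M} e Sv mk′ (≤-reflexive
                               (trans (cong (_+ card M) eq) (cong suc (trans (card-rem M Mv) (sym (card-add (rem v M) Mw))))))
      bound (suc k) {S} {M} e mk | inj₂ (v , Sv , s≤s ()) | inj₁ Mv | suc (suc _)

    upper : ∀ {S M} → Marks S M → E G S + card M ≤ card S
    upper = bound _ refl

  -- The counterpart of `Marks` for the opposite inequality: a component may fall short of as many
  -- edges as vertices only if it has a root in `R`. One root gives the bound for connected graphs,
  -- no root the one for graphs with a cycle in every component.
  Anchored : VSet n → VSet n → Set
  Anchored S R = ∀ {x} → S x ≡ true → (Σ[ r ∈ Fin n ] R r ≡ true × Path S x r) ⊎
    (Σ[ vs ∈ List (Fin n) ] Σ[ y ∈ Fin n ] IsCycle G vs × All (λ v → S v ≡ true) vs × y ∈ vs × Path S x y)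

  private
    two-nbrs : ∀ {v S p q} → p ≢ q → Adj v p → Adj v q → S p ≡ true → S q ≡ true → 2 ≤ deg G v S
    two-nbrs {S = S} p≢q a b s t = list≤deg G S ((p≢q ∷ []) ∷ ([] ∷ [])) ((a , s) ∷ (b , t) ∷ [])

    -- A walk that enters a vertex of degree at most one has to leave it to where it came from, so
    -- the detour can be cut out.
    avoid : ∀ {S v x y} → deg G v S ≤ 1 → x ≢ v → y ≢ v → Path S x y → Path (rem v S) x y
    avoid {S} d x≢ y≢ (stop s) = stop (rem-in S x≢ s)
    avoid {S} {v} d x≢ y≢ (move {y = z} s a p) with z ≟ v
    ... | no z≢ = move (rem-in S x≢ s) a (avoid d z≢ y≢ p)
    avoid {S} {v} d x≢ y≢ (move s a (stop _)) | yes refl = ⊥-elim (y≢ refl)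
    avoid {S} {v} {x} d x≢ y≢ (move {y = z} s a (move {y = w} s′ b p)) | yes refl with w ≟ x
    ... | yes refl = avoid d x≢ y≢ p
    ... | no w≢x = ⊥-elim (<-irrefl refl (≤-trans (two-nbrs {S = S} w≢x b (adj-swap G a) (path-src p) s) d))

    off-cycle : ∀ {S v vs} → deg G v S ≤ 1 → IsCycle G vs → All (λ v → S v ≡ true) vs → v ∉ vs
    off-cycle {S} d c ins m = let (p , q , p≢q , a , b , p∈ , q∈) = cycle-nbrs c m
      in <-irrefl refl (≤-trans (two-nbrs {S = S} p≢q a b (All.lookup ins p∈) (All.lookup ins q∈)) d)

    Anchored-rem : ∀ {S R R′ v} → deg G v S ≤ 1 → (∀ {r} → r ≢ v → R r ≡ true → R′ r ≡ true) →
      (∀ {x} → x ≢ v → R v ≡ true → Path S x v → Σ[ r ∈ Fin n ] R′ r ≡ true × Path (rem v S) x r) → Anchored S R → Anchored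
          (rem v S) R′
    Anchored-rem {S} {v = v} d keep redirect h {x} s with rem-inv {X = S} s
    ... | x≢ , Sx with h Sx
    ...   | inj₂ (vs , y , c , ins , y∈ , p) = inj₂ (vs , y , c , ins′ , y∈ , avoid d x≢ (λ { refl → v∉ y∈ }) p)
      where
      v∉ = off-cycle d c ins
      ins′ = All.tabulate (λ {z} z∈ → rem-in S (λ { refl → v∉ z∈ }) (All.lookup ins z∈))
    ...   | inj₁ (r , Rr , p) with r ≟ v
    ...     | no r≢ = inj₁ (r , keep r≢ Rr , avoid d x≢ r≢ p)
    ...     | yes refl = inj₁ (redirect x≢ Rr p)

    card-add≤ : ∀ w (X : VSet n) → card (add w X) ≤ suc (card X)
    card-add≤ w X with dichotomy (X w)
    ... | inj₂ e = ≤-reflexive (card-add X e)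
    ... | inj₁ e = ≤-trans (card-mono {X = add w X} (λ i m → sub i (add-inv {X = X} m))) (n≤1+n _)
      where
      sub : ∀ i → i ≡ w ⊎ X i ≡ true → X i ≡ true
      sub i (inj₁ refl) = e
      sub i (inj₂ m) = m

    lbound : ∀ k {S R} → card S ≡ k → Anchored S R → card S ≤ E G S + card R
    lremove : ∀ k {S R R′ v} → card S ≡ suc k → S v ≡ true → Anchored (rem v S) R′ → suc (card R′) ≤ deg G v S + card R → card S ≤ E
        G S + card R
    lremove k {S} {R} {R′} {v} e Sv an h = begin
      card S                                  ≡⟨ card-rem S Sv ⟩
      suc (card (rem v S))                    ≤⟨ s≤s (lbound k (suc-injective (trans (sym (card-rem S Sv)) e)) an) ⟩
      suc (E G (rem v S) + card R′)           ≡⟨ sym (+-suc _ _) ⟩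
      E G (rem v S) + suc (card R′)           ≤⟨ +-monoʳ-≤ (E G (rem v S)) h ⟩
      E G (rem v S) + (deg G v S + card R)    ≡⟨ sym (+-assoc (E G (rem v S)) _ _) ⟩
      E G (rem v S) + deg G v S + card R      ≡⟨ cong (_+ card R)
          (sym (trans (E-rem G S Sv) (cong (E G (rem v S) +_) (deg-rem G {v} {S})))) ⟩
      E G S + card R                          ∎
      where open ≤-Reasoning
    lbound zero e an = ≤-trans (≤-reflexive e) z≤n
    lbound (suc k) {S} {R} e an with low-degree S
    -- With minimum degree 2 the handshake identity already yields `card S ≤ E G S`.
    ... | inj₁ hi = ≤-trans (half (card S) (E G S) (≤-trans (vol≥ G S S 2 hi) (≤-reflexive (handshake G S)))) (m≤m+n _ _)
      where
      half : ∀ a b → a * 2 ≤ b + b → a ≤ b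
      half a b h = *-cancelʳ-≤ a b 2 (≤-trans h (≤-reflexive (trans (cong (b +_) (sym (+-identityʳ b))) (*-comm 2 b))))
    ... | inj₂ (v , Sv , d) with deg G v S in eq
    ...   | suc (suc _) = ⊥-elim (1+n≰n (≤-trans (s≤s z≤n) (≤-pred d)))
    ...   | zero = lremove k e Sv (Anchored-rem (≤-trans (≤-reflexive eq) z≤n) (λ r≢ m → rem-in R r≢ m)
                       (λ x≢ _ p → ⊥-elim (isolated x≢ (path-sym p))) an)
                     (≤-reflexive (trans (sym (card-rem R Rv)) (cong (_+ card R) (sym eq))))
      where
      no-nbr : ∀ {w} → Adj v w → S w ≡ true → ⊥
      no-nbr a s with () ← ≤-trans (list≤deg G S ([] ∷ []) ((a , s) ∷ [])) (≤-reflexive eq)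
      isolated : ∀ {x} → x ≢ v → ¬ Path S v x
      isolated x≢ (stop _) = x≢ refl
      isolated x≢ (move _ a p) = no-nbr a (path-src p)
      -- An isolated vertex can be anchored only at itself, so it is a root.
      Rv : R v ≡ true
      Rv with an Sv
      ... | inj₁ (r , Rr , stop _) = Rr
      ... | inj₁ (r , Rr , move _ a p) = ⊥-elim (no-nbr a (path-src p))
      ... | inj₂ (vs , y , c , ins , y∈ , move _ a p) = ⊥-elim (no-nbr a (path-src p))
      ... | inj₂ (vs , y , c , ins , y∈ , stop _) = ⊥-elim (off-cycle (≤-trans (≤-reflexive eq) z≤n) c ins y∈)
    ...   | suc zero with nbr {v} {S} (≤-reflexive (sym eq)) | dichotomy (R v)
    -- A root at a leaf moves to the neighbour `w`. Roots need not lie in different components, so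
    -- `w` may be one already; `card-add≤` allows for that.
    ...     | w , vw , Sw | inj₁ Rv = lremove k e Sv
                (Anchored-rem (≤-reflexive eq) (λ r≢ m → add-old w (rem v R) (rem-in R r≢ m))
                  (λ x≢ _ p → w , add-new w _ , avoid (≤-reflexive eq) x≢ w≢v (path-trans p (move Sv vw (stop Sw)))) an)
                (≤-trans (s≤s (card-add≤ w (rem v R))) (≤-reflexive
                    (trans (cong suc (sym (card-rem R Rv))) (cong (_+ card R) (sym eq)))))
      where
      w≢v : w ≢ v
      w≢v q = adj-≢ G vw (sym q)
    ...     | w , vw , Sw | inj₂ Rv = lremove k e Sv
                (Anchored-rem (≤-reflexive eq) (λ _ m → m) (λ _ m _ → ⊥-elim (T≢F m Rv)) an)
                (≤-reflexive (cong (_+ card R) (sym eq)))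

  lower : ∀ {S R} → Anchored S R → card S ≤ E G S + card R
  lower = lbound _ refl

opaque
  unfolding E

  E-union : ∀ {n} (G T P : Graph n) → (∀ i j → adj G i j ≡ (adj T i j ∨ adj P i j)) → (∀ i j → (adj T i j ∧ adj P i j) ≡ false) →
            ∀ X → E G X ≡ E T X + E P X
  E-union G T P h d X = trans (∑-cong λ i → trans (∑-cong λ j → trans
      (cong (λ a → b2n (((toℕ i <ᵇ toℕ j) ∧ a) ∧ (X i ∧ X j))) (h i j))
      (pt (toℕ i <ᵇ toℕ j) (adj T i j) (adj P i j) (X i ∧ X j) (d i j))) (∑-+ _ _)) (∑-+ _ _)
    where
    pt : ∀ l a b x → (a ∧ b) ≡ false → b2n ((l ∧ (a ∨ b)) ∧ x) ≡ b2n ((l ∧ a) ∧ x) + b2n ((l ∧ b) ∧ x)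
    pt false a b x e = refl
    pt true true true x ()
    pt true true false x e = sym (+-identityʳ _)
    pt true false b x e = refl

-- Induced subgraphs are the extreme case, as they have the most edges on given vertices. Nonempty
-- sets without edges satisfy the bound anyway, so nonemptiness can replace the presence of an edge.
SparseOn : ∀ {n} → Graph n → Set
SparseOn {n} G = ∀ X → 1 ≤ card X → E G X + 1 ≤ 2 * card X

TreePlusUnicyclic⇒sparse : ∀ {n} {G : Graph n} → TreePlusUnicyclic G → SparseOn G × E G full + 1 ≡ 2 * card (full {n})
TreePlusUnicyclic⇒sparse {n} {G} (T , P , cover , disj , ((r , conn) , acyc) , uni) = sparse , ≤-antisym
    (sparse full (card-∈ {X = full} {r} refl)) dense
  where
  upT : ∀ X → 1 ≤ card X → E T X + 1 ≤ card X
  upT X h = let (x , m) = card-pick X h in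
    ≤-trans (≤-reflexive (cong (E T X +_) (sym (one x)))) (Upper.upper T (λ c → ⊥-elim (acyc _ c)) (marks {M = add x (λ _ → false)}
      (λ i e → [ (λ { refl → m }) , (λ ()) ]′ (add-inv {X = λ _ → false} e))
      (λ a b _ → trans (only a) (sym (only b)))
      (λ _ c → ⊥-elim (acyc _ c))))
    where
    only : ∀ {x y} → add x (λ _ → false) y ≡ true → y ≡ x
    only e with add-inv {X = λ _ → false} e
    ... | inj₁ q = q
    one : ∀ x → card (add x (λ _ → false)) ≡ 1
    one x = trans (card-add {z = x} (λ _ → false) refl) (cong suc (card-empty {n} {λ _ → false} (λ _ → refl)))
  U : CycleUnique P
  U {vs} {ws} {x} {y} c d x∈ y∈ p = proj₂ (uni x) vs ws c
    (All.tabulate λ z∈ → Path⇒Reach P {full} (cycle-path P c (All.universal (λ _ → refl) _) x∈ z∈)) d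
    (All.tabulate λ z∈ → Path⇒Reach P {full} (path-trans P p (cycle-path P d (All.universal (λ _ → refl) _) y∈ z∈)))
  upP : ∀ X → E P X ≤ card X
  upP X = ≤-trans (≤-reflexive (trans (sym (+-identityʳ _)) (cong (E P X +_) (sym (card-empty {X = λ _ → false} (λ _ → refl))))))
    (Upper.upper P U (marks {S = X} {M = λ _ → false} (λ _ ()) (λ ()) (λ ())))
  sparse : SparseOn G
  sparse X h = ≤-trans (≤-reflexive (trans (cong (_+ 1) (trans (E-union G T P cover disj X) (+-comm (E T X) (E P X))))
      (+-assoc (E P X) _ _)))
    (≤-trans (+-mono-≤ (upP X) (upT X h)) (≤-reflexive (cong (card X +_) (sym (+-identityʳ (card X))))))
  lowT : card (full {n}) ≤ E T full + 1
  lowT = ≤-trans (lower T {full} {add r (λ _ → false)} (λ {x} _ → inj₁ (r , add-new r _ , Reach⇒Path T (conn x r))))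
    (+-monoʳ-≤ (E T full) (≤-reflexive (trans (card-add {z = r} (λ _ → false) refl)
        (cong suc (card-empty {n} {λ _ → false} (λ _ → refl))))))
  cyc-at : ∀ {x} → Σ[ vs ∈ List (Fin n) ] IsCycle P vs × All (Reach P x) vs →
           Σ[ vs ∈ List (Fin n) ] Σ[ y ∈ Fin n ] IsCycle P vs × All (λ _ → true ≡ true) vs × y ∈ vs × Path P full x y
  cyc-at (v ∷ vs , c , r ∷ rs) = v ∷ vs , v , c , All.universal (λ _ → refl) _ , here refl , Reach⇒Path P r
  cyc-at ([] , (_ , () , _) , _)
  lowP : card (full {n}) ≤ E P full
  lowP = ≤-trans (lower P {full} {λ _ → false} (λ {x} _ → inj₂ (cyc-at (proj₁ (uni x)))))
    (≤-reflexive (trans (cong (E P full +_) (card-empty {X = λ _ → false} (λ _ → refl))) (+-identityʳ _)))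
  dense : 2 * card (full {n}) ≤ E G full + 1
  dense = ≤-trans (≤-reflexive (cong (card (full {n}) +_) (+-identityʳ _))) (≤-trans (+-mono-≤ lowP lowT)
    (≤-reflexive (trans (sym (+-assoc (E P full) _ _)) (cong (_+ 1)
        (trans (+-comm (E P full) _) (sym (E-union G T P cover disj full)))))))

-- Relabelling and induced subgraphs

pullback : ∀ {m n} → Graph n → (Fin m → Fin n) → Graph m
pullback G φ = record { adj = λ i j → adj G (φ i) (φ j) ; adj-sym = λ i j → adj-sym G _ _ ; adj-irr = λ i → adj-irr G _ }

module _ {m n} (G : Graph m) (H : Graph n) (I : Iso G H) where

  private
    f = proj₁ I
    g = proj₁ (proj₂ I)
    gf = proj₁ (proj₂ (proj₂ I))
    fg = proj₁ (proj₂ (proj₂ (proj₂ I)))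
    π : Permutation m n
    π = permutation f g fg gf

  iso-sym : Iso H G
  iso-sym = g , f , fg , gf , λ i j → trans (sym (proj₂ (proj₂ (proj₂ (proj₂ I))) (g i) (g j))) (cong₂ (adj H) (fg i) (fg j))

  opaque
    unfolding card

    iso-card : ∀ X → card X ≡ card (X ∘ f)
    iso-card X = ∑-permute (λ i → b2n (X i)) π

  -- The edge count compares the indices of the two ends, an order that a relabelling need not
  -- respect. The symmetric count `vol` is invariant, and the handshake identity halves it.
  iso-E : ∀ X → E H X ≡ E G (X ∘ f)
  iso-E X = *-cancelˡ-≡ _ _ 2 (trans (two (E H X)) (trans (sym (handshake H X)) (trans (vol-∑∑ H X X) (trans (∑-permute _ π)
    (trans (∑-cong λ i → trans (∑-permute _ π) (∑-cong λ j → cong (λ a → b2n (a ∧ (X (f i) ∧ X (f j))))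
        (proj₂ (proj₂ (proj₂ (proj₂ I))) i j)))
    (trans (sym (vol-∑∑ G (X ∘ f) (X ∘ f))) (trans (handshake G (X ∘ f)) (sym (two (E G (X ∘ f)))))))))))
    where
    two : ∀ a → 2 * a ≡ a + a
    two a = cong (a +_) (+-identityʳ a)

  iso-sparse : SparseOn G → SparseOn H
  iso-sparse s X h = subst (λ e → e + 1 ≤ 2 * card X) (sym (iso-E X))
    (subst (λ c → E G (X ∘ f) + 1 ≤ 2 * c) (sym (iso-card X)) (s (X ∘ f) (subst (1 ≤_) (iso-card X) h)))

  iso-full : E G full + 1 ≡ 2 * card (full {m}) → E H full + 1 ≡ 2 * card (full {n})
  iso-full e = trans (cong (_+ 1) (iso-E full)) (trans e (cong (2 *_) (sym (iso-card full))))

module _ {m k : ℕ} where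

  opaque
    unfolding ∑

    ∑-↑ : (f : Fin (m + k) → ℕ) → ∑ f ≡ ∑ (λ a → f (a ↑ˡ k)) + ∑ (λ i → f (m ↑ʳ i))
    ∑-↑ f = go m f
      where
      go : ∀ m (f : Fin (m + k) → ℕ) → ∑ f ≡ ∑ (λ a → f (a ↑ˡ k)) + ∑ (λ i → f (m ↑ʳ i))
      go zero f = refl
      go (suc m) f = trans (cong (f zero +_) (go m (f ∘ suc))) (sym (+-assoc (f zero) _ _))

  data Side : Fin (m + k) → Set where
    isOld : ∀ a → Side (a ↑ˡ k)
    isNew : ∀ i → Side (m ↑ʳ i)

  side : ∀ v → Side v
  side v with splitAt m v in e
  ... | inj₁ a = subst Side (splitAt⁻¹-↑ˡ e) (isOld a)
  ... | inj₂ i = subst Side (splitAt⁻¹-↑ʳ e) (isNew i)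

  old≢new : ∀ {a i} → a ↑ˡ k ≢ m ↑ʳ i
  old≢new {a} {i} e with trans (sym (splitAt-↑ˡ m a k)) (trans (cong (splitAt m) e) (splitAt-↑ʳ m k i))
  ... | ()

  ↑ˡ-inj : ∀ {a b : Fin m} → a ↑ˡ k ≡ b ↑ˡ k → a ≡ b
  ↑ˡ-inj {a} {b} e with trans (sym (splitAt-↑ˡ m a k)) (trans (cong (splitAt m) e) (splitAt-↑ˡ m b k))
  ... | refl = refl

  ↑ʳ-inj : ∀ {i j : Fin k} → m ↑ʳ i ≡ m ↑ʳ j → i ≡ j
  ↑ʳ-inj {i} {j} e with trans (sym (splitAt-↑ʳ m k i)) (trans (cong (splitAt m) e) (splitAt-↑ʳ m k j))
  ... | refl = refl

  opaque
    unfolding card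

    card-↑ : (Y : VSet (m + k)) → card Y ≡ card (Y ∘ (_↑ˡ k)) + card (Y ∘ (m ↑ʳ_))
    card-↑ Y = ∑-↑ _

  module _ (G : Graph (m + k)) where

    opaque
      unfolding E

      E-old : (Y : VSet (m + k)) → (∀ i → Y (m ↑ʳ i) ≡ false) → E G Y ≡ E (pullback G (_↑ˡ k)) (Y ∘ (_↑ˡ k))
      E-old Y h = trans (∑-↑ _) (trans (cong₂ _+_
          (∑-cong λ a → trans (∑-↑ _) (trans (cong₂ _+_
              (∑-cong λ b → cong₂ (λ x y → b2n (((x <ᵇ y) ∧ adj G (a ↑ˡ k) (b ↑ˡ k)) ∧ (Y (a ↑ˡ k) ∧ Y (b ↑ˡ k)))) (toℕ-↑ˡ a k)
              (toℕ-↑ˡ b k))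
             (∑-zero λ i → off (c (a ↑ˡ k) (m ↑ʳ i)) (Y (a ↑ˡ k)) (h i))) (+-identityʳ _)))
          (∑-zero λ i → ∑-zero λ j → off′ (c (m ↑ʳ i) j) (Y j) (h i))) (+-identityʳ _))
        where
        c : Fin (m + k) → Fin (m + k) → Bool
        c i j = (toℕ i <ᵇ toℕ j) ∧ adj G i j
        off : ∀ c x {y} → y ≡ false → b2n (c ∧ (x ∧ y)) ≡ 0
        off c x refl rewrite ∧-zeroʳ x | ∧-zeroʳ c = refl
        off′ : ∀ c y {x} → x ≡ false → b2n (c ∧ (x ∧ y)) ≡ 0
        off′ c x refl rewrite ∧-zeroʳ c = refl

      E-new : (Y : VSet (m + k)) → (∀ a → Y (a ↑ˡ k) ≡ false) → E G Y ≡ E (pullback G (m ↑ʳ_)) (Y ∘ (m ↑ʳ_))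
      E-new Y h = trans (∑-↑ _) (cong₂ _+_ (∑-zero λ a → ∑-zero λ j → off′ (c (a ↑ˡ k) j) (Y j) (h a))
          (∑-cong λ i → trans (∑-↑ _) (cong₂ _+_ (∑-zero λ a → off (c (m ↑ʳ i) (a ↑ˡ k)) (Y (m ↑ʳ i)) (h a))
            (∑-cong λ j → cong (λ l → b2n ((l ∧ adj G (m ↑ʳ i) (m ↑ʳ j)) ∧ (Y (m ↑ʳ i) ∧ Y (m ↑ʳ j))))
               (trans (cong₂ _<ᵇ_ (toℕ-↑ʳ m i) (toℕ-↑ʳ m j)) (shift m _ _))))))
        where
        c : Fin (m + k) → Fin (m + k) → Bool
        c i j = (toℕ i <ᵇ toℕ j) ∧ adj G i j
        off : ∀ c x {y} → y ≡ false → b2n (c ∧ (x ∧ y)) ≡ 0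
        off c x refl rewrite ∧-zeroʳ x | ∧-zeroʳ c = refl
        off′ : ∀ c y {x} → x ≡ false → b2n (c ∧ (x ∧ y)) ≡ 0
        off′ c x refl rewrite ∧-zeroʳ c = refl
        shift : ∀ m a b → (m + a <ᵇ m + b) ≡ (a <ᵇ b)
        shift zero a b = refl
        shift (suc m) a b = shift m a b

Inj : ∀ {m n} → (Fin m → Fin n) → Set
Inj φ = ∀ {i j} → φ i ≡ φ j → i ≡ j

image : ∀ {m n} → (Fin m → Fin n) → VSet n
image φ j = does (any? (λ i → φ i ≟ j))

image-∈ : ∀ {m n} (φ : Fin m → Fin n) i → image φ (φ i) ≡ true
image-∈ φ i = dec-true (any? _) (i , refl)

image-inv : ∀ {m n} {φ : Fin m → Fin n} {j} → image φ j ≡ true → Σ[ i ∈ Fin m ] φ i ≡ j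
image-inv {φ = φ} e = does-true (any? (λ i → φ i ≟ _)) e

-- The moves expect the vertices in the form `m + k`, old ones first. A partition of the vertices
-- into the images of `φ` and `ψ` brings any graph into that form by the relabelling `glue`.
record Split {m k n} (φ : Fin m → Fin n) (ψ : Fin k → Fin n) : Set where
  field
    φ-inj : Inj φ
    ψ-inj : Inj ψ
    apart : ∀ {i j} → φ i ≢ ψ j
    cover : ∀ v → (Σ[ i ∈ Fin m ] φ i ≡ v) ⊎ (Σ[ j ∈ Fin k ] ψ j ≡ v)

  glue : Fin (m + k) → Fin n
  glue = φ ⊕ ψ

  glue-old : ∀ a → glue (a ↑ˡ k) ≡ φ a
  glue-old = ⊕-old φ ψ

  glue-new : ∀ i → glue (m ↑ʳ i) ≡ ψ i
  glue-new = ⊕-new φ ψ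

  unglue : Fin n → Fin (m + k)
  unglue v with cover v
  ... | inj₁ (i , _) = i ↑ˡ k
  ... | inj₂ (j , _) = m ↑ʳ j

  glue-unglue : ∀ v → glue (unglue v) ≡ v
  glue-unglue v with cover v
  ... | inj₁ (i , e) = trans (glue-old i) e
  ... | inj₂ (j , e) = trans (glue-new j) e

  glue-inj : Inj glue
  glue-inj {i} {j} e with side {m} {k} i | side {m} {k} j
  ... | isOld a | isOld b = cong (_↑ˡ k) (φ-inj (trans (sym (glue-old a)) (trans e (glue-old b))))
  ... | isOld a | isNew b = ⊥-elim (apart (trans (sym (glue-old a)) (trans e (glue-new b))))
  ... | isNew a | isOld b = ⊥-elim (apart (sym (trans (sym (glue-new a)) (trans e (glue-old b)))))
  ... | isNew a | isNew b = cong (m ↑ʳ_) (ψ-inj (trans (sym (glue-new a)) (trans e (glue-new b))))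

  relabel : (G : Graph n) → Iso (pullback G glue) G
  relabel G = glue , unglue , (λ i → glue-inj (glue-unglue (glue i))) , glue-unglue , (λ i j → refl)

  -- The invariance of `card` is available for isomorphic graphs; relabelling an edgeless graph
  -- turns the bare bijection into such an isomorphism.
  size : m + k ≡ n
  size = trans (sym (card-full (m + k))) (trans (sym (iso-card (pullback empty glue) empty (relabel empty) full)) (card-full n))
    where
    empty : Graph n
    empty = record { adj = λ _ _ → false ; adj-sym = λ _ _ → refl ; adj-irr = λ _ → refl }

lookup-inj : ∀ {A : Set} {xs : List A} → Unique xs → ∀ {i j} → lookup xs i ≡ lookup xs j → i ≡ j
lookup-inj (x∉ ∷ u) {zero} {zero} e = refl
lookup-inj {xs = x ∷ xs} (x∉ ∷ u) {zero} {suc j} e = ⊥-elim (All.lookup x∉ (∈-lookup {xs = xs} j) e)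
lookup-inj {xs = x ∷ xs} (x∉ ∷ u) {suc i} {zero} e = ⊥-elim (All.lookup x∉ (∈-lookup {xs = xs} i) (sym e))
lookup-inj (x∉ ∷ u) {suc i} {suc j} e = cong suc (lookup-inj u e)

record Enum {n} (X : VSet n) : Set where
  constructor enum
  field
    {size} : ℕ
    at : Fin size → Fin n
    at-inj : Inj at
    at-∈ : ∀ i → X (at i) ≡ true
    at-onto : ∀ v → X v ≡ true → Σ[ i ∈ Fin size ] at i ≡ v

enumerate : ∀ {n} (X : VSet n) → Enum X
enumerate {n} X = enum (lookup l) (lookup-inj (UniqueP.filter⁺ P? (UniqueP.allFin⁺ n)))
    (λ i → proj₂ (∈-filter⁻ P? {xs = allFin n} (∈-lookup {xs = l} i)))
    (λ v e → let m = ∈-filter⁺ P? {xs = allFin n} (∈-allFin v) e in index m , sym (AnyP.lookup-index m))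
  where
  P? : ∀ v → Dec (X v ≡ true)
  P? v = X v Data.Bool.≟ true
    where import Data.Bool
  l = filter P? (allFin n)

split-left : ∀ {m n} (φ : Fin m → Fin n) → Inj φ → Σ[ e ∈ Enum (∁ (image φ)) ] Split φ (Enum.at e)
split-left φ inj = e , record { φ-inj = inj ; ψ-inj = Enum.at-inj e
    ; apart = λ {i} {j} q → T≢F (subst (λ v → image φ v ≡ true) q (image-∈ φ i)) (not-true (Enum.at-∈ e j))
    ; cover = cov }
  where
  e = enumerate (∁ (image φ))
  cov : ∀ v → _
  cov v with dichotomy (image φ v)
  ... | inj₁ t = inj₁ (image-inv {φ = φ} t)
  ... | inj₂ f = inj₂ (Enum.at-onto e v (cong not f))

split-sym : ∀ {m k n} {φ : Fin m → Fin n} {ψ : Fin k → Fin n} → Split φ ψ → Split ψ φ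
split-sym s = record { φ-inj = ψ-inj ; ψ-inj = φ-inj ; apart = λ e → apart (sym e) ; cover = λ v → Data.Sum.swap (cover v) }
  where
  open Split s
  import Data.Sum

split-right : ∀ {k n} (ψ : Fin k → Fin n) → Inj ψ → Σ[ e ∈ Enum (∁ (image ψ)) ] Split (Enum.at e) ψ
split-right ψ inj = let (e , s) = split-left ψ inj in e , split-sym s

opaque
  unfolding E
  E-subgraph : ∀ {m} {G H : Graph m} {X} → (∀ a b → adj G a b ≡ true → adj H a b ≡ true) → E G X ≤ E H X
  E-subgraph {G = G} {H} {X} h = ∑-mono λ a → ∑-mono λ b → b2n-mono λ p →
    let (q , x) = ∧-split {(toℕ a <ᵇ toℕ b) ∧ adj G a b} p ; (l , g) = ∧-split {toℕ a <ᵇ toℕ b} q in cong₂ _∧_ (cong₂ _∧_ l (h a b g)) x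

  E-graph : ∀ {m} {G H : Graph m} {X} → (∀ a b → adj G a b ≡ adj H a b) → E G X ≡ E H X
  E-graph {X = X} h = ∑-cong λ a → ∑-cong λ b → cong (λ x → b2n (((toℕ a <ᵇ toℕ b) ∧ x) ∧ (X a ∧ X b))) (h a b)

private
  induced : ∀ {m n} (G : Graph n) (φ : Fin m → Fin n) → Inj φ → (X : VSet n) → (∀ i → X (φ i) ≡ true) →
      (∀ v → X v ≡ true → image φ v ≡ true) →
            E G X ≡ E (pullback G φ) full × card X ≡ m
  induced {m} G φ inj X on off = E-eq , c-eq
    where
    s = split-left φ inj
    open Split (proj₂ s)
    k = Enum.size (proj₁ s)
    new-off : ∀ i → X (glue (m ↑ʳ i)) ≡ false
    new-off i = ≢true λ t → T≢F (off _ (subst (λ v → X v ≡ true) (glue-new i) t)) (not-true (Enum.at-∈ (proj₁ s) i))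
    old-on : ∀ a → X (glue (a ↑ˡ k)) ≡ true
    old-on a = trans (cong X (glue-old a)) (on a)
    c-eq = trans (iso-card (pullback G glue) G (relabel G) X)
        (trans (card-↑ {m} {k} _) (trans (cong₂ _+_ (trans (card-cong old-on) (card-full m))
        (card-empty {X = λ i → X (glue (m ↑ʳ i))} new-off)) (+-identityʳ m)))
    E-eq = trans (iso-E (pullback G glue) G (relabel G) X) (trans (E-old {m} {k} (pullback G glue) _ new-off)
      (trans (E-cong _ old-on) (E-graph (λ a b → cong₂ (adj G) (glue-old a) (glue-old b)))))

Tight⇒sparse : ∀ {n} {G : Graph n} → Tight 1 G → SparseOn G × E G full + 1 ≡ 2 * card (full {n})
Tight⇒sparse {n} {G} (sp , t) = sparse , trans (cong (_+ 1) (E-full G)) (trans t (cong (2 *_) (sym (card-full n))))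
  where
  sparse : SparseOn G
  sparse X h with E G X in eq
  -- `Sparse` says nothing about subgraphs without edges; here nonemptiness alone suffices.
  ... | zero = ≤-trans h (m≤m+n _ _)
  ... | suc e = subst₂ (λ a b → a + 1 ≤ 2 * b) (trans (sym e-eq) eq) (sym (proj₂ ind))
      (sp size H at (at-inj , λ _ _ p → p) (≤-trans (s≤s z≤n) (≤-reflexive (trans (sym eq) e-eq))))
    where
    open Enum (enumerate X)
    H = pullback G at
    ind = induced G at at-inj X at-∈ (λ v t → let (i , q) = at-onto v t in subst (λ v → image at v ≡ true) q (image-∈ at i))
    e-eq : E G X ≡ edgeCount H
    e-eq = trans (proj₁ ind) (E-full H)

sparse⇒Tight : ∀ {n} {G : Graph n} → SparseOn G → E G full + 1 ≡ 2 * card (full {n}) → Tight 1 G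
sparse⇒Tight {n} {G} sparse t = sp , trans (cong (_+ 1) (sym (E-full G))) (trans t (cong (2 *_) (card-full n)))
  where
  sp : Sparse 1 G
  sp (suc m) H φ (inj , sub) _ = ≤-trans (+-monoˡ-≤ 1 (≤-trans (≤-reflexive (sym (E-full H)))
      (≤-trans (E-subgraph {G = H} {pullback G φ} sub) (≤-reflexive (sym (proj₁ ind))))))
    (≤-trans (sparse (image φ) (≤-trans (s≤s z≤n) (≤-reflexive (sym (proj₂ ind))))) (≤-reflexive (cong (2 *_) (proj₂ ind))))
    where ind = induced G φ inj (image φ) (image-∈ φ) (λ v t → t)
  sp zero H φ _ ()

-- Rooted trees and functional graphs

-- G is the disjoint union of the tree {i, π i} rooted at r and the functional graph {i, s i}.
record Cert {n} (G : Graph n) : Set where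
  field
    r : Fin n
    π s : Fin n → Fin n
    d : Fin n → ℕ
    down : ∀ {i} → i ≢ r → d (π i) < d i
    π-adj : ∀ {i} → i ≢ r → adj G i (π i) ≡ true
    s-adj : ∀ i → adj G i (s i) ≡ true
    cover : ∀ {i j} → adj G i j ≡ true → (i ≢ r × π i ≡ j) ⊎ (j ≢ r × π j ≡ i) ⊎ s i ≡ j ⊎ s j ≡ i
    ss : ∀ i → s (s i) ≢ i
    πs : ∀ {i} → i ≢ r → s i ≢ π i
    sπ : ∀ {i} → i ≢ r → s (π i) ≢ i

-- Every vertex has exactly one outgoing edge, and the condition `ss` keeps these edges distinct.
-- The cycle of a component is the orbit into which iterating `s` leads all its vertices.
module FunctionalGraph {n} (P : Graph n) (s : Fin n → Fin n) (s-adj : ∀ i → adj P i (s i) ≡ true)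
  (s-cover : ∀ {i j} → adj P i j ≡ true → s i ≡ j ⊎ s j ≡ i) (ss : ∀ i → s (s i) ≢ i) where

  Fwd Bwd : Fin n → Fin n → Set
  Fwd a b = s a ≡ b
  Bwd a b = s b ≡ a

  infix 4 _↝_
  data _↝_ : Fin n → Fin n → Set where
    done : ∀ {x} → x ↝ x
    next : ∀ {x y} → s x ↝ y → x ↝ y

  ↝-trans : ∀ {x y z} → x ↝ y → y ↝ z → x ↝ z
  ↝-trans done q = q
  ↝-trans (next p) q = next (↝-trans p q)

  private
    data NoBack : List (Fin n) → Set where
      one : ∀ {a} → NoBack (a ∷ [])
      two : ∀ {a b} → NoBack (a ∷ b ∷ [])
      more : ∀ {a b c xs} → a ≢ c → NoBack (b ∷ c ∷ xs) → NoBack (a ∷ b ∷ c ∷ xs)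

    noBack : ∀ a xs z → Unique (a ∷ xs) → z ∉ xs → a ≢ z ⊎ 2 ≤ length xs → NoBack (a ∷ xs ++ [ z ])
    noBack a [] z u z∉ h = two
    noBack a (x ∷ []) z u z∉ (inj₁ a≢z) = more a≢z two
    noBack a (x ∷ []) z u z∉ (inj₂ (s≤s ()))
    noBack a (x ∷ y ∷ ys) z ((_ ∷ a≢y ∷ _) ∷ u) z∉ h = more a≢y
        (noBack x (y ∷ ys) z u (z∉ ∘ there) (inj₁ λ { refl → z∉ (here refl) }))

    data EndBwd : List (Fin n) → Set where
      end : ∀ {a b} → s b ≡ a → EndBwd (a ∷ b ∷ [])
      cons : ∀ {a xs} → EndBwd xs → EndBwd (a ∷ xs)

    endBwd-inv : ∀ xs z → EndBwd (xs ++ [ z ]) → s z ∈ xs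
    endBwd-inv (x ∷ []) z (end e) = here e
    endBwd-inv (x ∷ []) z (cons (cons ()))
    endBwd-inv (x ∷ y ∷ []) z (cons e) = there (endBwd-inv (y ∷ []) z e)
    endBwd-inv (x ∷ y ∷ z′ ∷ xs) z (cons e) = there (endBwd-inv (y ∷ z′ ∷ xs) z e)
    endBwd-inv [] z (cons ())

    endBwd-tail : ∀ w u vs z → EndBwd (w ∷ u ∷ vs ++ [ z ]) → s z ∈ (u ∷ vs)
    endBwd-tail w u [] z (cons e) = endBwd-inv (u ∷ []) z e
    endBwd-tail w u (x ∷ vs) z (cons e) = endBwd-inv (u ∷ x ∷ vs) z e

    Link : Fin n → Fin n → Set
    Link a b = adj P a b ≡ true

    -- After a step from `a` to `b` against `s`, the only outgoing edge of `b` leads back to `a`. A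
    -- walk that never turns back therefore goes on against `s`.
    bwd : ∀ {a b xs} → Linked Link (a ∷ b ∷ xs) → NoBack (a ∷ b ∷ xs) → s b ≡ a → Linked Bwd (a ∷ b ∷ xs)
    bwd (_ ∷ [-]) nb e = e ∷ [-]
    bwd (_ ∷ l@(p ∷ _)) (more a≢c nb) e with s-cover p
    ... | inj₁ f = ⊥-elim (a≢c (trans (sym e) f))
    ... | inj₂ f = e ∷ bwd l nb f

    Bwd⇒End : ∀ {a b xs} → Linked Bwd (a ∷ b ∷ xs) → EndBwd (a ∷ b ∷ xs)
    Bwd⇒End (e ∷ [-]) = end e
    Bwd⇒End (e ∷ l@(_ ∷ _)) = cons (Bwd⇒End l)

    classify : ∀ {a b xs} → Linked Link (a ∷ b ∷ xs) → NoBack (a ∷ b ∷ xs) → Linked Fwd (a ∷ b ∷ xs) ⊎ EndBwd (a ∷ b ∷ xs)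
    classify l@(p ∷ _) nb with s-cover p
    ... | inj₂ f = inj₂ (Bwd⇒End (bwd l nb f))
    classify (p ∷ [-]) nb | inj₁ f = inj₁ (f ∷ [-])
    classify (p ∷ l@(_ ∷ _)) (more _ nb) | inj₁ f with classify l nb
    ... | inj₁ g = inj₁ (f ∷ g)
    ... | inj₂ e = inj₂ (cons e)

  -- By `bwd` the direction can change at most once, from along `s` to against `s`. Starting along
  -- and ending against `s` would give the first vertex `v` two different images.
  oriented : ∀ {v vs} → IsCycle P (v ∷ vs) → Linked Fwd (v ∷ vs ++ [ v ]) ⊎ Linked Bwd (v ∷ vs ++ [ v ])
  oriented {v} {[]} (_ , s≤s () , _)
  oriented {v} {_ ∷ []} (_ , s≤s (s≤s ()) , _)
  oriented {v} {w ∷ u ∷ vs} (uq@(v∉ ∷ (w∉ ∷ _)) , _ , es) = go (consec⇒Linked {R = Link} _ es)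
    where
    nb : NoBack (v ∷ w ∷ u ∷ vs ++ [ v ])
    nb = noBack v (w ∷ u ∷ vs) v uq (λ m → All.lookup v∉ m refl) (inj₂ (s≤s (s≤s z≤n)))
    go : Linked Link (v ∷ w ∷ u ∷ vs ++ [ v ]) → _
    go l@(p ∷ _) with s-cover p
    ... | inj₂ f = inj₂ (bwd l nb f)
    ... | inj₁ f with classify l nb
    ...   | inj₁ g = inj₁ g
    ...   | inj₂ (cons e) = ⊥-elim (All.lookup w∉ (endBwd-tail w u vs v e) (sym f))

  private
    fwd-pair : ∀ xs z {x} → Linked Fwd (xs ++ [ z ]) → x ∈ xs → (x , s x) ∈ consecPairs (xs ++ [ z ])
    fwd-pair (x ∷ []) z (e ∷ _) (here refl) = here (cong (x ,_) e)
    fwd-pair (x ∷ y ∷ xs) z (e ∷ _) (here refl) = here (cong (x ,_) e)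
    fwd-pair (x ∷ y ∷ xs) z (e ∷ l) (there m) = there (fwd-pair (y ∷ xs) z l m)

    bwd-pair : ∀ a xs {x} → Linked Bwd (a ∷ xs) → x ∈ xs → (s x , x) ∈ consecPairs (a ∷ xs)
    bwd-pair a (x ∷ xs) (e ∷ _) (here refl) = here (cong (_, x) e)
    bwd-pair a (x ∷ xs) (e ∷ l) (there m) = there (bwd-pair x xs l m)

    fwd-from : ∀ {a xs x} → Linked Fwd (a ∷ xs) → x ∈ (a ∷ xs) → a ↝ x
    fwd-from l (here refl) = done
    fwd-from {a} (e ∷ l) (there m) = next (subst (_↝ _) (sym e) (fwd-from l m))

    fwd-to : ∀ xs z {x} → Linked Fwd (xs ++ [ z ]) → x ∈ xs → x ↝ z
    fwd-to (x ∷ []) z (e ∷ _) (here refl) = next (subst (_↝ z) (sym e) done)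
    fwd-to (x ∷ y ∷ xs) z (e ∷ l) (here refl) = next (subst (_↝ z) (sym e) (fwd-to (y ∷ xs) z l (here refl)))
    fwd-to (x ∷ y ∷ xs) z (e ∷ l) (there m) = fwd-to (y ∷ xs) z l m

    bwd-to : ∀ {a xs x} → Linked Bwd (a ∷ xs) → x ∈ (a ∷ xs) → x ↝ a
    bwd-to l (here refl) = done
    bwd-to {a} (e ∷ l) (there m) = ↝-trans (bwd-to l m) (next (subst (_↝ a) (sym e) done))

    bwd-from : ∀ xs z {x} → Linked Bwd (xs ++ [ z ]) → x ∈ xs → z ↝ x
    bwd-from (x ∷ []) z (e ∷ _) (here refl) = next (subst (_↝ x) (sym e) done)
    bwd-from (x ∷ y ∷ xs) z (e ∷ l) (here refl) = ↝-trans (bwd-from (y ∷ xs) z l (here refl)) (next (subst (_↝ x) (sym e) done))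
    bwd-from (x ∷ y ∷ xs) z (e ∷ l) (there m) = bwd-from (y ∷ xs) z l m

  uses-s : ∀ {vs x} → IsCycle P vs → x ∈ vs → UsesEdge vs x (s x)
  uses-s {v ∷ vs} c m with oriented c
  ... | inj₁ l = inj₁ (fwd-pair (v ∷ vs) v l m)
  uses-s {v ∷ vs} c (here refl) | inj₂ l = inj₂ (bwd-pair v (vs ++ [ v ]) l (∈-++⁺ʳ vs (here refl)))
  uses-s {v ∷ vs} c (there m) | inj₂ l = inj₂ (bwd-pair v (vs ++ [ v ]) l (∈-++⁺ˡ m))

  uses-inv : ∀ {vs a b} → IsCycle P vs → UsesEdge vs a b → s a ≡ b ⊎ s b ≡ a
  uses-inv {v ∷ vs} c (inj₁ m) = s-cover (All.lookup (proj₂ (proj₂ c)) m)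
  uses-inv {v ∷ vs} c (inj₂ m) = swap (s-cover (All.lookup (proj₂ (proj₂ c)) m))
  uses-inv {[]} (_ , () , _)

  orbit : ∀ {vs x y} → IsCycle P vs → x ∈ vs → y ∈ vs → x ↝ y
  orbit {v ∷ vs} c x∈ y∈ with oriented c
  ... | inj₁ l = ↝-trans (fwd-to (v ∷ vs) v l x∈) (fwd-from l (∈-++⁺ˡ y∈))
  ... | inj₂ l = ↝-trans (bwd-to l (∈-++⁺ˡ x∈)) (bwd-from (v ∷ vs) v l y∈)

  s-closed : ∀ {vs x y} → IsCycle P vs → x ∈ vs → x ↝ y → y ∈ vs
  s-closed c m done = m
  s-closed {vs} c m (next p) = s-closed c (proj₂ (uses-∈ P vs (uses-s c m))) p

  private
    -- Flowing into the cycle passes along every edge in both directions: a predecessor flows in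
    -- through its image, and the image of a vertex either continues its flow or, if the vertex is
    -- on the cycle, is on the cycle too.
    attracted : ∀ {ws y z S} → IsCycle P ws → y ∈ ws → Path P S y z → Σ[ c ∈ Fin n ] c ∈ ws × z ↝ c
    attracted {ws} cyc y∈ p = go (_ , y∈ , done) p
      where
      go : ∀ {y z S} → Σ[ c ∈ Fin n ] c ∈ ws × y ↝ c → Path P S y z → Σ[ c ∈ Fin n ] c ∈ ws × z ↝ c
      go q (stop _) = q
      go (c , c∈ , q) (move _ a p) with s-cover a | q
      ... | inj₂ e | _ = go (c , c∈ , next (subst (_↝ c) (sym e) q)) p
      ... | inj₁ refl | done = go (_ , s-closed cyc c∈ (next done) , done) p
      ... | inj₁ refl | next q′ = go (c , c∈ , q′) p

    same-half : ∀ {vs ws c} → IsCycle P vs → IsCycle P ws → c ∈ vs → c ∈ ws → ∀ a b → UsesEdge vs a b → UsesEdge ws a b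
    same-half {vs} {ws} cv cw c∈v c∈w a b u with uses-∈ P vs u | uses-inv cv u
    ... | a∈ , b∈ | inj₁ refl = uses-s cw (s-closed cw c∈w (orbit cv c∈v a∈))
    ... | a∈ , b∈ | inj₂ refl = swap (uses-s cw (s-closed cw c∈w (orbit cv c∈v b∈)))

  -- The orbit of `x` stays on `vs` and reaches `ws`. From the common vertex on, both cycles are its
  -- orbit.
  same-cycle : ∀ {vs ws x y S} → IsCycle P vs → IsCycle P ws → x ∈ vs → y ∈ ws → Path P S y x → SameCycle vs ws
  same-cycle cv cw x∈ y∈ p a b =
    let (c , c∈w , q) = attracted cw y∈ p
        c∈v = s-closed cv x∈ q
    in same-half cv cw c∈v c∈w a b , same-half cw cv c∈w c∈v a b

  open DecMem {A = Fin n} _≟_ using (_∈?_)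

  private
    -- Iterating `s` must hit a vertex already visited. It is neither the current vertex, as edges
    -- are not loops, nor the one before it, by `ss`; so a genuine cycle closes.
    trace : ∀ fuel {x} v vs → n ≤ fuel + length (v ∷ vs) → Unique (v ∷ vs) → Linked Bwd (v ∷ vs) → All (Path P full x) (v ∷ vs) →
            Σ[ ws ∈ List (Fin n) ] IsCycle P ws × All (Path P full x) ws
    trace fuel v vs h u l ps with s v ∈? (v ∷ vs)
    ... | yes (here e) = ⊥-elim (adj-≢ P (s-adj v) (sym e))
    trace fuel v (w ∷ vs) h u (sw ∷ l) ps | yes (there (here e)) = ⊥-elim (ss w (trans (cong s sw) e))
    trace fuel v (w ∷ vs) h u l (p ∷ q ∷ ps) | yes (there (there m)) =
      loop P {v} {w} m , loop-cycle P m u (Linked.map (λ { refl → adj-swap P (s-adj _) }) l) (adj-swap P (s-adj v)) , p ∷ q ∷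
          upTo-All P m ps
    trace fuel v vs h u l (p ∷ ps) | no ∉ = go fuel h
      where
      u′ = AllP.¬Any⇒All¬ _ ∉ ∷ u
      go : ∀ fuel → n ≤ fuel + length (v ∷ vs) → _
      go zero h = ⊥-elim (<-irrefl refl (≤-trans (s≤s h)
          (≤-trans (list≤card full u′ (All.universal (λ _ → refl) _)) (card≤n full))))
      go (suc f) h = trace f (s v) (v ∷ vs) (≤-trans h (≤-reflexive (sym (+-suc f _)))) u′ (refl ∷ l)
                         (path-trans P p (move refl (s-adj v) (stop refl)) ∷ p ∷ ps)

  unicyclic : ComponentsUnicyclic P
  unicyclic x = (let (ws , c , ps) = trace n x [] (m≤m+n n 1) ([] ∷ []) [-] (stop refl ∷ []) in ws , c , All.map (Path⇒Reach P) ps)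
              , same
    where
    same : ∀ vs ws → IsCycle P vs → All (Reach P x) vs → IsCycle P ws → All (Reach P x) ws → SameCycle vs ws
    same (v ∷ vs) (w ∷ ws) cv (rv ∷ _) cw (rw ∷ _) =
      same-cycle cv cw (here refl) (here refl) (path-trans P (path-sym P (Reach⇒Path P rw)) (Reach⇒Path P rv))
    same [] _ (_ , () , _)
    same _ [] _ _ (_ , () , _)

∨-inj₁ : ∀ {a b : Bool} → a ≡ true → a ∨ b ≡ true
∨-inj₁ refl = refl

∨-inj₂ : ∀ {a b : Bool} → b ≡ true → a ∨ b ≡ true
∨-inj₂ {a} refl = ∨-zeroʳ a

∨-≡false : ∀ {a b : Bool} → a ≡ false → b ≡ false → a ∨ b ≡ false
∨-≡false refl refl = refl

≡⇒== : ∀ {n} {i j : Fin n} → i ≡ j → (i == j) ≡ true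
≡⇒== {i = i} refl = ==-refl i

Cert⇒TreePlusUnicyclic : ∀ {n} {G : Graph n} → Cert G → TreePlusUnicyclic G
Cert⇒TreePlusUnicyclic {n} {G} C = T , P , (λ i j → bool-ext (fwd i j) (bwd i j)) , disj , ((r , conn) , acyc) , unicyclic
  where
  open Cert C
  up : Fin n → Fin n → Bool
  up i j = not (i == r) ∧ (π i == j)
  up-inv : ∀ {i j} → up i j ≡ true → i ≢ r × π i ≡ j
  up-inv {i} e = let (a , b) = ∧-split {not (i == r)} e in
    ==⇒≢ (not-true a) , ==⇒≡ b
  up-intro : ∀ {i j} → i ≢ r → π i ≡ j → up i j ≡ true
  up-intro i≢r e rewrite ==-≢ i≢r = ≡⇒== e
  T P : Graph n
  T = record { adj = λ i j → up i j ∨ up j i ; adj-sym = λ i j → ∨-comm (up i j) (up j i)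
             ; adj-irr = λ i → let no = ≢true λ e → let (a , b) = up-inv {i} {i} e in <-irrefl (cong d b) (down a) in ∨-≡false no no }
  P = record { adj = λ i j → (s i == j) ∨ (s j == i) ; adj-sym = λ i j → ∨-comm (s i == j) (s j == i)
             ; adj-irr = λ i → let no = ==-≢ (λ e → adj-≢ G (s-adj i) (sym e)) in ∨-≡false no no }
  T-inv : ∀ {i j} → adj T i j ≡ true → (i ≢ r × π i ≡ j) ⊎ (j ≢ r × π j ≡ i)
  T-inv {i} {j} e with ∨-split {up i j} e
  ... | inj₁ a = inj₁ (up-inv {i} {j} a)
  ... | inj₂ a = inj₂ (up-inv {j} {i} a)
  P-inv : ∀ {i j} → adj P i j ≡ true → s i ≡ j ⊎ s j ≡ i
  P-inv {i} {j} e with ∨-split {s i == j} e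
  ... | inj₁ a = inj₁ (==⇒≡ a)
  ... | inj₂ a = inj₂ (==⇒≡ a)
  open FunctionalGraph P s (λ i → ∨-inj₁ (==-refl (s i))) P-inv ss using (unicyclic)
  fwd : ∀ i j → adj G i j ≡ true → adj T i j ∨ adj P i j ≡ true
  fwd i j e with cover e
  ... | inj₁ (a , b) = ∨-inj₁ (∨-inj₁ (up-intro a b))
  ... | inj₂ (inj₁ (a , b)) = ∨-inj₁ (∨-inj₂ {up i j} (up-intro a b))
  ... | inj₂ (inj₂ (inj₁ a)) = ∨-inj₂ {adj T i j} (∨-inj₁ (≡⇒== a))
  ... | inj₂ (inj₂ (inj₂ a)) = ∨-inj₂ {adj T i j} (∨-inj₂ {s i == j} (≡⇒== a))
  bwd : ∀ i j → adj T i j ∨ adj P i j ≡ true → adj G i j ≡ true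
  bwd i j e with ∨-split {adj T i j} e
  ... | inj₁ t with T-inv {i} {j} t
  ...   | inj₁ (a , refl) = π-adj a
  ...   | inj₂ (a , refl) = adj-swap G (π-adj a)
  bwd i j e | inj₂ p with P-inv {i} {j} p
  ...   | inj₁ refl = s-adj i
  ...   | inj₂ refl = adj-swap G (s-adj j)
  disj : ∀ i j → (adj T i j ∧ adj P i j) ≡ false
  disj i j = ≢true λ e → let (t , p) = ∧-split {adj T i j} e in clash (T-inv {i} {j} t) (P-inv {i} {j} p)
    where
    clash : (i ≢ r × π i ≡ j) ⊎ (j ≢ r × π j ≡ i) → s i ≡ j ⊎ s j ≡ i → ⊥
    clash (inj₁ (a , refl)) (inj₁ e) = πs a e
    clash (inj₁ (a , refl)) (inj₂ e) = sπ a e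
    clash (inj₂ (a , refl)) (inj₁ e) = sπ a e
    clash (inj₂ (a , refl)) (inj₂ e) = πs a e
  to-root : ∀ k x → d x ≤ k → Path T full x r
  to-root k x h with x ≟ r
  ... | yes refl = stop refl
  to-root zero x h | no x≢r with () ← ≤-trans (down x≢r) h
  to-root (suc k) x h | no x≢r = move refl (∨-inj₁ (up-intro x≢r refl)) (to-root k (π x) (≤-pred (≤-trans (down x≢r) h)))
  conn : ∀ x y → Reach T x y
  conn x y = Path⇒Reach T (path-trans T (to-root _ x ≤-refl) (path-sym T (to-root _ y ≤-refl)))
  deepest : ∀ v vs → Σ[ x ∈ Fin n ] x ∈ (v ∷ vs) × (∀ {y} → y ∈ (v ∷ vs) → d y ≤ d x)
  deepest v [] = v , here refl , λ { (here refl) → ≤-refl }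
  deepest v (w ∷ vs) with deepest w vs
  ... | x , x∈ , mx with ≤-total (d v) (d x)
  ...   | inj₁ h = x , there x∈ , λ { (here refl) → h ; (there m) → mx m }
  ...   | inj₂ h = v , here refl , λ { (here refl) → ≤-refl ; (there m) → ≤-trans (mx m) h }
  -- Both cycle neighbours of a vertex of maximal depth on the cycle would have to be its parent.
  acyc : Acyclic T
  acyc [] (_ , () , _)
  acyc (v ∷ vs) c =
    let (x , x∈ , mx) = deepest v vs
        (p , q , p≢q , a , b , p∈ , q∈) = cycle-nbrs T c x∈
    in p≢q (trans (sym (parent mx p∈ a)) (parent mx q∈ b))
    where
    parent : ∀ {x p} → (∀ {y} → y ∈ (v ∷ vs) → d y ≤ d x) → p ∈ (v ∷ vs) → adj T x p ≡ true → π x ≡ p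
    parent {x} {p} mx p∈ a with T-inv {x} {p} a
    ... | inj₁ (_ , e) = e
    ... | inj₂ (p≢r , refl) = ⊥-elim (<-irrefl refl (≤-trans (down p≢r) (mx p∈)))

-- The moves preserve certificates

module _ {n} (G : Graph n) (r : Fin n) (π s : Vec (Fin n) n) (d : Vec ℕ n) where

  private
    p q : Fin n → Fin n
    p = Vec.lookup π
    q = Vec.lookup s
    Local : Fin n → Set
    Local i = (i ≢ r → (Vec.lookup d (p i) < Vec.lookup d i) × (adj G i (p i) ≡ true) × (q i ≢ p i) × (q (p i) ≢ i))
              × (adj G i (q i) ≡ true) × (q (q i) ≢ i)
    Cover : Fin n → Fin n → Set
    Cover i j = adj G i j ≡ true → (i ≢ r × p i ≡ j) ⊎ (j ≢ r × p j ≡ i) ⊎ q i ≡ j ⊎ q j ≡ i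

    local? : ∀ i → Dec (Local i)
    local? i = (¬? (i ≟ r) →-dec (Vec.lookup d (p i) ℕ.<? Vec.lookup d i) ×-dec (adj G i (p i) Bool.≟ true) ×-dec ¬? (q i ≟ p i)
        ×-dec ¬? (q (p i) ≟ i))
               ×-dec (adj G i (q i) Bool.≟ true) ×-dec ¬? (q (q i) ≟ i)
    cover? : ∀ i j → Dec (Cover i j)
    cover? i j = (adj G i j Bool.≟ true) →-dec ((¬? (i ≟ r) ×-dec (p i ≟ j)) ⊎-dec
        ((¬? (j ≟ r) ×-dec (p j ≟ i)) ⊎-dec ((q i ≟ j) ⊎-dec (q j ≟ i))))

  checked : True (all? local?) → True (all? (λ i → all? (cover? i))) → Cert G
  checked l c = record
    { r = r ; π = p ; s = q ; d = Vec.lookup d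
    ; down = λ {i} h → proj₁ (proj₁ (L i) h)
    ; π-adj = λ {i} h → proj₁ (proj₂ (proj₁ (L i) h))
    ; s-adj = λ i → proj₁ (proj₂ (L i))
    ; cover = λ {i} {j} → toWitness c i j
    ; ss = λ i → proj₂ (proj₂ (L i))
    ; πs = λ {i} h → proj₁ (proj₂ (proj₂ (proj₁ (L i) h)))
    ; sπ = λ {i} h → proj₂ (proj₂ (proj₂ (proj₁ (L i) h))) }
    where L = toWitness l

-- The missing edge is 01. The tree has the edges 20, 21, 23, 34; the functional graph is the cycle
-- 0, 3, 1, 4 with 2 attached at 4.
Cert-K5-e : Cert K5-e
Cert-K5-e = checked K5-e 2F (2F ∷ 2F ∷ 2F ∷ 2F ∷ 3F ∷ []) (3F ∷ 4F ∷ 4F ∷ 1F ∷ 0F ∷ []) (1 ∷ 1 ∷ 0 ∷ 1 ∷ 2 ∷ []) _ _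

-- The tree is the path 4, 2, 5, 3 with leaves 0 and 1 at 3; the functional graph is the triangle 0,
-- 1, 2 with the path 5, 4, 3 leading to 2.
Cert-K4⊔K4 : Cert K4⊔K4
Cert-K4⊔K4 = checked K4⊔K4 3F (3F ∷ 3F ∷ 5F ∷ 3F ∷ 2F ∷ 3F ∷ []) (1F ∷ 2F ∷ 0F ∷ 2F ∷ 3F ∷ 4F ∷ []) (1 ∷ 1 ∷ 2 ∷ 0 ∷ 3 ∷ 1 ∷ []) _ _

Cert-iso : ∀ {m n} (G : Graph m) (G′ : Graph n) → Iso G G′ → Cert G → Cert G′
Cert-iso G G′ (f , g , gf , fg , e) C = record
  { r = f r ; π = f ∘ π ∘ g ; s = f ∘ s ∘ g ; d = d ∘ g
  ; down = λ {i} h → subst (λ x → d x < d (g i)) (sym (gf _)) (down (≢r h))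
  ; π-adj = λ {i} h → lift (π-adj (≢r h))
  ; s-adj = λ i → lift (s-adj (g i))
  ; cover = λ {i} {j} a → cov i j (cover (trans (sym (e (g i) (g j))) (trans (cong₂ (adj G′) (fg i) (fg j)) a)))
  ; ss = λ i q → ss (g i) (trans (cong s (sym (gf _))) (trans (sym (gf _)) (cong g q)))
  ; πs = λ {i} h q → πs (≢r h) (f-inj q)
  ; sπ = λ {i} h q → sπ (≢r h) (trans (cong s (sym (gf _))) (trans (sym (gf _)) (cong g q))) }
  where
  open Cert C
  f-inj : ∀ {a b} → f a ≡ f b → a ≡ b
  f-inj {a} {b} q = trans (sym (gf a)) (trans (cong g q) (gf b))
  ≢r : ∀ {i} → i ≢ f r → g i ≢ r
  ≢r {i} h q = h (trans (sym (fg i)) (cong f q))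
  lift : ∀ {i b} → adj G (g i) b ≡ true → adj G′ i (f b) ≡ true
  lift {i} {b} a = subst (λ x → adj G′ x (f b) ≡ true) (fg i) (trans (e (g i) b) a)
  cov : ∀ i j → _ → _
  cov i j (inj₁ (h , q)) = inj₁ ((λ { refl → h (gf r) }) , trans (cong f q) (fg j))
  cov i j (inj₂ (inj₁ (h , q))) = inj₂ (inj₁ ((λ { refl → h (gf r) }) , trans (cong f q) (fg i)))
  cov i j (inj₂ (inj₂ (inj₁ q))) = inj₂ (inj₂ (inj₁ (trans (cong f q) (fg j))))
  cov i j (inj₂ (inj₂ (inj₂ q))) = inj₂ (inj₂ (inj₂ (trans (cong f q) (fg i))))

TreeEdge : ∀ {n} {G : Graph n} → Cert G → Fin n → Fin n → Set
TreeEdge C i j = (i ≢ r × π i ≡ j) ⊎ (j ≢ r × π j ≡ i)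
  where open Cert C

module _ {n} {G : Graph n} where

  private
    -- Only the tree edge between the root and its child `c` has to be reversed.
    reroot-child : (C : Cert G) (c : Fin n) → c ≢ Cert.r C → Cert.π C c ≡ Cert.r C →
                   Σ[ C′ ∈ Cert G ] Cert.r C′ ≡ c × (∀ {i j} → TreeEdge C i j → TreeEdge C′ i j)
    reroot-child C c c≢r πc = C′ , refl , λ { (inj₁ t) → one t ; (inj₂ t) → swap (one t) }
      where
      open Cert C
      π′ : Fin n → Fin n
      π′ i = if i == r then c else π i
      -- Shifting the old depths by 2 makes room for the new root at 0 and the old root at 1.
      d′ : Fin n → ℕ
      d′ i = if i == c then 0 else if i == r then 1 else 2 + d i
      π′-r : π′ r ≡ c
      π′-r rewrite ==-refl r = refl
      π′-≢ : ∀ {i} → i ≢ r → π′ i ≡ π i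
      π′-≢ h rewrite ==-≢ h = refl
      down′ : ∀ {i} → i ≢ c → d′ (π′ i) < d′ i
      down′ {i} i≢c with i ≟ c | i ≟ r
      ... | yes e | _ = ⊥-elim (i≢c e)
      ... | no _ | yes e rewrite ==-refl c = s≤s z≤n
      ... | no _ | no i≢r with π i ≟ c | π i ≟ r
      ...   | yes _ | _ = s≤s z≤n
      ...   | no _ | yes _ = s≤s (s≤s z≤n)
      ...   | no _ | no _ = s≤s (s≤s (down i≢r))
      one : ∀ {i j} → i ≢ r × π i ≡ j → (i ≢ c × π′ i ≡ j) ⊎ (j ≢ c × π′ j ≡ i)
      one {i} {j} (i≢r , e) with i ≟ c
      ... | no i≢c = inj₁ (i≢c , trans (π′-≢ i≢r) e)
      ... | yes refl with trans (sym e) πc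
      ...   | refl = inj₂ ((λ q → c≢r (sym q)) , π′-r)
      cover′ : ∀ {i j} → adj G i j ≡ true → (i ≢ c × π′ i ≡ j) ⊎ (j ≢ c × π′ j ≡ i) ⊎ s i ≡ j ⊎ s j ≡ i
      cover′ a with cover a
      ... | inj₁ t = [ inj₁ , inj₂ ∘ inj₁ ]′ (one t)
      ... | inj₂ (inj₁ t) = [ inj₂ ∘ inj₁ , inj₁ ]′ (one t)
      ... | inj₂ (inj₂ q) = inj₂ (inj₂ q)
      cases : ∀ {i} (Q : Fin n → Fin n → Set) → Q r c → (∀ {i} → i ≢ r → Q i (π i)) → Q i (π′ i)
      cases {i} Q a b with i ≟ r
      ... | yes refl = a
      ... | no h = b h
      C′ : Cert G
      C′ = record { r = c ; π = π′ ; s = s ; d = d′ ; down = down′ ; s-adj = s-adj ; cover = cover′ ; ss = ss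
        ; π-adj = λ _ → cases (λ i p → adj G i p ≡ true) (adj-swap G (subst (λ x → adj G c x ≡ true) πc (π-adj c≢r))) π-adj
        ; πs = λ _ → cases (λ i p → s i ≢ p) (λ q → sπ c≢r (trans (cong s πc) q)) πs
        ; sπ = λ _ → cases (λ i p → s p ≢ i) (λ q → πs c≢r (trans q (sym πc))) sπ }

    -- The root is first moved to the parent of `v`. That tree edges are kept shows that `v` is then
    -- a child of the root, so that one more reversal is enough.
    reroot-to : ∀ k (C : Cert G) (v : Fin n) → Cert.d C v ≤ k → Σ[ C′ ∈ Cert G ] Cert.r C′ ≡ v ×
        (∀ {i j} → TreeEdge C i j → TreeEdge C′ i j)
    reroot-to k C v h with v ≟ Cert.r C
    ... | yes refl = C , refl , id
    reroot-to zero C v h | no v≢r with () ← ≤-trans (Cert.down C v≢r) h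
    reroot-to (suc k) C v h | no v≢r with reroot-to k C (Cert.π C v) (≤-pred (≤-trans (Cert.down C v≢r) h))
    ... | C₁ , r≡ , keep with keep (inj₁ (v≢r , refl))
    ...   | inj₂ (q , _) = ⊥-elim (q (sym r≡))
    ...   | inj₁ (v≢r₁ , e) = let (C₂ , r₂ , keep₂) = reroot-child C₁ v v≢r₁ (trans e (sym r≡)) in C₂ , r₂ , keep₂ ∘ keep

  reroot : Cert G → (v : Fin n) → Σ[ C ∈ Cert G ] Cert.r C ≡ v
  reroot C v = let (C′ , e , _) = reroot-to _ C v ≤-refl in C′ , e

=ᵛ⇒≡ : ∀ {n} {i j : Fin n} → (i =ᵛ j) ≡ true → i ≡ j
=ᵛ⇒≡ {i = zero} {zero} _ = refl
=ᵛ⇒≡ {i = suc i} {suc j} e = cong suc (=ᵛ⇒≡ e)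

=ᵛ-refl : ∀ {n} (i : Fin n) → (i =ᵛ i) ≡ true
=ᵛ-refl i = ≡ᵇ-refl (toℕ i)

≡⇒=ᵛ : ∀ {n} {i j : Fin n} → i ≡ j → (i =ᵛ j) ≡ true
≡⇒=ᵛ {i = i} refl = =ᵛ-refl i

-- Once `H` is rooted at the end `v` of the joining edge, this edge becomes the parent edge of `v`.
-- Depths in `H` are shifted beyond that of `u`.
Cert-edgeJoin : ∀ {n m} {K : Graph n} {H : Graph m} {G : Graph (n + m)} → Cert K → Cert H → EdgeJoin K H G → Cert G
Cert-edgeJoin {n} {m} {K} {H} {G} CK CH₀ (u , v , oo , nn , on) with reroot CH₀ v
... | CH , refl = record { r = o k.r ; π = π ; s = s ; d = d ; down = λ {i} → down i (side {n} {m} i) ; π-adj = λ {i} → π-adj i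
    (side {n} {m} i)
      ; s-adj = λ i → s-adj i (side {n} {m} i) ; cover = λ {i} {j} → cover i j (side {n} {m} i) (side {n} {m} j) ; ss = λ i → ss i
          (side {n} {m} i) ; πs = λ {i} → πs i (side {n} {m} i) ; sπ = λ {i} → sπ i (side {n} {m} i) }
  where
  module k = Cert CK
  module h = Cert CH
  o : Fin n → Fin (n + m)
  o a = a ↑ˡ m
  w : Fin m → Fin (n + m)
  w i = n ↑ʳ i
  up : Fin m → Fin (n + m)
  up i = if i == h.r then o u else w (h.π i)
  π s : Fin (n + m) → Fin (n + m)
  π = _⊕_ (o ∘ k.π) up
  s = _⊕_ (o ∘ k.s) (w ∘ h.s)
  d : Fin (n + m) → ℕ
  d = _⊕_ k.d (λ i → suc (k.d u) + h.d i)
  up-r : up h.r ≡ o u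
  up-r rewrite ==-refl h.r = refl
  up-≢ : ∀ {i} → i ≢ h.r → up i ≡ w (h.π i)
  up-≢ q rewrite ==-≢ q = refl
  πo : ∀ a → π (o a) ≡ o (k.π a)
  πo = ⊕-old _ _
  so : ∀ a → s (o a) ≡ o (k.s a)
  so = ⊕-old _ _
  d-o : ∀ a → d (o a) ≡ k.d a
  d-o = ⊕-old _ _
  πn : ∀ a → π (w a) ≡ up a
  πn = ⊕-new {m = n} _ _
  sn : ∀ a → s (w a) ≡ w (h.s a)
  sn = ⊕-new {m = n} _ _
  d-w : ∀ a → d (w a) ≡ suc (k.d u) + h.d a
  d-w = ⊕-new {m = n} _ _
  oo→ : ∀ {a b} → adj K a b ≡ true → adj G (o a) (o b) ≡ true
  oo→ e = trans (oo _ _) e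
  o≢ : ∀ {a} → o a ≢ o k.r → a ≢ k.r
  o≢ q e = q (cong o e)
  open-new : ∀ {a} (Q : Fin (n + m) → Set) → (a ≡ h.r → Q (o u)) → (a ≢ h.r → Q (w (h.π a))) → Q (π (w a))
  open-new {a} Q x y with a ≟ h.r
  ... | yes refl = subst Q (sym (trans (πn a) up-r)) (x refl)
  ... | no q = subst Q (sym (trans (πn a) (up-≢ q))) (y q)
  bridge : adj G (o u) (w h.r) ≡ true
  bridge = trans (on _ _) (cong₂ _∧_ (=ᵛ-refl u) (=ᵛ-refl h.r))
  down : ∀ i → Side {n} {m} i → i ≢ o k.r → d (π i) < d i
  down _ (isOld a) q = subst₂ _<_ (sym (trans (cong d (πo a)) (d-o _))) (sym (d-o a)) (k.down (o≢ q))
  down _ (isNew a) q = subst (d (π (w a)) <_) (sym (d-w a)) (open-new (λ x → d x < suc (k.d u) + h.d a)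
    (λ _ → subst (_< suc (k.d u) + h.d a) (sym (d-o u)) (m≤m+n _ _))
    (λ r → subst (_< suc (k.d u) + h.d a) (sym (d-w _)) (+-monoʳ-< (suc (k.d u)) (h.down r))))
  π-adj : ∀ i → Side {n} {m} i → i ≢ o k.r → adj G i (π i) ≡ true
  π-adj _ (isOld a) q = subst (λ x → adj G (o a) x ≡ true) (sym (πo a)) (oo→ (k.π-adj (o≢ q)))
  π-adj _ (isNew a) q = open-new (λ x → adj G (w a) x ≡ true) (λ { refl → adj-swap G bridge }) (λ r → trans (nn _ _) (h.π-adj r))
  s-adj : ∀ i → Side {n} {m} i → adj G i (s i) ≡ true
  s-adj _ (isOld a) = subst (λ x → adj G (o a) x ≡ true) (sym (so a)) (oo→ (k.s-adj a))
  s-adj _ (isNew a) = subst (λ x → adj G (w a) x ≡ true) (sym (sn a)) (trans (nn _ _) (h.s-adj a))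
  ss : ∀ i → Side {n} {m} i → s (s i) ≢ i
  ss _ (isOld a) e = k.ss a (↑ˡ-inj (trans (sym (trans (cong s (so a)) (so _))) e))
  ss _ (isNew a) e = h.ss a (↑ʳ-inj {n} (trans (sym (trans (cong s (sn a)) (sn _))) e))
  πs : ∀ i → Side {n} {m} i → i ≢ o k.r → s i ≢ π i
  πs _ (isOld a) q e = k.πs (o≢ q) (↑ˡ-inj (trans (sym (so a)) (trans e (πo a))))
  πs _ (isNew a) q = open-new (λ x → s (w a) ≢ x) (λ _ e → old≢new (trans (sym e) (sn a)))
      (λ r e → h.πs r (↑ʳ-inj {n} (trans (sym (sn a)) e)))
  sπ : ∀ i → Side {n} {m} i → i ≢ o k.r → s (π i) ≢ i
  sπ _ (isOld a) q e = k.sπ (o≢ q) (↑ˡ-inj (trans (sym (trans (cong s (πo a)) (so _))) e))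
  sπ _ (isNew a) q = open-new (λ x → s x ≢ w a) (λ _ e → old≢new (trans (sym (so u)) e))
      (λ r e → h.sπ r (↑ʳ-inj {n} (trans (sym (sn _)) e)))
  o-inj₁ : ∀ {a} → a ≢ k.r → o a ≢ o k.r
  o-inj₁ q e = q (↑ˡ-inj e)
  cross : ∀ {a b} → adj G (o a) (w b) ≡ true → w b ≢ o k.r × π (w b) ≡ o a
  cross {a} {b} e with ∧-split {a =ᵛ u} (trans (sym (on a b)) e)
  ... | p , q with =ᵛ⇒≡ {i = a} {u} p | =ᵛ⇒≡ {i = b} {h.r} q
  ... | refl | refl = (λ x → old≢new (sym x)) , trans (πn b) up-r
  cover : ∀ i j → Side {n} {m} i → Side {n} {m} j → adj G i j ≡ true → (i ≢ o k.r × π i ≡ j) ⊎ (j ≢ o k.r × π j ≡ i) ⊎ s i ≡ j ⊎ s j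
      ≡ i
  cover _ _ (isOld a) (isOld b) e with k.cover (trans (sym (oo a b)) e)
  ... | inj₁ (q , refl) = inj₁ (o-inj₁ q , πo a)
  ... | inj₂ (inj₁ (q , refl)) = inj₂ (inj₁ (o-inj₁ q , πo b))
  ... | inj₂ (inj₂ (inj₁ refl)) = inj₂ (inj₂ (inj₁ (so a)))
  ... | inj₂ (inj₂ (inj₂ refl)) = inj₂ (inj₂ (inj₂ (so b)))
  cover _ _ (isNew a) (isNew b) e with h.cover (trans (sym (nn a b)) e)
  ... | inj₁ (q , refl) = inj₁ ((λ x → old≢new (sym x)) , trans (πn a) (up-≢ q))
  ... | inj₂ (inj₁ (q , refl)) = inj₂ (inj₁ ((λ x → old≢new (sym x)) , trans (πn b) (up-≢ q)))
  ... | inj₂ (inj₂ (inj₁ refl)) = inj₂ (inj₂ (inj₁ (sn a)))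
  ... | inj₂ (inj₂ (inj₂ refl)) = inj₂ (inj₂ (inj₂ (sn b)))
  cover _ _ (isOld a) (isNew b) e = inj₂ (inj₁ (cross e))
  cover _ _ (isNew a) (isOld b) e = inj₁ (cross (adj-swap G e))

module AddVertex {n} (G′ : Graph (n + 1)) where

  o : Fin n → Fin (n + 1)
  o a = a ↑ˡ 1

  x : Fin (n + 1)
  x = n ↑ʳ zero

  at : ∀ {A : Set} → (Fin n → A) → A → Fin (n + 1) → A
  at f c = _⊕_ f (λ _ → c)

  o≢x : ∀ {a} → o a ≢ x
  o≢x = old≢new

  x≢o : ∀ {a} → x ≢ o a
  x≢o e = old≢new (sym e)

  o-inj : ∀ {a b} → o a ≡ o b → a ≡ b
  o-inj = ↑ˡ-inj

  at-o : ∀ {A : Set} (f : Fin n → A) c a → at f c (o a) ≡ f a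
  at-o f c = ⊕-old f _

  at-x : ∀ {A : Set} (f : Fin n → A) c → at f c x ≡ c
  at-x f c = ⊕-new f _ zero

  -- The common assembly for both Henneberg moves: the new vertex `x` gets the parent `px` and the
  -- image `sx`, while the pointers `po`, `so` of old vertices may be redirected to `x`.
  module _ (r : Fin n) (po so : Fin n → Fin (n + 1)) (px sx : Fin n) (do′ : Fin n → ℕ) (dx : ℕ)
    (down-o : ∀ a → a ≢ r → at do′ dx (po a) < do′ a) (down-x : do′ px < dx)
    (π-o : ∀ a → a ≢ r → adj G′ (o a) (po a) ≡ true) (π-x : adj G′ x (o px) ≡ true)
    (s-o : ∀ a → adj G′ (o a) (so a) ≡ true) (s-x : adj G′ x (o sx) ≡ true)
    (cov-oo : ∀ a b → adj G′ (o a) (o b) ≡ true → (a ≢ r × po a ≡ o b) ⊎ (b ≢ r × po b ≡ o a) ⊎ so a ≡ o b ⊎ so b ≡ o a)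
    (cov-xo : ∀ a → adj G′ x (o a) ≡ true → px ≡ a ⊎ (a ≢ r × po a ≡ x) ⊎ sx ≡ a ⊎ so a ≡ x)
    (ss-o : ∀ a → at so (o sx) (so a) ≢ o a) (ss-x : so sx ≢ x)
    (πs-o : ∀ a → a ≢ r → so a ≢ po a) (πs-x : sx ≢ px)
    (sπ-o : ∀ a → a ≢ r → at so (o sx) (po a) ≢ o a) (sπ-x : so px ≢ x) where

    private
      π s : Fin (n + 1) → Fin (n + 1)
      π = at po (o px)
      s = at so (o sx)
      d : Fin (n + 1) → ℕ
      d = at do′ dx
      V : Fin (n + 1) → Set
      V = Side {n} {1}
      ≢r : ∀ {a} → o a ≢ o r → a ≢ r
      ≢r q e = q (cong o e)
      r≢ : ∀ {a} → a ≢ r → o a ≢ o r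
      r≢ q e = q (o-inj e)
      down : ∀ i → V i → i ≢ o r → d (π i) < d i
      down _ (isOld a) q = subst₂ (λ p e → d p < e) (sym (at-o po _ a)) (sym (at-o do′ dx a)) (down-o a (≢r q))
      down _ (isNew zero) _ = subst₂ _<_ (sym (trans (cong d (at-x po _)) (at-o do′ dx px))) (sym (at-x do′ dx)) down-x
      π-adj : ∀ i → V i → i ≢ o r → adj G′ i (π i) ≡ true
      π-adj _ (isOld a) q = subst (λ p → adj G′ (o a) p ≡ true) (sym (at-o po _ a)) (π-o a (≢r q))
      π-adj _ (isNew zero) _ = subst (λ p → adj G′ x p ≡ true) (sym (at-x po _)) π-x
      s-adj : ∀ i → V i → adj G′ i (s i) ≡ true
      s-adj _ (isOld a) = subst (λ p → adj G′ (o a) p ≡ true) (sym (at-o so _ a)) (s-o a)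
      s-adj _ (isNew zero) = subst (λ p → adj G′ x p ≡ true) (sym (at-x so _)) s-x
      ss : ∀ i → V i → s (s i) ≢ i
      ss _ (isOld a) e = ss-o a (trans (cong s (sym (at-o so _ a))) e)
      ss _ (isNew zero) e = ss-x (trans (sym (trans (cong s (at-x so _)) (at-o so _ sx))) e)
      πs : ∀ i → V i → i ≢ o r → s i ≢ π i
      πs _ (isOld a) q e = πs-o a (≢r q) (trans (sym (at-o so _ a)) (trans e (at-o po _ a)))
      πs _ (isNew zero) _ e = πs-x (o-inj (trans (sym (at-x so _)) (trans e (at-x po _))))
      sπ : ∀ i → V i → i ≢ o r → s (π i) ≢ i
      sπ _ (isOld a) q e = sπ-o a (≢r q) (trans (cong s (sym (at-o po _ a))) e)
      sπ _ (isNew zero) _ e = sπ-x (trans (sym (trans (cong s (at-x po _)) (at-o so _ px))) e)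
      xo : ∀ a → adj G′ x (o a) ≡ true → (x ≢ o r × π x ≡ o a) ⊎ (o a ≢ o r × π (o a) ≡ x) ⊎ s x ≡ o a ⊎ s (o a) ≡ x
      xo a e with cov-xo a e
      ... | inj₁ refl = inj₁ (x≢o , at-x po _)
      ... | inj₂ (inj₁ (q , t)) = inj₂ (inj₁ (r≢ q , trans (at-o po _ a) t))
      ... | inj₂ (inj₂ (inj₁ refl)) = inj₂ (inj₂ (inj₁ (at-x so _)))
      ... | inj₂ (inj₂ (inj₂ t)) = inj₂ (inj₂ (inj₂ (trans (at-o so _ a) t)))
      flip : ∀ {A B C D : Set} → A ⊎ B ⊎ C ⊎ D → B ⊎ A ⊎ D ⊎ C
      flip (inj₁ t) = inj₂ (inj₁ t)
      flip (inj₂ (inj₁ t)) = inj₁ t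
      flip (inj₂ (inj₂ t)) = inj₂ (inj₂ (swap t))
      cover : ∀ i j → V i → V j → adj G′ i j ≡ true → (i ≢ o r × π i ≡ j) ⊎ (j ≢ o r × π j ≡ i) ⊎ s i ≡ j ⊎ s j ≡ i
      cover _ _ (isOld a) (isOld b) e with cov-oo a b e
      ... | inj₁ (q , t) = inj₁ (r≢ q , trans (at-o po _ a) t)
      ... | inj₂ (inj₁ (q , t)) = inj₂ (inj₁ (r≢ q , trans (at-o po _ b) t))
      ... | inj₂ (inj₂ (inj₁ t)) = inj₂ (inj₂ (inj₁ (trans (at-o so _ a) t)))
      ... | inj₂ (inj₂ (inj₂ t)) = inj₂ (inj₂ (inj₂ (trans (at-o so _ b) t)))
      cover _ _ (isNew zero) (isOld a) e = xo a e
      cover _ _ (isOld a) (isNew zero) e = flip (xo a (adj-swap G′ e))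
      cover _ _ (isNew zero) (isNew zero) e = ⊥-elim (T≢F e (adj-irr G′ x))

    cert : Cert G′
    cert = record { r = o r ; π = π ; s = s ; d = d ; down = λ {i} → down i (side {n} i) ; π-adj = λ {i} → π-adj i (side {n} i)
      ; s-adj = λ i → s-adj i (side {n} i) ; cover = λ {i} {j} → cover i j (side {n} i) (side {n} j) ; ss = λ i → ss i (side {n} i)
      ; πs = λ {i} → πs i (side {n} i) ; sπ = λ {i} → sπ i (side {n} i) }

-- The two new edges become the two outgoing edges of the new vertex, one in each part.
Cert-henneberg1 : ∀ {n} {G : Graph n} {G′ : Graph (n + 1)} → Cert G → Henneberg1 G G′ → Cert G′
Cert-henneberg1 {n} {G} {G′} C (oo , p , q , p≢q , xo) =
  cert r (o ∘ π) (o ∘ s) p q d (suc (d p))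
    (λ a h → subst (_< d a) (sym (at-o d _ (π a))) (down h)) ≤-refl
    (λ a h → old-adj (π-adj h)) (trans (xo p) (∨-inj₁ (=ᵛ-refl p)))
    (λ a → old-adj (s-adj a)) (trans (xo q) (∨-inj₂ {q =ᵛ p} (=ᵛ-refl q)))
    cov-oo cov-xo
    (λ a e → ss a (o-inj (trans (sym (at-o (o ∘ s) _ (s a))) e))) o≢x
    (λ a h e → πs h (o-inj e)) (λ e → p≢q (sym e))
    (λ a h e → sπ h (o-inj (trans (sym (at-o (o ∘ s) _ (π a))) e))) o≢x
  where
  open Cert C
  open AddVertex G′
  old-adj : ∀ {a b} → adj G a b ≡ true → adj G′ (o a) (o b) ≡ true
  old-adj e = trans (oo _ _) e
  cov-oo : ∀ a b → adj G′ (o a) (o b) ≡ true → _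
  cov-oo a b e with cover (trans (sym (oo a b)) e)
  ... | inj₁ (h , t) = inj₁ (h , cong o t)
  ... | inj₂ (inj₁ (h , t)) = inj₂ (inj₁ (h , cong o t))
  ... | inj₂ (inj₂ (inj₁ t)) = inj₂ (inj₂ (inj₁ (cong o t)))
  ... | inj₂ (inj₂ (inj₂ t)) = inj₂ (inj₂ (inj₂ (cong o t)))
  cov-xo : ∀ a → adj G′ x (o a) ≡ true → p ≡ a ⊎ (a ≢ r × o (π a) ≡ x) ⊎ q ≡ a ⊎ o (s a) ≡ x
  cov-xo a e with ∨-split {a =ᵛ p} (trans (sym (xo a)) e)
  ... | inj₁ t = inj₁ (sym (=ᵛ⇒≡ t))
  ... | inj₂ t = inj₂ (inj₂ (inj₁ (sym (=ᵛ⇒≡ t))))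

-- A form of Henneberg 2 that is symmetric in `u` and `v`, so that the pointer realizing the removed
-- edge may be assumed to start at `u`.
record Subdivision {n} (G : Graph n) (G′ : Graph (n + 1)) (u v w : Fin n) : Set where
  open AddVertex G′
  field
    w≢u : w ≢ u
    w≢v : w ≢ v
    keep : ∀ {a b} → adj G a b ≡ true → ¬ (a ≡ u × b ≡ v) → ¬ (a ≡ v × b ≡ u) → adj G′ (o a) (o b) ≡ true
    from : ∀ {a b} → adj G′ (o a) (o b) ≡ true → adj G a b ≡ true × ¬ (a ≡ u × b ≡ v) × ¬ (a ≡ v × b ≡ u)
    xu : adj G′ x (o u) ≡ true
    xv : adj G′ x (o v) ≡ true
    xw : adj G′ x (o w) ≡ true
    x-from : ∀ {a} → adj G′ x (o a) ≡ true → a ≡ u ⊎ a ≡ v ⊎ a ≡ w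

Subdivision-sym : ∀ {n} {G : Graph n} {G′ u v w} → Subdivision G G′ u v w → Subdivision G G′ v u w
Subdivision-sym S = record { w≢u = w≢v ; w≢v = w≢u ; keep = λ e h k → keep e k h ; from = λ e → let (a , h , k) = from e in a , k , h
    ; xu = xv ; xv = xu ; xw = xw ; x-from = λ e → [ inj₂ ∘ inj₁ , [ inj₁ , inj₂ ∘ inj₂ ]′ ]′ (x-from e) }
  where open Subdivision S

module _ {n} {G : Graph n} {G′ : Graph (n + 1)} {u v w : Fin n} (C : Cert G) (S : Subdivision G G′ u v w) where

  open Cert C
  open Subdivision S
  open AddVertex G′

  private
    redirect : (Fin n → Fin n) → Fin n → Fin (n + 1)
    redirect f a = if a == u then x else o (f a)
    re-u : ∀ f → redirect f u ≡ x
    re-u f rewrite ==-refl u = refl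
    re-≢ : ∀ f {a} → a ≢ u → redirect f a ≡ o (f a)
    re-≢ f h rewrite ==-≢ h = refl
    re-elim : ∀ f {a} (Q : Fin n → Fin (n + 1) → Set) → Q u x → (∀ {a} → a ≢ u → Q a (o (f a))) → Q a (redirect f a)
    re-elim f {a} Q h k with a ≟ u
    ... | yes refl = h
    ... | no a≢u = k a≢u

  -- The removed parent edge is replaced by the path from `u` through `x` to `v`, and `xw` becomes
  -- the functional edge of `x`. Doubling all depths leaves an odd value for `x` between those of
  -- `v` and `u`.
  subdivide-tree : u ≢ r → π u ≡ v → Cert G′
  subdivide-tree u≢r refl =
    cert r (redirect π) (o ∘ s) v w (λ a → 2 * d a) (suc (2 * d v))
      (λ a → re-elim π (λ a p → a ≢ r → at dd _ p < dd a)
         (λ _ → subst (_< dd u) (sym (at-x dd _)) (≤-trans (s≤s (≤-reflexive (sym (+-suc (d v) (d v + 0)))))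
             (*-monoʳ-≤ 2 (down u≢r))))
         (λ {a} _ h → subst (_< dd a) (sym (at-o dd _ (π a))) (*-monoʳ-< 2 (down h)))) ≤-refl
      (λ a → re-elim π (λ a p → a ≢ r → adj G′ (o a) p ≡ true) (λ _ → adj-swap G′ xu)
         (λ a≢u h → keep (π-adj h) (λ e → a≢u (proj₁ e))
             (λ { (refl , e) → <-asym (down u≢r) (subst (λ t → d t < d v) e (down h)) }))) xv
      (λ a → keep (s-adj a) (λ { (refl , e) → πs u≢r e }) (λ { (refl , e) → sπ u≢r e })) xw
      cov-oo cov-xo
      (λ a e → ss a (o-inj (trans (sym (at-o (o ∘ s) _ (s a))) e))) o≢x
      (λ a h → re-elim π (λ a p → a ≢ r → o (s a) ≢ p) (λ _ → o≢x) (λ _ h e → πs h (o-inj e)) h) w≢v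
      (λ a h → re-elim π (λ a p → a ≢ r → at (o ∘ s) (o w) p ≢ o a)
         (λ _ e → w≢u (o-inj (trans (sym (at-x (o ∘ s) (o w))) e)))
         (λ _ h e → sπ h (o-inj (trans (sym (at-o (o ∘ s) _ _)) e))) h) o≢x
    where
    dd : Fin n → ℕ
    dd a = 2 * d a
    one : ∀ {a b} → a ≢ r → π a ≡ b → ¬ (a ≡ u × b ≡ v) → redirect π a ≡ o b
    one {a} h refl k = re-≢ π (λ { refl → k (refl , refl) })
    cov-oo : ∀ a b → adj G′ (o a) (o b) ≡ true → _
    cov-oo a b e with from e
    ... | e′ , h , k with cover e′
    ...   | inj₁ (q , t) = inj₁ (q , one q t h)
    ...   | inj₂ (inj₁ (q , t)) = inj₂ (inj₁ (q , one q t (λ { (refl , refl) → k (refl , refl) })))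
    ...   | inj₂ (inj₂ (inj₁ t)) = inj₂ (inj₂ (inj₁ (cong o t)))
    ...   | inj₂ (inj₂ (inj₂ t)) = inj₂ (inj₂ (inj₂ (cong o t)))
    cov-xo : ∀ a → adj G′ x (o a) ≡ true → v ≡ a ⊎ (a ≢ r × redirect π a ≡ x) ⊎ w ≡ a ⊎ o (s a) ≡ x
    cov-xo a e with x-from e
    ... | inj₁ refl = inj₂ (inj₁ (u≢r , re-u π))
    ... | inj₂ (inj₁ refl) = inj₁ refl
    ... | inj₂ (inj₂ refl) = inj₂ (inj₂ (inj₁ refl))

  -- Now `x` is inserted into the functional edge from `u` to `v`, and `xw` makes `x` a leaf of the
  -- tree, so no old depth changes.
  subdivide-cycle : s u ≡ v → Cert G′
  subdivide-cycle refl =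
    cert r (o ∘ π) (redirect s) w v d (suc (d w))
      (λ a h → subst (_< d a) (sym (at-o d _ (π a))) (down h)) ≤-refl
      (λ a h → keep (π-adj h) (λ { (refl , e) → πs h (sym e) }) (λ { (refl , e) → sπ h (cong s e) })) xw
      (λ a → re-elim s (λ a p → adj G′ (o a) p ≡ true) (adj-swap G′ xu)
         (λ {a} a≢u → keep (s-adj a) (λ e → a≢u (proj₁ e)) (λ { (refl , e) → ss u e }))) xv
      cov-oo cov-xo
      (λ a → re-elim s (λ a p → at (redirect s) (o v) p ≢ o a)
         (λ e → adj-≢ G (s-adj u) (sym (o-inj (trans (sym (at-x (redirect s) (o v))) e))))
         (λ {a} _ e → no-return (trans (sym (at-o (redirect s) (o v) (s a))) e)))
      (λ e → x≢o (trans (sym e) (re-≢ s (λ t → adj-≢ G (s-adj u) (sym t)))))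
      (λ a h → re-elim s (λ a p → a ≢ r → p ≢ o (π a)) (λ _ → x≢o) (λ _ h e → πs h (o-inj e)) h) (λ e → w≢v (sym e))
      (λ a h e → no-parent h (trans (sym (at-o (redirect s) (o v) (π a))) e))
      (λ e → x≢o (trans (sym e) (re-≢ s w≢u)))
    where
    no-return : ∀ {a} → redirect s (s a) ≢ o a
    no-return {a} = re-elim s (λ b p → b ≡ s a → p ≢ o a) (λ _ → x≢o) (λ { _ refl e → ss a (o-inj e) }) refl
    no-parent : ∀ {a} → a ≢ r → redirect s (π a) ≢ o a
    no-parent {a} h = re-elim s (λ b p → b ≡ π a → p ≢ o a) (λ _ → x≢o) (λ { _ refl e → sπ h (o-inj e) }) refl
    one : ∀ {a b} → s a ≡ b → ¬ (a ≡ u × b ≡ v) → redirect s a ≡ o b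
    one refl k = re-≢ s (λ { refl → k (refl , refl) })
    cov-oo : ∀ a b → adj G′ (o a) (o b) ≡ true → _
    cov-oo a b e with from e
    ... | e′ , h , k with cover e′
    ...   | inj₁ (q , t) = inj₁ (q , cong o t)
    ...   | inj₂ (inj₁ (q , t)) = inj₂ (inj₁ (q , cong o t))
    ...   | inj₂ (inj₂ (inj₁ t)) = inj₂ (inj₂ (inj₁ (one t h)))
    ...   | inj₂ (inj₂ (inj₂ t)) = inj₂ (inj₂ (inj₂ (one t (λ { (refl , refl) → k (refl , refl) }))))
    cov-xo : ∀ a → adj G′ x (o a) ≡ true → w ≡ a ⊎ (a ≢ r × o (π a) ≡ x) ⊎ v ≡ a ⊎ redirect s a ≡ x
    cov-xo a e with x-from e
    ... | inj₁ refl = inj₂ (inj₂ (inj₂ (re-u s)))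
    ... | inj₂ (inj₁ refl) = inj₂ (inj₂ (inj₁ refl))
    ... | inj₂ (inj₂ refl) = inj₁ refl

Cert-henneberg2 : ∀ {n} {G : Graph n} {G′ : Graph (n + 1)} → Cert G → Henneberg2 G G′ → Cert G′
Cert-henneberg2 {n} {G} {G′} C (u , v , w , uv , w≢u , w≢v , oo , xo) = go (Cert.cover C uv)
  where
  open AddVertex G′
  is : Fin n → Fin n → Bool
  is a b = ((a =ᵛ u) ∧ (b =ᵛ v)) ∨ ((a =ᵛ v) ∧ (b =ᵛ u))
  keep : ∀ {a b} → adj G a b ≡ true → ¬ (a ≡ u × b ≡ v) → ¬ (a ≡ v × b ≡ u) → adj G′ (o a) (o b) ≡ true
  keep {a} {b} e h k = trans (oo a b) (cong₂ _∧_ e (cong not (≢true λ t → [ (λ p → let (x , y) = ∧-split {a =ᵛ u} p in h (=ᵛ⇒≡ x , =ᵛ⇒≡ y))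
    , (λ p → let (x , y) = ∧-split {a =ᵛ v} p in k (=ᵛ⇒≡ x , =ᵛ⇒≡ y)) ]′ (∨-split {(a =ᵛ u) ∧ (b =ᵛ v)} t))))
  from : ∀ {a b} → adj G′ (o a) (o b) ≡ true → adj G a b ≡ true × ¬ (a ≡ u × b ≡ v) × ¬ (a ≡ v × b ≡ u)
  from {a} {b} e with ∧-split {adj G a b} (trans (sym (oo a b)) e)
  ... | p , q = p , (λ { (refl , refl) → T≢F (∨-inj₁ (cong₂ _∧_ (=ᵛ-refl u) (=ᵛ-refl v))) not-is })
                  , (λ { (refl , refl) → T≢F (∨-inj₂ {(v =ᵛ u) ∧ (u =ᵛ v)} (cong₂ _∧_ (=ᵛ-refl v) (=ᵛ-refl u))) not-is })
    where
    not-is : is a b ≡ false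
    not-is = not-true q
  x-from : ∀ {a} → adj G′ x (o a) ≡ true → a ≡ u ⊎ a ≡ v ⊎ a ≡ w
  x-from {a} e with ∨-split {a =ᵛ u} (trans (sym (xo a)) e)
  ... | inj₁ p = inj₁ (=ᵛ⇒≡ p)
  ... | inj₂ p with ∨-split {a =ᵛ v} p
  ...   | inj₁ q = inj₂ (inj₁ (=ᵛ⇒≡ q))
  ...   | inj₂ q = inj₂ (inj₂ (=ᵛ⇒≡ q))
  S : Subdivision G G′ u v w
  S = record { w≢u = w≢u ; w≢v = w≢v ; keep = keep ; from = from
    ; xu = trans (xo u) (∨-inj₁ (=ᵛ-refl u))
    ; xv = trans (xo v) (∨-inj₂ {v =ᵛ u} (∨-inj₁ (=ᵛ-refl v)))
    ; xw = trans (xo w) (∨-inj₂ {w =ᵛ u} (∨-inj₂ {w =ᵛ v} (=ᵛ-refl w))) ; x-from = x-from }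
  go : _ → Cert G′
  go (inj₁ (h , e)) = subdivide-tree C S h e
  go (inj₂ (inj₁ (h , e))) = subdivide-tree C (Subdivision-sym S) h e
  go (inj₂ (inj₂ (inj₁ e))) = subdivide-cycle C S e
  go (inj₂ (inj₂ (inj₂ e))) = subdivide-cycle C (Subdivision-sym S) e

-- The vertex v of G is replaced by a complete graph on F 0, …, F k; the edge av of G becomes the edge from a to F (L a).
-- The new complete graph is rooted at α by τ, and every F i with i ≢ β receives the functional-graph edge σ i.
module VertexSplit {n k : ℕ} {G : Graph n} (C : Cert G) (v : Fin n) (G′ : Graph (n + k))
  (L : Fin n → Fin (suc k)) (α β : Fin (suc k)) (K : ℕ) (τ : Fin (suc k) → Fin (suc k)) (ρ : Fin (suc k) → ℕ)
  (σ : Fin (suc k) → Fin (n + k)) where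

  open Cert C

  o : Fin n → Fin (n + k)
  o a = a ↑ˡ k

  F : Fin (suc k) → Fin (n + k)
  F zero = o v
  F (suc i) = n ↑ʳ i

  o≢F : ∀ {a} → a ≢ v → ∀ i → o a ≢ F i
  o≢F h zero e = h (↑ˡ-inj e)
  o≢F h (suc i) e = old≢new e

  F-inj : ∀ {i j} → F i ≡ F j → i ≡ j
  F-inj {zero} {zero} _ = refl
  F-inj {zero} {suc j} e = ⊥-elim (old≢new e)
  F-inj {suc i} {zero} e = ⊥-elim (old≢new (sym e))
  F-inj {suc i} {suc j} e = cong suc (↑ʳ-inj {n} e)

  data View : Fin (n + k) → Set where
    outer : ∀ {a} → a ≢ v → View (o a)
    inner : ∀ i → View (F i)

  view : ∀ x → View x
  view x with side {n} {k} x
  ... | isNew i = inner (suc i)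
  ... | isOld a with a ≟ v
  ...   | yes refl = inner zero
  ...   | no h = outer h

  module _
    -- The copy `α` inherits the parent edge of `v`, so it must be the one to which the edge to
    -- `π v` is attached. If `v` is the root, the root stays at `F zero`, which is the old `v`.
    -- Likewise `β` inherits the edge to `s v`.
    (α-L : v ≢ r → α ≡ L (π v)) (α-r : v ≡ r → α ≡ zero) (β-L : β ≡ L (s v))
    (ρ-τ : ∀ {i} → i ≢ α → ρ (τ i) < ρ i) (ρ-K : ∀ i → ρ i < K)
    (oo : ∀ {a b} → a ≢ v → b ≢ v → adj G′ (o a) (o b) ≡ adj G a b)
    (L-adj : ∀ {a} → a ≢ v → adj G a v ≡ true → adj G′ (o a) (F (L a)) ≡ true)
    (L-inv : ∀ {a i} → a ≢ v → adj G′ (o a) (F i) ≡ true → (adj G a v ≡ true × i ≡ L a) ⊎ (i ≢ β × σ i ≡ o a))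
    (F-adj : ∀ {i j} → i ≢ j → adj G′ (F i) (F j) ≡ true)
    (σ-adj : ∀ {i} → i ≢ β → adj G′ (F i) (σ i) ≡ true)
    (σ-L : ∀ {i a} → i ≢ β → σ i ≡ o a → a ≢ v → L a ≢ i)
    (σσ : ∀ {i j} → i ≢ β → j ≢ β → σ i ≡ F j → σ j ≢ F i)
    (στ : ∀ {i} → i ≢ β → i ≢ α → σ i ≢ F (τ i))
    (τσ : ∀ {i} → i ≢ α → τ i ≢ β → σ (τ i) ≢ F i)
    (F-cover : ∀ {i j} → i ≢ j → (i ≢ α × τ i ≡ j) ⊎ (j ≢ α × τ j ≡ i) ⊎ (i ≢ β × σ i ≡ F j) ⊎ (j ≢ β × σ j ≡ F i)) where

    private
      ptr : Fin n → Fin n → Fin (n + k)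
      ptr a b = if b == v then F (L a) else o b

      ptr-v : ∀ a → ptr a v ≡ F (L a)
      ptr-v a rewrite ==-refl v = refl

      ptr-≢ : ∀ a {b} → b ≢ v → ptr a b ≡ o b
      ptr-≢ a h rewrite ==-≢ h = refl

      ptr-inj : ∀ {a b c} → ptr a b ≡ ptr a c → b ≡ c
      ptr-inj {a} {b} {c} e with b ≟ v | c ≟ v
      ... | yes refl | yes refl = refl
      ... | yes refl | no h = ⊥-elim (o≢F h (L a) (sym e))
      ... | no h | yes refl = ⊥-elim (o≢F h (L a) e)
      ... | no _ | no _ = ↑ˡ-inj e

      πF sF : Fin (suc k) → Fin (n + k)
      πF i = if i == α then o (π v) else F (τ i)
      sF i = if i == β then o (s v) else σ i

      -- Scaling all depths by `K` leaves room for the depths `ρ` of the copies, all below `K`,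
      -- between `v` and its children.
      dF : Fin (suc k) → ℕ
      dF i = K * d v + ρ i

      on-outer : {A : Set} → (Fin (suc k) → A) → (Fin n → A) → Fin n → A
      on-outer g h a = if a == v then g zero else h a

      extend : {A : Set} → (Fin (suc k) → A) → (Fin n → A) → Fin (n + k) → A
      extend g h = _⊕_ (on-outer g h) (g ∘ suc)

      extend-o : ∀ {A : Set} (g : Fin (suc k) → A) h {a} → a ≢ v → extend g h (o a) ≡ h a
      extend-o g h {a} q = trans (⊕-old (on-outer g h) _ a) (lem q)
        where
        lem : a ≢ v → on-outer g h a ≡ h a
        lem q rewrite ==-≢ q = refl

      extend-F : ∀ {A : Set} (g : Fin (suc k) → A) h i → extend g h (F i) ≡ g i
      extend-F g h zero = trans (⊕-old (on-outer g h) _ v) lem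
        where
        lem : on-outer g h v ≡ g zero
        lem rewrite ==-refl v = refl
      extend-F g h (suc i) = ⊕-new (on-outer g h) _ i

      π′ s′ : Fin (n + k) → Fin (n + k)
      π′ = extend πF (λ a → ptr a (π a))
      s′ = extend sF (λ a → ptr a (s a))
      d′ : Fin (n + k) → ℕ
      d′ = extend dF (λ a → K * d a)

      r′ : Fin (n + k)
      r′ = o r

      π-o : ∀ {a} → a ≢ v → π′ (o a) ≡ ptr a (π a)
      π-o = extend-o πF _
      s-o : ∀ {a} → a ≢ v → s′ (o a) ≡ ptr a (s a)
      s-o = extend-o sF _
      d-o : ∀ {a} → a ≢ v → d′ (o a) ≡ K * d a
      d-o = extend-o dF _
      d-F : ∀ i → d′ (F i) ≡ dF i
      d-F = extend-F dF _
      π-α : π′ (F α) ≡ o (π v)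
      π-α = trans (extend-F πF _ α) (cong (λ b → if b then o (π v) else F (τ α)) (==-refl α))
      π-F : ∀ {i} → i ≢ α → π′ (F i) ≡ F (τ i)
      π-F {i} h = trans (extend-F πF _ i) (cong (λ b → if b then o (π v) else F (τ i)) (==-≢ h))
      s-β : s′ (F β) ≡ o (s v)
      s-β = trans (extend-F sF _ β) (cong (λ b → if b then o (s v) else σ β) (==-refl β))
      s-F : ∀ {i} → i ≢ β → s′ (F i) ≡ σ i
      s-F {i} h = trans (extend-F sF _ i) (cong (λ b → if b then o (s v) else σ i) (==-≢ h))

      sv≢v : s v ≢ v
      sv≢v e = adj-≢ G (s-adj v) (sym e)
      πv≢v : v ≢ r → π v ≢ v
      πv≢v h e = <-irrefl (cong d e) (down h)

      root-F : ∀ {i} → F i ≢ r′ → i ≢ α ⊎ (i ≡ α × v ≢ r)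
      root-F {i} h with i ≟ α
      ... | no q = inj₁ q
      ... | yes e = inj₂ (e , λ { refl → h (cong F (trans e (α-r refl))) })

      F≢r : ∀ {i} → i ≢ α → F i ≢ r′
      F≢r {zero} h e = h (sym (α-r (↑ˡ-inj e)))
      F≢r {suc i} h e = old≢new (sym e)

      inner≢r : v ≢ r → ∀ i → F i ≢ r′
      inner≢r h zero e = h (↑ˡ-inj e)
      inner≢r h (suc i) e = old≢new (sym e)

      s-ptr : ∀ {a b} → a ≢ v → s b ≢ a → s′ (ptr a b) ≢ o a
      s-ptr {a} {b} a≢v h e with b ≟ v
      ... | no b≢v with s b ≟ v | trans (sym (s-o b≢v)) e
      ...   | yes _ | e′ = o≢F a≢v (L b) (sym e′)
      ...   | no _ | e′ = h (↑ˡ-inj e′)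
      s-ptr {a} a≢v h e | yes refl with L a ≟ β
      ... | yes q = h (↑ˡ-inj (trans (sym s-β) (trans (cong (s′ ∘ F) (sym q)) e)))
      ... | no q = σ-L q (trans (sym (s-F q)) e) a≢v refl

      s-o≢F : ∀ {a i} → a ≢ v → (s a ≡ v → L a ≢ i) → s′ (o a) ≢ F i
      s-o≢F {a} {i} a≢v h e with s a ≟ v | trans (sym (s-o a≢v)) e
      ... | yes p | e′ = h p (F-inj e′)
      ... | no q | e′ = o≢F q i e′

      down′ : ∀ x → View x → x ≢ r′ → d′ (π′ x) < d′ x
      down′ _ (outer {a} a≢v) h = subst₂ (λ p e → d′ p < e) (sym (π-o a≢v)) (sym (d-o a≢v)) lem
        where
        a≢r : a ≢ r
        a≢r e = h (cong o e)
        K>0 = ≤-trans (s≤s z≤n) (ρ-K zero)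
        lem : d′ (ptr a (π a)) < K * d a
        lem with π a ≟ v
        ... | no q = subst (_< K * d a) (sym (d-o q)) (*-monoʳ-< K ⦃ ℕ.>-nonZero K>0 ⦄ (down a≢r))
        ... | yes refl = subst (_< K * d a) (sym (d-F (L a))) (≤-trans (+-monoʳ-< (K * d (π a)) (ρ-K (L a)))
                (≤-trans (≤-reflexive (trans (+-comm (K * d (π a)) K) (sym (*-suc K (d (π a)))))) (*-monoʳ-≤ K (down a≢r))))
      down′ _ (inner i) h with root-F {i} h
      ... | inj₁ q = subst₂ _<_ (sym (trans (cong d′ (π-F q)) (d-F (τ i)))) (sym (d-F i)) (+-monoʳ-< (K * d v) (ρ-τ q))
      ... | inj₂ (refl , q) = subst₂ _<_ (sym (trans (cong d′ π-α) (d-o (πv≢v q)))) (sym (d-F α))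
              (≤-trans (*-monoʳ-< K ⦃ ℕ.>-nonZero (≤-trans (s≤s z≤n) (ρ-K zero)) ⦄ (down q)) (m≤m+n _ _))

      ptr-adj : ∀ {a b} → a ≢ v → adj G a b ≡ true → adj G′ (o a) (ptr a b) ≡ true
      ptr-adj {a} {b} a≢v e with b ≟ v
      ... | yes refl = L-adj a≢v e
      ... | no q = trans (oo a≢v q) e

      π-adj′ : ∀ x → View x → x ≢ r′ → adj G′ x (π′ x) ≡ true
      π-adj′ _ (outer {a} a≢v) h = subst (λ p → adj G′ (o a) p ≡ true) (sym (π-o a≢v)) (ptr-adj a≢v (π-adj (λ e → h (cong o e))))
      π-adj′ _ (inner i) h with root-F {i} h
      ... | inj₁ q = subst (λ p → adj G′ (F i) p ≡ true) (sym (π-F q)) (F-adj {i} (λ e → <-irrefl (cong ρ (sym e)) (ρ-τ q)))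
      ... | inj₂ (refl , q) = subst₂ (λ j p → adj G′ (F j) p ≡ true) (sym (α-L q)) (sym π-α)
              (adj-swap G′ (L-adj (πv≢v q) (adj-swap G (π-adj q))))

      s-adj′ : ∀ x → View x → adj G′ x (s′ x) ≡ true
      s-adj′ _ (outer {a} a≢v) = subst (λ p → adj G′ (o a) p ≡ true) (sym (s-o a≢v)) (ptr-adj a≢v (s-adj a))
      s-adj′ _ (inner i) with i ≟ β
      ... | no q = subst (λ p → adj G′ (F i) p ≡ true) (sym (s-F q)) (σ-adj q)
      ... | yes refl = subst₂ (λ j p → adj G′ (F j) p ≡ true) (sym β-L) (sym s-β) (adj-swap G′ (L-adj sv≢v (adj-swap G (s-adj v))))

      ss′ : ∀ x → View x → s′ (s′ x) ≢ x
      ss′ _ (outer {a} a≢v) e = s-ptr a≢v (ss a) (trans (cong s′ (sym (s-o a≢v))) e)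
      ss′ _ (inner i) e with i ≟ β
      ... | yes refl = s-o≢F {i = β} sv≢v (λ q → ⊥-elim (ss v q)) (trans (cong s′ (sym s-β)) e)
      ... | no q with trans (cong s′ (sym (s-F q))) e
      ...   | e′ = lem (view (σ i)) refl e′
        where
        lem : ∀ {y} → View y → y ≡ σ i → s′ y ≢ F i
        lem (outer b≢v) eq = s-o≢F b≢v (λ _ → σ-L q (sym eq) b≢v)
        lem (inner j) eq e″ with j ≟ β
        ... | no t = σσ {i} q t (sym eq) (trans (sym (s-F t)) e″)
        ... | yes refl = o≢F sv≢v i (trans (sym s-β) e″)

      πs′ : ∀ x → View x → x ≢ r′ → s′ x ≢ π′ x
      πs′ _ (outer {a} a≢v) h e = πs (λ t → h (cong o t)) (ptr-inj {a} (trans (sym (s-o a≢v)) (trans e (π-o a≢v))))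
      πs′ _ (inner i) h e with root-F {i} h | i ≟ β
      ... | inj₁ q | yes refl = o≢F sv≢v (τ i) (trans (sym s-β) (trans e (π-F q)))
      ... | inj₁ q | no t = στ t q (trans (sym (s-F t)) (trans e (π-F q)))
      ... | inj₂ (refl , q) | yes eq = πs q (↑ˡ-inj (trans (sym s-β) (trans (cong (s′ ∘ F) (sym eq)) (trans e π-α))))
      ... | inj₂ (refl , q) | no t = σ-L t (trans (sym (s-F t)) (trans e π-α)) (πv≢v q) (sym (α-L q))

      sπ′ : ∀ x → View x → x ≢ r′ → s′ (π′ x) ≢ x
      sπ′ _ (outer {a} a≢v) h e = s-ptr a≢v (sπ (λ t → h (cong o t))) (trans (cong s′ (sym (π-o a≢v))) e)
      sπ′ _ (inner i) h e with root-F {i} h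
      ... | inj₂ (refl , q) = s-o≢F {i = α} (πv≢v q) (λ t → ⊥-elim (sπ q t)) (trans (cong s′ (sym π-α)) e)
      ... | inj₁ q with τ i ≟ β | trans (cong s′ (sym (π-F q))) e
      ...   | yes eq | e′ = o≢F sv≢v i (trans (sym s-β) (trans (cong (s′ ∘ F) (sym eq)) e′))
      ...   | no t | e′ = τσ q t (trans (sym (s-F t)) e′)

      Covered : Fin (n + k) → Fin (n + k) → Set
      Covered x y = (x ≢ r′ × π′ x ≡ y) ⊎ (y ≢ r′ × π′ y ≡ x) ⊎ s′ x ≡ y ⊎ s′ y ≡ x

      flip : ∀ {x y} → Covered x y → Covered y x
      flip (inj₁ t) = inj₂ (inj₁ t)
      flip (inj₂ (inj₁ t)) = inj₁ t
      flip (inj₂ (inj₂ t)) = inj₂ (inj₂ (swap t))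

      mixed : ∀ {a i} → a ≢ v → adj G′ (o a) (F i) ≡ true → Covered (o a) (F i)
      mixed {a} {i} a≢v e with L-inv {a} {i} a≢v e
      ... | inj₂ (q , t) = inj₂ (inj₂ (inj₂ (trans (s-F q) t)))
      ... | inj₁ (e′ , refl) with cover e′
      ...   | inj₁ (h , t) = inj₁ ((λ x → h (↑ˡ-inj x)) , trans (π-o a≢v) (trans (cong (ptr a) t) (ptr-v a)))
      ...   | inj₂ (inj₁ (h , refl)) = inj₂ (inj₁ (subst (λ i → F i ≢ r′) (α-L h) (inner≢r h α) , trans
          (cong (π′ ∘ F) (sym (α-L h))) π-α))
      ...   | inj₂ (inj₂ (inj₁ t)) = inj₂ (inj₂ (inj₁ (trans (s-o a≢v) (trans (cong (ptr a) t) (ptr-v a)))))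
      ...   | inj₂ (inj₂ (inj₂ refl)) = inj₂ (inj₂ (inj₂ (trans (cong (s′ ∘ F) (sym β-L)) s-β)))

      cover′ : ∀ x y → View x → View y → adj G′ x y ≡ true → Covered x y
      cover′ _ _ (outer {a} a≢v) (outer {b} b≢v) e with cover (trans (sym (oo a≢v b≢v)) e)
      ... | inj₁ (h , t) = inj₁ ((λ x → h (↑ˡ-inj x)) , trans (π-o a≢v) (trans (cong (ptr a) t) (ptr-≢ a b≢v)))
      ... | inj₂ (inj₁ (h , t)) = inj₂ (inj₁ ((λ x → h (↑ˡ-inj x)) , trans (π-o b≢v) (trans (cong (ptr b) t) (ptr-≢ b a≢v))))
      ... | inj₂ (inj₂ (inj₁ t)) = inj₂ (inj₂ (inj₁ (trans (s-o a≢v) (trans (cong (ptr a) t) (ptr-≢ a b≢v)))))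
      ... | inj₂ (inj₂ (inj₂ t)) = inj₂ (inj₂ (inj₂ (trans (s-o b≢v) (trans (cong (ptr b) t) (ptr-≢ b a≢v)))))
      cover′ _ _ (outer a≢v) (inner i) e = mixed {i = i} a≢v e
      cover′ _ _ (inner i) (outer a≢v) e = flip {o _} {F i} (mixed {i = i} a≢v (adj-swap G′ e))
      cover′ _ _ (inner i) (inner j) e with F-cover {i} {j} (λ { refl → T≢F e (adj-irr G′ _) })
      ... | inj₁ (h , t) = inj₁ (F≢r {i} h , trans (π-F h) (cong F t))
      ... | inj₂ (inj₁ (h , t)) = inj₂ (inj₁ (F≢r {j} h , trans (π-F h) (cong F t)))
      ... | inj₂ (inj₂ (inj₁ (h , t))) = inj₂ (inj₂ (inj₁ (trans (s-F h) t)))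
      ... | inj₂ (inj₂ (inj₂ (h , t))) = inj₂ (inj₂ (inj₂ (trans (s-F h) t)))

    cert : Cert G′
    cert = record { r = r′ ; π = π′ ; s = s′ ; d = d′ ; down = λ {x} → down′ x (view x) ; π-adj = λ {x} → π-adj′ x (view x)
      ; s-adj = λ x → s-adj′ x (view x) ; cover = λ {x} {y} → cover′ x y (view x) (view y) ; ss = λ x → ss′ x (view x)
      ; πs = λ {x} → πs′ x (view x) ; sπ = λ {x} → sπ′ x (view x) }

root-or : ∀ {n} {A : Set} (v r : Fin n) → A → A → A
root-or v r x y = if v == r then x else y

root-yes : ∀ {n} {A : Set} {v r : Fin n} {x y : A} → v ≡ r → root-or v r x y ≡ x
root-yes {v = v} refl rewrite ==-refl v = refl

root-no : ∀ {n} {A : Set} {v r : Fin n} {x y : A} → v ≢ r → root-or v r x y ≡ y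
root-no h rewrite ==-≢ h = refl

-- Two edges are gained. The one between the two copies of `v` joins the tree, which is why `τ`
-- swaps them. The old edge `uv` goes to the copy `β`, and the other edge at `u` becomes the
-- functional edge of the other copy.
Cert-edgeToK3 : ∀ {n} {G : Graph n} {G′ : Graph (n + 1)} → Cert G → EdgeToK3 G G′ → Cert G′
Cert-edgeToK3 {n} {G} {G′} C (u , v , uv , oo , vx , uv′ , ux , sums) =
  cert (λ h → root-no h) (λ h → root-yes h) β-L (λ {i} → ρ-τ i) (λ i → ρ-K i (i == α))
    (λ a≢v b≢v → oo _ _ a≢v b≢v) (λ {a} → L-adj a) (λ {a} {i} → L-inv a i) (λ {i} {j} → F-adj i j) (λ {i} → σ-adj i)
    (λ {i} {a} q e a≢v t → q (trans (sym t) (trans (cong L (sym (↑ˡ-inj e))) L-u)))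
    (λ {i} {j} _ _ e _ → o≢F u≢v j e) (λ {i} _ _ e → o≢F u≢v (τ i) e) (λ {i} _ _ e → o≢F u≢v i e) (λ {i} {j} → F-cover i j)
  where
  open Cert C
  u≢v = adj-≢ G uv
  L₀ : Fin n → Fin 2
  L₀ a = if adj G′ (a ↑ˡ 1) (v ↑ˡ 1) then 0F else 1F
  -- If `s v` is `u`, either copy may inherit this edge, since `u` is joined to both; `0F` is a
  -- choice.
  β : Fin 2
  β = if s v == u then 0F else L₀ (s v)
  L : Fin n → Fin 2
  L a = if a == u then β else L₀ a
  α : Fin 2
  α = root-or v r 0F (L (π v))
  τ : Fin 2 → Fin 2
  τ 0F = 1F
  τ 1F = 0F
  ρ : Fin 2 → ℕ
  ρ i = if i == α then 0 else 1
  open VertexSplit C v G′ L α β 2 τ ρ (λ _ → u ↑ˡ 1)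
  L-u : L u ≡ β
  L-u rewrite ==-refl u = refl
  β-L : β ≡ L (s v)
  β-L with s v ≟ u
  ... | yes _ = refl
  ... | no _ = refl
  ρ-τ : ∀ i → i ≢ α → ρ (τ i) < ρ i
  ρ-τ i h with α
  ρ-τ 0F h | 0F = ⊥-elim (h refl)
  ρ-τ 0F h | 1F = s≤s z≤n
  ρ-τ 1F h | 0F = s≤s z≤n
  ρ-τ 1F h | 1F = ⊥-elim (h refl)
  ρ-K : ∀ i b → (if b then 0 else 1) < 2
  ρ-K i true = s≤s z≤n
  ρ-K i false = s≤s (s≤s z≤n)
  u-adj : ∀ i → adj G′ (o u) (F i) ≡ true
  u-adj 0F = uv′
  u-adj 1F = ux
  L-adj : ∀ a → a ≢ v → adj G a v ≡ true → adj G′ (o a) (F (L a)) ≡ true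
  L-adj a a≢v e with a ≟ u
  ... | yes refl = u-adj β
  ... | no a≢u = lem refl (sums a a≢v a≢u)
    where
    lem : ∀ {b} → adj G′ (o a) (o v) ≡ b → b2n b + b2n (adj G′ (o a) (F 1F)) ≡ b2n (adj G a v) → adj G′ (o a)
        (F (if b then 0F else 1F)) ≡ true
    lem {true} p _ = p
    lem {false} p q with adj G′ (o a) (F 1F) | adj G a v
    ... | true | _ = refl
    lem {false} p () | false | true
    lem {false} p q | false | false = e
  L-inv : ∀ a i → a ≢ v → adj G′ (o a) (F i) ≡ true → (adj G a v ≡ true × i ≡ L a) ⊎ (i ≢ β × u ↑ˡ 1 ≡ o a)
  L-inv a i a≢v e with a ≟ u
  L-inv a i a≢v e | yes refl with i ≟ β
  ... | yes q = inj₁ (uv , q)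
  ... | no q = inj₂ (q , refl)
  L-inv a i a≢v e | no a≢u = inj₁ (lem i e (sums a a≢v a≢u))
    where
    lem : ∀ i → adj G′ (o a) (F i) ≡ true → b2n (adj G′ (o a) (o v)) + b2n (adj G′ (o a) (F 1F)) ≡ b2n (adj G a v) → adj G a v ≡
        true × i ≡ L₀ a
    lem 0F e q with adj G′ (o a) (o v) | adj G a v
    ... | true | true = refl , refl
    lem 0F e () | true | false
    lem 1F e q with adj G′ (o a) (o v) | adj G′ (o a) (F 1F) | adj G a v
    ... | false | true | true = refl , refl
    lem 1F e () | false | true | false
    lem 1F e () | true | true | true
    lem 1F e () | true | true | false
  F-adj : ∀ i j → i ≢ j → adj G′ (F i) (F j) ≡ true
  F-adj 0F 0F h = ⊥-elim (h refl)
  F-adj 0F 1F h = vx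
  F-adj 1F 0F h = adj-swap G′ vx
  F-adj 1F 1F h = ⊥-elim (h refl)
  σ-adj : ∀ i → i ≢ β → adj G′ (F i) (o u) ≡ true
  σ-adj i _ = adj-swap G′ (u-adj i)
  F-cover : ∀ i j → i ≢ j → (i ≢ α × τ i ≡ j) ⊎ (j ≢ α × τ j ≡ i) ⊎ (i ≢ β × u ↑ˡ 1 ≡ F j) ⊎ (j ≢ β × u ↑ˡ 1 ≡ F i)
  F-cover i j h with α
  F-cover 0F 0F h | _ = ⊥-elim (h refl)
  F-cover 1F 1F h | _ = ⊥-elim (h refl)
  F-cover 0F 1F h | 0F = inj₂ (inj₁ ((λ ()) , refl))
  F-cover 0F 1F h | 1F = inj₁ ((λ ()) , refl)
  F-cover 1F 0F h | 0F = inj₁ ((λ ()) , refl)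
  F-cover 1F 0F h | 1F = inj₂ (inj₁ ((λ ()) , refl))

-- K4 is the union of the Hamiltonian paths 0-1-2-3 and 1-3-0-2; τ₄ α and σ₄ β follow them towards α and β.
opaque
  τ₄ σ₄ : Fin 4 → Fin 4 → Fin 4
  τ₄ α i = Vec.lookup (Vec.lookup ((0F ∷ 0F ∷ 1F ∷ 2F ∷ []) ∷ (1F ∷ 1F ∷ 1F ∷ 2F ∷ []) ∷ (1F ∷ 2F ∷ 2F ∷ 2F ∷ []) ∷
      (1F ∷ 2F ∷ 3F ∷ 3F ∷ []) ∷ []) α) i
  σ₄ β i = Vec.lookup (Vec.lookup ((0F ∷ 3F ∷ 0F ∷ 0F ∷ []) ∷ (3F ∷ 1F ∷ 0F ∷ 1F ∷ []) ∷ (2F ∷ 3F ∷ 2F ∷ 0F ∷ []) ∷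
      (3F ∷ 3F ∷ 0F ∷ 3F ∷ []) ∷ []) β) i

  ρ₄ : Fin 4 → Fin 4 → ℕ
  ρ₄ α i = ℕ.∣ toℕ α - toℕ i ∣

module K4Paths where

  opaque
    unfolding τ₄ σ₄ ρ₄

    ρ-τ : ∀ α i → i ≢ α → ρ₄ α (τ₄ α i) < ρ₄ α i
    ρ-τ = from-yes (all? λ α → all? λ i → ¬? (i ≟ α) →-dec (ρ₄ α (τ₄ α i) ℕ.<? ρ₄ α i))

    ρ-4 : ∀ α i → ρ₄ α i < 4
    ρ-4 = from-yes (all? λ α → all? λ i → ρ₄ α i ℕ.<? 4)

    σ-≢ : ∀ β i → i ≢ β → i ≢ σ₄ β i
    σ-≢ = from-yes (all? λ β → all? λ i → ¬? (i ≟ β) →-dec ¬? (i ≟ σ₄ β i))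

    σσ : ∀ β i → i ≢ β → σ₄ β i ≢ β → σ₄ β (σ₄ β i) ≢ i
    σσ = from-yes (all? λ β → all? λ i → ¬? (i ≟ β) →-dec (¬? (σ₄ β i ≟ β) →-dec ¬? (σ₄ β (σ₄ β i) ≟ i)))

    στ : ∀ α β i → i ≢ β → i ≢ α → σ₄ β i ≢ τ₄ α i
    στ = from-yes (all? λ α → all? λ β → all? λ i → ¬? (i ≟ β) →-dec (¬? (i ≟ α) →-dec ¬? (σ₄ β i ≟ τ₄ α i)))

    τσ : ∀ α β i → i ≢ α → τ₄ α i ≢ β → σ₄ β (τ₄ α i) ≢ i
    τσ = from-yes (all? λ α → all? λ β → all? λ i → ¬? (i ≟ α) →-dec (¬? (τ₄ α i ≟ β) →-dec ¬? (σ₄ β (τ₄ α i) ≟ i)))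

    covered : ∀ α β i j → i ≢ j → (i ≢ α × τ₄ α i ≡ j) ⊎ (j ≢ α × τ₄ α j ≡ i) ⊎ (i ≢ β × σ₄ β i ≡ j) ⊎ (j ≢ β × σ₄ β j ≡ i)
    covered = from-yes (all? λ α → all? λ β → all? λ i → all? λ j → ¬? (i ≟ j) →-dec ((¬? (i ≟ α) ×-dec (τ₄ α i ≟ j)) ⊎-dec
      ((¬? (j ≟ α) ×-dec (τ₄ α j ≟ i)) ⊎-dec ((¬? (i ≟ β) ×-dec (σ₄ β i ≟ j)) ⊎-dec (¬? (j ≟ β) ×-dec (σ₄ β j ≟ i))))))

-- The six new edges form two Hamiltonian paths. One, directed towards `α`, extends the tree, and
-- the other, directed towards `β`, the functional graph; both orientations exist for any `α` and
-- `β`.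
Cert-vertexToK4 : ∀ {n} {G : Graph n} {G′ : Graph (n + 3)} → Cert G → VertexToK4 G G′ → Cert G′
Cert-vertexToK4 {n} {G} {G′} C (v , oo , vx , xx , sums) =
  cert (λ h → root-no h) (λ h → root-yes h) refl (λ {i} → K4Paths.ρ-τ α i) (K4Paths.ρ-4 α)
    (λ a≢v b≢v → oo _ _ a≢v b≢v) (λ {a} → L-adj a) (λ {a} {i} a≢v e → inj₁ (L-inv a i a≢v e)) (λ {i} {j} → F-adj i j)
    (λ {i} q → subst (λ z → adj G′ (F i) z ≡ true) (F≡y (σ₄ β i)) (F-adj i (σ₄ β i) (K4Paths.σ-≢ β i q)))
    (λ {i} q e a≢v → ⊥-elim (o≢F a≢v (σ₄ β i) (trans (sym e) (sym (F≡y (σ₄ β i))))))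
    (λ {i} {j} p q e f → σσ i p q (F-inj e) (F-inj f))
    (λ {i} p q e → K4Paths.στ α β i p q (F-inj e)) (λ {i} p q e → K4Paths.τσ α β i p q (F-inj e)) (λ {i} {j} → F-cover i j)
  where
  open Cert C
  -- A former neighbour of `v` is joined to exactly one of the four vertices, so `3F` is forced if
  -- the first three fail.
  first : Bool → Bool → Bool → Fin 4
  first true _ _ = 0F
  first false true _ = 1F
  first false false true = 2F
  first false false false = 3F
  y : Fin 4 → Fin (n + 3)
  y zero = v ↑ˡ 3
  y (suc i) = n ↑ʳ i
  L : Fin n → Fin 4
  L a = first (adj G′ (a ↑ˡ 3) (y 0F)) (adj G′ (a ↑ˡ 3) (y 1F)) (adj G′ (a ↑ˡ 3) (y 2F))
  α β : Fin 4
  α = root-or v r 0F (L (π v))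
  β = L (s v)
  open VertexSplit C v G′ L α β 4 (τ₄ α) (ρ₄ α) (λ i → y (σ₄ β i)) renaming (F-inj to F-inj′)
  F≡y : ∀ i → F i ≡ y i
  F≡y zero = refl
  F≡y (suc i) = refl
  F-inj : ∀ {i j} → y i ≡ F j → i ≡ j
  F-inj {i} {j} e = F-inj′ {i} {j} (trans (F≡y i) e)
  σσ : ∀ i {j} → i ≢ β → j ≢ β → σ₄ β i ≡ j → σ₄ β j ≢ i
  σσ i p q refl = K4Paths.σσ β i p q
  L-adj : ∀ a → a ≢ v → adj G a v ≡ true → adj G′ (o a) (F (L a)) ≡ true
  L-adj a a≢v e = lem refl refl refl (sums a a≢v)
    where
    lem : ∀ {b₀ b₁ b₂} → adj G′ (o a) (F 0F) ≡ b₀ → adj G′ (o a) (F 1F) ≡ b₁ → adj G′ (o a) (F 2F) ≡ b₂ →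
          b2n b₀ + b2n b₁ + b2n b₂ + b2n (adj G′ (o a) (F 3F)) ≡ b2n (adj G a v) → adj G′ (o a) (F (first b₀ b₁ b₂)) ≡ true
    lem {true} p _ _ _ = p
    lem {false} {true} _ p _ _ = p
    lem {false} {false} {true} _ _ p _ = p
    lem {false} {false} {false} _ _ _ q with adj G′ (o a) (F 3F)
    ... | true = refl
    lem {false} {false} {false} _ _ _ q | false with () ← trans q (cong b2n e)
  L-inv : ∀ a i → a ≢ v → adj G′ (o a) (F i) ≡ true → adj G a v ≡ true × i ≡ L a
  L-inv a i a≢v e = lem _ _ _ _ _ i (trans (at i) e) (sums a a≢v)
    where
    pick4 : Bool → Bool → Bool → Bool → Fin 4 → Bool
    pick4 a b c d 0F = a
    pick4 a b c d 1F = b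
    pick4 a b c d 2F = c
    pick4 a b c d 3F = d
    at : ∀ i → pick4 (adj G′ (o a) (F 0F)) (adj G′ (o a) (F 1F)) (adj G′ (o a) (F 2F)) (adj G′ (o a) (F 3F)) i ≡ adj G′ (o a) (F i)
    at 0F = refl
    at 1F = refl
    at 2F = refl
    at 3F = refl
    lem : ∀ b₀ b₁ b₂ b₃ c i → pick4 b₀ b₁ b₂ b₃ i ≡ true → b2n b₀ + b2n b₁ + b2n b₂ + b2n b₃ ≡ b2n c → c ≡ true × i ≡ first b₀ b₁ b₂
    lem true false false false true 0F _ _ = refl , refl
    lem true false false false true 1F () _
    lem true false false false true 2F () _
    lem true false false false true 3F () _
    lem false true false false true 1F _ _ = refl , refl
    lem false true false false true 2F () _
    lem false true false false true 3F () _
    lem false false true false true 2F _ _ = refl , refl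
    lem false false true false true 3F () _
    lem false false false true true 3F _ _ = refl , refl
  F-adj : ∀ i j → i ≢ j → adj G′ (F i) (F j) ≡ true
  F-adj zero zero h = ⊥-elim (h refl)
  F-adj zero (suc j) h = vx j
  F-adj (suc i) zero h = adj-swap G′ (vx i)
  F-adj (suc i) (suc j) h = xx i j (λ { refl → h refl })
  F-cover : ∀ i j → i ≢ j → (i ≢ α × τ₄ α i ≡ j) ⊎ (j ≢ α × τ₄ α j ≡ i) ⊎ (i ≢ β × y (σ₄ β i) ≡ F j) ⊎ (j ≢ β × y (σ₄ β j) ≡ F i)
  F-cover i j h with K4Paths.covered α β i j h
  ... | inj₁ t = inj₁ t
  ... | inj₂ (inj₁ t) = inj₂ (inj₁ t)
  ... | inj₂ (inj₂ (inj₁ (p , t))) = inj₂ (inj₂ (inj₁ (p , trans (cong y t) (sym (F≡y j)))))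
  ... | inj₂ (inj₂ (inj₂ (p , t))) = inj₂ (inj₂ (inj₂ (p , trans (cong y t) (sym (F≡y i)))))

Derivable⇒Cert : ∀ {n} {G : Graph n} → Derivable G → Cert G
Derivable⇒Cert (base-K5-e I) = Cert-iso K5-e _ I Cert-K5-e
Derivable⇒Cert (base-K4⊔K4 I) = Cert-iso K4⊔K4 _ I Cert-K4⊔K4
Derivable⇒Cert (iso D I) = Cert-iso _ _ I (Derivable⇒Cert D)
Derivable⇒Cert (henneberg1 D M) = Cert-henneberg1 (Derivable⇒Cert D) M
Derivable⇒Cert (henneberg2 D M) = Cert-henneberg2 (Derivable⇒Cert D) M
Derivable⇒Cert (vertexToK4 D M) = Cert-vertexToK4 (Derivable⇒Cert D) M
Derivable⇒Cert (edgeToK3 D M) = Cert-edgeToK3 (Derivable⇒Cert D) M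
Derivable⇒Cert (edgeJoin D D′ M) = Cert-edgeJoin (Derivable⇒Cert D) (Derivable⇒Cert D′) M

-- Inverse moves

TightOn : ∀ {n} → Graph n → Set
TightOn {n} G = SparseOn G × E G full + 1 ≡ 2 * card (full {n})

∅ : ∀ {n} → VSet n
∅ _ = false

card-∅ : ∀ n → card (∅ {n}) ≡ 0
card-∅ n = card-empty {n} {∅} (λ _ → refl)

tightOn-iso : ∀ {m n} (G : Graph m) (H : Graph n) → Iso G H → TightOn H → TightOn G
tightOn-iso G H I (s , t) = iso-sparse H G (iso-sym G H I) s , iso-full H G (iso-sym G H I) t

E-agree : ∀ {m} {G H : Graph m} X → (∀ {a b} → X a ≡ true → X b ≡ true → adj G a b ≡ adj H a b) → E G X ≡ E H X
E-agree {G = G} {H} X h = ≤-antisym (half G H h) (half H G (λ p q → sym (h p q)))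
  where
  opaque
    unfolding E
    half : ∀ G H → (∀ {a b} → X a ≡ true → X b ≡ true → adj G a b ≡ adj H a b) → E G X ≤ E H X
    half G H h = ∑-mono λ a → ∑-mono λ b → b2n-mono λ p →
      let (q , x) = ∧-split {(toℕ a <ᵇ toℕ b) ∧ adj G a b} p ; (l , g) = ∧-split {toℕ a <ᵇ toℕ b} q ; (xa , xb) = ∧-split {X a} x
      in cong₂ _∧_ (cong₂ _∧_ l (trans (sym (h xa xb)) g)) x

module _ {n} (G : Graph n) where

  deg-add : ∀ {z y} Y → Y y ≡ false → deg G z (add y Y) ≡ deg G z Y + b2n (adj G z y)
  deg-add {z} {y} Y e with adj G z y in a
  ... | true = trans (deg-rem-nbr G (add y Y) a (add-new y Y)) (trans (cong suc (deg-cong G (rem-add Y e))) (+-comm 1 _))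
  ... | false = trans (trans (deg-def G z _) (trans (card-cong pt) (sym (deg-def G z Y)))) (sym (+-identityʳ _))
    where
    pt : ∀ j → (adj G z j ∧ add y Y j) ≡ (adj G z j ∧ Y j)
    pt j with j ≟ y
    ... | yes refl rewrite a = refl
    ... | no p = cong (adj G z j ∧_) (add-≢ Y p)

iso-deg : ∀ {m n} (G : Graph m) (H : Graph n) (I : Iso G H) z X → deg H (proj₁ I z) X ≡ deg G z (X ∘ proj₁ I)
iso-deg G H I z X = trans (deg-def H _ X) (trans (iso-card G H I _)
  (trans (card-cong (λ j → cong (_∧ X (proj₁ I j)) (proj₂ (proj₂ (proj₂ (proj₂ I))) z j))) (sym (deg-def G z _))))

module Extension {m k : ℕ} (G : Graph (m + k)) where

  o : Fin m → Fin (m + k)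
  o a = a ↑ˡ k

  x : Fin k → Fin (m + k)
  x i = m ↑ʳ i

  base : VSet m → VSet (m + k)
  base X = X ⊕ ∅

  base-o : ∀ X a → base X (o a) ≡ X a
  base-o X = ⊕-old X ∅

  base-x : ∀ X i → base X (x i) ≡ false
  base-x X = ⊕-new X ∅

  E-base : ∀ X → E (pullback G o) X ≡ E G (base X)
  E-base X = sym (trans (E-old G (base X) (base-x X)) (E-cong _ (base-o X)))

  card-base : ∀ X → card (base X) ≡ card X
  card-base X = trans (card-↑ {m} {k} (base X)) (trans (cong₂ _+_ (card-cong (base-o X))
      (card-empty {X = λ i → base X (x i)} (base-x X))) (+-identityʳ _))

  card-⊕full : ∀ X → card (X ⊕ full {k}) ≡ card X + k
  card-⊕full X = trans (card-↑ {m} {k} _) (cong₂ _+_ (card-cong (⊕-old X full))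
      (trans (card-cong (⊕-new X (full {k}))) (card-full k)))

  deg-base : ∀ z X → deg G z (base X) ≡ card (λ j → adj G z (o j) ∧ X j)
  deg-base z X = trans (deg-def G z _) (trans (card-↑ {m} {k} _)
    (trans (cong₂ _+_ (card-cong (λ j → cong (adj G z (o j) ∧_) (base-o X j)))
      (card-empty {X = λ i → adj G z (x i) ∧ base X (x i)} (λ i → trans (cong (adj G z (x i) ∧_) (base-x X i)) (∧-zeroʳ _))))
          (+-identityʳ _)))

  full-⊕ : full {m} ⊕ full {k} ≗ full
  full-⊕ v with side {m} {k} v
  ... | isOld a = ⊕-old full full a
  ... | isNew i = ⊕-new {m = m} full full i

  card-m+k : card (full {m + k}) ≡ card (full {m}) + k
  card-m+k = trans (card-cong (λ v → sym (full-⊕ v))) (card-⊕full full)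

module OneVertex {m} (G : Graph (m + 1)) (T : TightOn G) where
  open Extension {m} {1} G

  x₀ : Fin (m + 1)
  x₀ = x zero

  add-x : add x₀ (base full) ≗ full
  add-x v with side {m} {1} v
  ... | isOld a = add-old x₀ (base full) (base-o full a)
  ... | isNew zero = add-new x₀ (base full)

  E-total : E G full ≡ E G (base full) + deg G x₀ full
  E-total = trans (E-cong G (λ v → sym (add-x v))) (trans (E-add G (base full) (base-x full zero)) (cong (E G (base full) +_)
    (trans (sym (deg-rem G)) (trans (deg-cong G {z = x₀} pt) (deg-rem G)))))
    where
    pt : rem x₀ (base full) ≗ rem x₀ full
    pt v with side {m} {1} v
    ... | isOld a = trans (rem-in (base full) old≢new (base-o full a)) (sym (rem-in {z = x₀} full (old≢new {m} {1}) refl))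
    ... | isNew zero = trans (rem-self x₀ _) (sym (rem-self x₀ _))

  x-nbr-old : ∀ {y} → adj G x₀ y ≡ true → Σ[ a ∈ Fin m ] y ≡ o a
  x-nbr-old {y} e with side {m} {1} y
  ... | isOld a = a , refl
  ... | isNew zero = ⊥-elim (T≢F e (adj-irr G x₀))

  sparse-base : SparseOn (pullback G o)
  sparse-base X h = subst₂ (λ e c → e + 1 ≤ 2 * c) (sym (E-base X)) (card-base X)
      (proj₁ T (base X) (≤-trans h (≤-reflexive (sym (card-base X)))))

  tight-henneberg1 : deg G x₀ full ≡ 2 → TightOn (pullback G o)
  tight-henneberg1 d = sparse-base , arith (E-base full) E-total d (proj₂ T) card-m+k
    where
    arith : ∀ {e e₁ e₂ d c c₁} → e ≡ e₁ → e₂ ≡ e₁ + d → d ≡ 2 → e₂ + 1 ≡ 2 * c₁ → c₁ ≡ c + 1 → e + 1 ≡ 2 * c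
    arith {e} {c = c} refl refl refl t refl = +-cancelʳ-≡ 2 _ _ (trans (l e) (trans t (r c)))
      where
      l : ∀ e → e + 1 + 2 ≡ e + 2 + 1
      l = solve-∀
      r : ∀ c → 2 * (c + 1) ≡ 2 * c + 2
      r = solve-∀

  two-nbrs : ∀ {p q y} → deg G x₀ full ≡ 2 → adj G x₀ p ≡ true → adj G x₀ q ≡ true → p ≢ q → adj G x₀ y ≡ true → y ≡ p ⊎ y ≡ q
  two-nbrs {p} {q} {y} d a b p≢q c with y ≟ p | y ≟ q
  ... | yes e | _ = inj₁ e
  ... | no _ | yes e = inj₂ e
  ... | no h | no k = ⊥-elim (1+n≰n (≤-trans (list≤deg G full ((h ∷ k ∷ []) ∷ ((p≢q ∷ []) ∷ ([] ∷ [])))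
      ((c , refl) ∷ (a , refl) ∷ (b , refl) ∷ [])) (≤-reflexive d)))

  reduce-henneberg1 : deg G x₀ full ≡ 2 → Derivable (pullback G o) → Derivable G
  reduce-henneberg1 d D with nbr G {x₀} {full} (≤-trans (s≤s z≤n) (≤-reflexive (sym d)))
  ... | p′ , xp , _ with nbr-≢ G {x₀} {full} p′ (≤-reflexive (sym d))
  ...   | q′ , q≢p , xq , _ with x-nbr-old xp | x-nbr-old xq
  ...     | p , refl | q , refl = henneberg1 D ((λ a b → refl) , p , q , (λ e → q≢p (cong o (sym e))) ,
      λ a → bool-ext (λ e → [ (λ t → ∨-inj₁ (≡⇒=ᵛ (↑ˡ-inj t))) , (λ t → ∨-inj₂ {a =ᵛ p} (≡⇒=ᵛ (↑ˡ-inj t))) ]′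
          (two-nbrs d xp xq (λ e → q≢p (sym e)) e))
                     (λ e → [ (λ t → subst (λ b → adj G x₀ (o b) ≡ true) (sym (=ᵛ⇒≡ t)) xp) ,
                         (λ t → subst (λ b → adj G x₀ (o b) ≡ true) (sym (=ᵛ⇒≡ t)) xq) ]′ (∨-split {a =ᵛ p} e)))

  -- The new edge `uv` raises the edge count by one precisely on the sets that contain both its
  -- ends; `free` says that none of these sets is tight before.
  module _ {u v w : Fin m} (u≢v : u ≢ v) (w≢u : w ≢ u) (w≢v : w ≢ v) (xu : adj G x₀ (o u) ≡ true) (xv : adj G x₀ (o v) ≡ true)
    (xw : adj G x₀ (o w) ≡ true) (d : deg G x₀ full ≡ 3) (uv : adj G (o u) (o v) ≡ false)
    (free : ∀ X → X (o u) ≡ true → X (o v) ≡ true → X x₀ ≡ false → E G X + 2 ≤ 2 * card X) where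

    private
      is : Fin m → Fin m → Bool
      is a b = ((a == u) ∧ (b == v)) ∨ ((a == v) ∧ (b == u))

      is-sym : ∀ a b → is a b ≡ is b a
      is-sym a b = trans (∨-comm _ ((a == v) ∧ (b == u))) (cong₂ _∨_ (∧-comm (a == v) (b == u)) (∧-comm (a == u) (b == v)))

      is-inv : ∀ {a b} → is a b ≡ true → (a ≡ u × b ≡ v) ⊎ (a ≡ v × b ≡ u)
      is-inv {a} {b} e with ∨-split {(a == u) ∧ (b == v)} e
      ... | inj₁ t = let (p , q) = ∧-split {a == u} t in inj₁ (==⇒≡ p , ==⇒≡ q)
      ... | inj₂ t = let (p , q) = ∧-split {a == v} t in inj₂ (==⇒≡ p , ==⇒≡ q)

      is-≢ : ∀ {a b} → a ≢ u → b ≢ u → is a b ≡ false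
      is-≢ h k = ≢true λ e → [ (λ p → h (proj₁ p)) , (λ p → k (proj₂ p)) ]′ (is-inv e)

    joined : Graph m
    joined = record { adj = λ a b → adj G (o a) (o b) ∨ is a b ; adj-sym = λ a b → cong₂ _∨_ (adj-sym G _ _) (is-sym a b)
                    ; adj-irr = λ a → trans (cong₂ _∨_ (adj-irr G (o a))
                        (≢true λ e → [ (λ p → u≢v (trans (sym (proj₁ p)) (proj₂ p))) , (λ p → u≢v (trans (sym (proj₂ p)) (proj₁ p)))
                        ]′ (is-inv {a} {a} e))) refl }

    private
      agree : ∀ X → X u ≡ false → E joined X ≡ E (pullback G o) X
      agree X e = E-agree {G = joined} {pullback G o} X λ {a} {b} p q →
        trans (cong (adj G (o a) (o b) ∨_) (is-≢ {a} {b} (λ { refl → T≢F p e }) (λ { refl → T≢F q e }))) (∨-identityʳ _)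

      is-u : ∀ {j} → j ≢ v → (adj G (o u) (o j) ∨ is u j) ≡ adj G (o u) (o j)
      is-u {j} j≢v = trans (cong (adj G (o u) (o j) ∨_)
          (≢true λ e → [ (λ p → j≢v (proj₂ p)) , (λ p → u≢v (proj₁ p)) ]′ (is-inv {u} {j} e))) (∨-identityʳ _)

      deg-u : ∀ Y → Y u ≡ false → deg joined u Y ≡ deg (pullback G o) u Y + b2n (Y v)
      deg-u Y Yu with Y v in Yv
      ... | false = trans (trans (deg-def joined u Y) (trans (card-cong pt) (sym (deg-def (pullback G o) u Y))))
          (sym (+-identityʳ _))
        where
        pt : ∀ j → ((adj G (o u) (o j) ∨ is u j) ∧ Y j) ≡ (adj G (o u) (o j) ∧ Y j)
        pt j = go (j ≟ v)
          where
          go : Dec (j ≡ v) → ((adj G (o u) (o j) ∨ is u j) ∧ Y j) ≡ (adj G (o u) (o j) ∧ Y j)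
          go (yes refl) rewrite Yv = trans (∧-zeroʳ _) (sym (∧-zeroʳ _))
          go (no j≢v) = cong (_∧ Y j) (is-u j≢v)
      ... | true = trans (deg-rem-nbr joined Y (∨-inj₂ {adj G (o u) (o v)} (∨-inj₁ (cong₂ _∧_ (==-refl u) (==-refl v)))) Yv)
                    (trans (cong suc (trans (deg-def joined u _) (trans (card-cong pt) (sym (deg-def (pullback G o) u Y)))))
                        (+-comm 1 _))
        where
        pt : ∀ j → ((adj G (o u) (o j) ∨ is u j) ∧ rem v Y j) ≡ (adj G (o u) (o j) ∧ Y j)
        pt j = go (j ≟ v)
          where
          go : Dec (j ≡ v) → ((adj G (o u) (o j) ∨ is u j) ∧ rem v Y j) ≡ (adj G (o u) (o j) ∧ Y j)
          go (yes refl) rewrite uv = trans (cong (is u j ∧_) (rem-self j Y)) (∧-zeroʳ _)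
          go (no j≢v) = cong₂ _∧_ (is-u j≢v) (rem-≢ Y j≢v)

    E-joined : ∀ X → E joined X ≡ E G (base X) + b2n (X u ∧ X v)
    E-joined X with dichotomy (X u)
    ... | inj₂ e = trans (agree X e) (trans (E-base X) (trans (sym (+-identityʳ _))
        (cong (λ b → E G (base X) + b2n (b ∧ X v)) (sym e))))
    ... | inj₁ e = begin
        E joined X                                                  ≡⟨ E-rem joined X e ⟩
        E joined Y + deg joined u Y                                 ≡⟨ cong₂ _+_ (agree Y (rem-self u X)) (deg-u Y (rem-self u X)) ⟩
        E (pullback G o) Y + (deg (pullback G o) u Y + b2n (Y v))   ≡⟨ sym (+-assoc (E (pullback G o) Y) _ _) ⟩
        E (pullback G o) Y + deg (pullback G o) u Y + b2n (Y v)     ≡⟨ cong (_+ b2n (Y v)) (sym (E-rem (pullback G o) X e)) ⟩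
        E (pullback G o) X + b2n (Y v)                              ≡⟨ cong₂ _+_ (E-base X)
            (cong b2n (trans (rem-≢ X (λ q → u≢v (sym q))) (cong (_∧ X v) (sym e)))) ⟩
        E G (base X) + b2n (X u ∧ X v)                              ∎
      where
      open ≡-Reasoning
      Y = rem u X

    tight-henneberg2 : TightOn joined
    tight-henneberg2 = sp , arith (E-joined full) E-total d (proj₂ T) card-m+k
      where
      arith : ∀ {e e₁ e₂ d c c₁} → e ≡ e₁ + 1 → e₂ ≡ e₁ + d → d ≡ 3 → e₂ + 1 ≡ 2 * c₁ → c₁ ≡ c + 1 → e + 1 ≡ 2 * c
      arith {e₁ = e} {c = c} refl refl refl t refl = +-cancelʳ-≡ 2 _ _ (trans (l e) (trans t (r c)))
        where
        l : ∀ e → e + 1 + 1 + 2 ≡ e + 3 + 1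
        l = solve-∀
        r : ∀ c → 2 * (c + 1) ≡ 2 * c + 2
        r = solve-∀
      sp : SparseOn joined
      sp X h with dichotomy (X u ∧ X v)
      ... | inj₂ e = subst (λ t → t + 1 ≤ 2 * card X) (trans (E-base X)
          (sym (trans (E-joined X) (trans (cong (λ b → E G (base X) + b2n b) e) (+-identityʳ _))))) (sparse-base X h)
      ... | inj₁ e = let (p , q) = ∧-split {X u} e in
          subst₂ (λ t c → t ≤ 2 * c) (sym (trans (cong (_+ 1) (trans (E-joined X) (cong (λ b → E G (base X) + b2n b) e)))
              (+-assoc _ 1 1))) (card-base X)
            (free (base X) (trans (base-o X u) p) (trans (base-o X v) q) (base-x X zero))

    reduce-henneberg2 : Derivable joined → Derivable G
    reduce-henneberg2 D = henneberg2 D (u , v , w , ∨-inj₂ {adj G (o u) (o v)} (∨-inj₁ (cong₂ _∧_ (==-refl u) (==-refl v))) , w≢u ,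
        w≢v , oo , xo)
      where
      is′ : Fin m → Fin m → Bool
      is′ a b = ((a =ᵛ u) ∧ (b =ᵛ v)) ∨ ((a =ᵛ v) ∧ (b =ᵛ u))
      ==ᵛ : ∀ {n} (a b : Fin n) → (a =ᵛ b) ≡ (a == b)
      ==ᵛ a b = bool-ext (λ e → ≡⇒== (=ᵛ⇒≡ {i = a} {b} e)) (λ e → ≡⇒=ᵛ (==⇒≡ {i = a} {b} e))
      is≡ : ∀ a b → is′ a b ≡ is a b
      is≡ a b = cong₂ _∨_ (cong₂ _∧_ (==ᵛ a u) (==ᵛ b v)) (cong₂ _∧_ (==ᵛ a v) (==ᵛ b u))
      oo : ∀ a b → adj G (o a) (o b) ≡ ((adj G (o a) (o b) ∨ is a b) ∧ not (is′ a b))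
      oo a b with dichotomy (is a b)
      ... | inj₂ e rewrite is≡ a b | e = lem _
        where
        lem : ∀ p → p ≡ (p ∨ false) ∧ true
        lem true = refl
        lem false = refl
      ... | inj₁ e rewrite is≡ a b | e = trans (non-adj (is-inv {a} {b} e)) (sym (∧-zeroʳ _))
        where
        non-adj : (a ≡ u × b ≡ v) ⊎ (a ≡ v × b ≡ u) → adj G (o a) (o b) ≡ false
        non-adj (inj₁ (refl , refl)) = uv
        non-adj (inj₂ (refl , refl)) = trans (adj-sym G _ _) uv
      xo : ∀ a → adj G x₀ (o a) ≡ ((a =ᵛ u) ∨ (a =ᵛ v) ∨ (a =ᵛ w))
      xo a = bool-ext to from
        where
        to : adj G x₀ (o a) ≡ true → _
        to e with a ≟ u | a ≟ v | a ≟ w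
        ... | yes p | _ | _ = ∨-inj₁ (≡⇒=ᵛ p)
        ... | no _ | yes p | _ = ∨-inj₂ {a =ᵛ u} (∨-inj₁ (≡⇒=ᵛ p))
        ... | no _ | no _ | yes p = ∨-inj₂ {a =ᵛ u} (∨-inj₂ {a =ᵛ v} (≡⇒=ᵛ p))
        ... | no p | no q | no r = ⊥-elim (1+n≰n (≤-trans (list≤deg G full
                (((p ∘ ↑ˡ-inj) ∷ (q ∘ ↑ˡ-inj) ∷ (r ∘ ↑ˡ-inj) ∷ []) ∷
                    (((u≢v ∘ ↑ˡ-inj) ∷ ((λ e → w≢u (sym (↑ˡ-inj e))) ∷ [])) ∷ ((((λ e → w≢v (sym (↑ˡ-inj e))) ∷ []) ∷ ([] ∷ [])))))
                ((e , refl) ∷ (xu , refl) ∷ (xv , refl) ∷ (xw , refl) ∷ [])) (≤-reflexive d)))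
        from : ((a =ᵛ u) ∨ (a =ᵛ v) ∨ (a =ᵛ w)) ≡ true → adj G x₀ (o a) ≡ true
        from e with ∨-split {a =ᵛ u} e
        ... | inj₁ p = subst (λ b → adj G x₀ (o b) ≡ true) (sym (=ᵛ⇒≡ p)) xu
        ... | inj₂ p with ∨-split {a =ᵛ v} p
        ...   | inj₁ q = subst (λ b → adj G x₀ (o b) ≡ true) (sym (=ᵛ⇒≡ q)) xv
        ...   | inj₂ q = subst (λ b → adj G x₀ (o b) ≡ true) (sym (=ᵛ⇒≡ q)) xw

card-singleton : ∀ {n} (u : Fin n) (Y : VSet n) → card (λ j → (j == u) ∧ Y j) ≡ b2n (Y u)
card-singleton {n} u Y with dichotomy (Y u)
... | inj₂ e = trans (card-empty (λ j → ≢true λ t → let (p , q) = ∧-split {j == u} t in T≢F (subst (λ i → Y i ≡ true) (==⇒≡ {i = j} {u} p) q) e)) (cong b2n (sym e))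
... | inj₁ e = trans (card-cong pt) (trans (card-add {z = u} ∅ refl) (trans (cong suc (card-∅ n)) (cong b2n (sym e))))
  where
  pt : (λ j → (j == u) ∧ Y j) ≗ add u ∅
  pt j = go (j ≟ u)
    where
    go : Dec (j ≡ u) → ((j == u) ∧ Y j) ≡ add u ∅ j
    go (yes refl) = trans (cong₂ _∧_ (==-refl j) e) (sym (add-new j ∅))
    go (no h) = trans (cong (_∧ Y j) (==-≢ h)) (sym (add-out ∅ h refl))

card-disjoint : ∀ {n} (P Q : VSet n) → (∀ i → P i ≡ true → Q i ≡ true → ⊥) → card (P ∪ Q) ≡ card P + card Q
card-disjoint P Q h = trans (sym (+-identityʳ _)) (trans (cong (card (P ∪ Q) +_) (sym (card-empty {X = P ∩ Q}
  (λ i → ≢true λ t → let (p , q) = ∧-split {P i} t in h i p q)))) (card-∪-∩ P Q))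

-- The cluster of `v` and the last `k` vertices shrinks to `v`. The new neighbourhood is a
-- parameter, so that contractions of an edge and of a K4 share the counting.
module Contract {m k} (G : Graph (m + k)) (T : TightOn G) (v : Fin m) (nb : VSet m) where
  open Extension {m} {k} G public

  contracted : Graph m
  contracted = record { adj = ad ; adj-sym = sy ; adj-irr = ir }
    where
    ad : Fin m → Fin m → Bool
    ad a b = if a == v then not (b == v) ∧ nb b else if b == v then nb a else adj G (o a) (o b)
    sy : ∀ a b → ad a b ≡ ad b a
    sy a b with a ≟ v | b ≟ v
    ... | yes _ | yes _ = refl
    ... | yes _ | no _ = refl
    ... | no _ | yes _ = refl
    ... | no _ | no _ = adj-sym G _ _
    ir : ∀ a → ad a a ≡ false
    ir a with a ≟ v
    ... | yes _ = refl
    ... | no _ = adj-irr G _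

  adj-off : ∀ {a b} → a ≢ v → b ≢ v → adj contracted a b ≡ adj G (o a) (o b)
  adj-off h k rewrite ==-≢ h | ==-≢ k = refl

  adj-v : ∀ {b} → b ≢ v → adj contracted v b ≡ nb b
  adj-v h rewrite ==-refl v | ==-≢ h = refl

  adj-to-v : ∀ {a} → a ≢ v → adj contracted a v ≡ nb a
  adj-to-v h = trans (adj-sym contracted _ v) (adj-v h)

  E-off : ∀ X → X v ≡ false → E contracted X ≡ E G (base X)
  E-off X e = trans (E-agree {G = contracted} {pullback G o} X (λ p q → adj-off (λ { refl → T≢F p e }) (λ { refl → T≢F q e })))
      (E-base X)

  E-on : ∀ X → X v ≡ true → E contracted X ≡ E G (base (rem v X)) + card (λ j → nb j ∧ rem v X j)
  E-on X e = trans (E-rem contracted X e) (cong₂ _+_ (E-off (rem v X) (rem-self v X))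
      (trans (deg-def contracted v _) (card-cong pt)))
    where
    pt : ∀ j → (adj contracted v j ∧ rem v X j) ≡ (nb j ∧ rem v X j)
    pt j = go (j ≟ v)
      where
      go : Dec (j ≡ v) → (adj contracted v j ∧ rem v X j) ≡ (nb j ∧ rem v X j)
      go (yes refl) = trans (cong (adj contracted j j ∧_) (rem-self j X))
          (trans (∧-zeroʳ _) (sym (trans (cong (nb j ∧_) (rem-self j X)) (∧-zeroʳ _))))
      go (no h) = cong (_∧ rem v X j) (adj-v h)

  sparse-off : ∀ X → X v ≡ false → 1 ≤ card X → E contracted X + 1 ≤ 2 * card X
  sparse-off X e h = subst₂ (λ t c → t + 1 ≤ 2 * c) (sym (E-off X e)) (card-base X)
      (proj₁ T (base X) (≤-trans h (≤-reflexive (sym (card-base X)))))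

  base-rem-v : ∀ X → base (rem v X) (o v) ≡ false
  base-rem-v X = trans (base-o (rem v X) v) (rem-self v X)

module ContractEdge {m} (G : Graph (m + 1)) (T : TightOn G) (u v : Fin m) (u≢v : u ≢ v)
  (vx : adj G (v ↑ˡ 1) (m ↑ʳ zero) ≡ true) (uv : adj G (u ↑ˡ 1) (v ↑ˡ 1) ≡ true) (ux : adj G (u ↑ˡ 1) (m ↑ʳ zero) ≡ true)
  (common : ∀ {j} → adj G (v ↑ˡ 1) (j ↑ˡ 1) ≡ true → adj G (m ↑ʳ zero) (j ↑ˡ 1) ≡ true → j ≡ u)
  (free : ∀ X → X (v ↑ˡ 1) ≡ true → X (m ↑ʳ zero) ≡ true → X (u ↑ˡ 1) ≡ false → E G X + 2 ≤ 2 * card X) where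

  private
    p q : VSet m
    p j = adj G (v ↑ˡ 1) (j ↑ˡ 1)
    q j = adj G (m ↑ʳ zero) (j ↑ˡ 1)

  open Contract G T v (p ∪ q)

  private
    x₀ : Fin (m + 1)
    x₀ = m ↑ʳ zero

    -- The edge `vx` is lost, and the two edges from `u` merge into one if `u` lies in `X`. One
    -- vertex less is worth two edges, so sets with `u` keep their `f` while sets without `u` lose
    -- one unit; `free` compensates for the latter.
    E-split : ∀ X → X v ≡ true → E G (X ⊕ full) ≡ E contracted X + b2n (X u) + 1
    E-split X Xv = begin
        E G (X ⊕ full)                                                       ≡⟨ E-cong G (λ i → sym (grow i)) ⟩
        E G (add x₀ S)                                                       ≡⟨ E-add G S
            (add-out _ (λ e → old≢new (sym e)) (base-x Y zero)) ⟩
        E G S + deg G x₀ S                                                   ≡⟨ cong₂ _+_ (E-add G (base Y) (base-rem-v X))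
            (deg-add G (base Y) (base-rem-v X)) ⟩
        E G (base Y) + deg G (o v) (base Y) + (deg G x₀ (base Y) + b2n (adj G x₀ (o v)))
          ≡⟨ cong₂ _+_ (cong (E G (base Y) +_) (deg-base (o v) Y)) (cong₂ _+_ (deg-base x₀ Y) (cong b2n (adj-swap G vx))) ⟩
        E G (base Y) + card P + (card Q + 1)                                 ≡⟨ l (E G (base Y)) (card P) (card Q) ⟩
        E G (base Y) + (card P + card Q) + 1                                 ≡⟨ cong (λ t → E G (base Y) + t + 1)
            (sym (card-∪-∩ P Q)) ⟩
        E G (base Y) + (card (P ∪ Q) + card (P ∩ Q)) + 1
          ≡⟨ cong₂ (λ s t → E G (base Y) + (s + t) + 1) (card-cong (λ j → sym (∧-distribʳ-∨ (Y j) (p j) (q j))))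
              (trans (card-cong both) (trans (card-singleton u Y) (cong b2n (rem-≢ X u≢v)))) ⟩
        E G (base Y) + (card (λ j → (p j ∨ q j) ∧ Y j) + b2n (X u)) + 1      ≡⟨ cong (_+ 1) (sym (+-assoc (E G (base Y)) _ _)) ⟩
        E G (base Y) + card (λ j → (p j ∨ q j) ∧ Y j) + b2n (X u) + 1        ≡⟨ cong (λ t → t + b2n (X u) + 1) (sym (E-on X Xv)) ⟩
        E contracted X + b2n (X u) + 1 ∎
      where
      open ≡-Reasoning
      Y = rem v X
      S = add (o v) (base Y)
      P Q : VSet m
      P j = p j ∧ Y j
      Q j = q j ∧ Y j
      l : ∀ e a b → e + a + (b + 1) ≡ e + (a + b) + 1
      l = solve-∀
      both : ∀ j → ((p j ∧ Y j) ∧ (q j ∧ Y j)) ≡ ((j == u) ∧ Y j)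
      both j = bool-ext (λ t → let (a , b) = ∧-split {p j ∧ Y j} t ; (a₁ , y) = ∧-split {p j} a ; (b₁ , _) = ∧-split {q j} b in cong₂ _∧_ (≡⇒== (common a₁ b₁)) y)
        (λ t → let (a , y) = ∧-split {j == u} t in cong₂ _∧_ (cong₂ _∧_ (subst (λ i → p i ≡ true) (sym (==⇒≡ a)) (adj-swap G uv)) y) (cong₂ _∧_ (subst (λ i → q i ≡ true) (sym (==⇒≡ a)) (adj-swap G ux)) y))
      grow : add x₀ S ≗ X ⊕ full
      grow i with side {m} {1} i
      ... | isNew zero = trans (add-new x₀ S) (sym (⊕-new {m = m} X full zero))
      ... | isOld a = trans (add-≢ S old≢new) (trans (go (a ≟ v)) (sym (⊕-old X full a)))
        where
        go : Dec (a ≡ v) → S (o a) ≡ X a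
        go (yes refl) = trans (add-new (o a) (base Y)) (sym Xv)
        go (no h) = trans (add-≢ (base Y) (λ e → h (↑ˡ-inj e))) (trans (base-o Y a) (rem-≢ X h))

  tight-contractEdge : TightOn contracted
  tight-contractEdge = sp , arith (E-split full refl) (E-cong G full-⊕) (proj₂ T) card-m+k
    where
    arith : ∀ {e e₁ e₂ c c₁} → e₁ ≡ e + 1 + 1 → e₁ ≡ e₂ → e₂ + 1 ≡ 2 * c₁ → c₁ ≡ c + 1 → e + 1 ≡ 2 * c
    arith {e} {c = c} refl refl t refl = +-cancelʳ-≡ 2 _ _ (trans (l e) (trans t (r c)))
      where
      l : ∀ e → e + 1 + 2 ≡ e + 1 + 1 + 1
      l = solve-∀
      r : ∀ c → 2 * (c + 1) ≡ 2 * c + 2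
      r = solve-∀
    ar₁ : ∀ {e e₁ c c₁} → e₁ ≡ e + 1 + 1 → e₁ + 1 ≤ 2 * c₁ → c₁ ≡ c + 1 → e + 1 ≤ 2 * c
    ar₁ {e} {c = c} refl h refl = lin≤ 0 h (l e c)
      where
      l : ∀ e c → e + 1 + 2 * (c + 1) + 0 ≡ 2 * c + (e + 1 + 1 + 1)
      l = solve-∀
    ar₂ : ∀ {e e₁ c c₁} → e₁ ≡ e + 0 + 1 → e₁ + 2 ≤ 2 * c₁ → c₁ ≡ c + 1 → e + 1 ≤ 2 * c
    ar₂ {e} {c = c} refl h refl = lin≤ 0 h (l e c)
      where
      l : ∀ e c → e + 1 + 2 * (c + 1) + 0 ≡ 2 * c + (e + 0 + 1 + 2)
      l = solve-∀
    sp : SparseOn contracted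
    sp X h with dichotomy (X v) | dichotomy (X u)
    ... | inj₂ e | _ = sparse-off X e h
    ... | inj₁ e | inj₁ t = ar₁ (trans (E-split X e) (cong (λ b → E contracted X + b2n b + 1) t))
            (proj₁ T (X ⊕ full) (card-∈ {i = o v} (trans (⊕-old X full v) e))) (card-⊕full X)
    ... | inj₁ e | inj₂ t = ar₂ (trans (E-split X e) (cong (λ b → E contracted X + b2n b + 1) t))
            (free (X ⊕ full) (trans (⊕-old X full v) e) (⊕-new {m = m} X full zero) (trans (⊕-old X full u) t)) (card-⊕full X)

  reduce-edgeToK3 : Derivable contracted → Derivable G
  reduce-edgeToK3 D = edgeToK3 D (u , v , trans (adj-to-v u≢v) (∨-inj₁ (adj-swap G uv)) , (λ a b h k → sym (adj-off h k)) , vx , uv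
      , ux , sums)
    where
    sums : ∀ a → a ≢ v → a ≢ u → b2n (adj G (o a) (o v)) + b2n (adj G (o a) x₀) ≡ b2n (adj contracted a v)
    sums a h k rewrite adj-to-v h | adj-sym G (o a) (o v) | adj-sym G (o a) x₀ with adj G (o v) (o a) in e₁ | adj G x₀ (o a) in e₂
    ... | true | true = ⊥-elim (k (common e₁ e₂))
    ... | true | false = refl
    ... | false | true = refl
    ... | false | false = refl

module ContractK4 {m} (G : Graph (m + 3)) (T : TightOn G) (v : Fin m)
  (vx : ∀ i → adj G (v ↑ˡ 3) (m ↑ʳ i) ≡ true) (xx : ∀ i j → i ≢ j → adj G (m ↑ʳ i) (m ↑ʳ j) ≡ true)
  (clean-v : ∀ {j i} → adj G (v ↑ˡ 3) (j ↑ˡ 3) ≡ true → adj G (m ↑ʳ i) (j ↑ˡ 3) ≡ true → j ≢ v → ⊥)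
  (clean-x : ∀ {j i i′} → i ≢ i′ → adj G (m ↑ʳ i) (j ↑ˡ 3) ≡ true → adj G (m ↑ʳ i′) (j ↑ˡ 3) ≡ true → j ≢ v → ⊥) where

  private
    x′ : Fin 3 → Fin (m + 3)
    x′ i = m ↑ʳ i
    p : VSet m
    p j = adj G (v ↑ˡ 3) (j ↑ˡ 3)
    q : Fin 3 → VSet m
    q i j = adj G (x′ i) (j ↑ˡ 3)

  open Contract G T v (p ∪ (q 0F ∪ (q 1F ∪ q 2F)))

  private
    -- Three vertices and six edges disappear, so `f` does not change and no tight set can obstruct
    -- the contraction. Cleanness keeps the neighbourhoods of the four vertices disjoint, so that no
    -- edges merge.
    E-split : ∀ X → X v ≡ true → E G (X ⊕ full) ≡ E contracted X + 6
    E-split X Xv = begin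
        E G (X ⊕ full)                                  ≡⟨ E-cong G (λ i → sym (grow i)) ⟩
        E G S₄                                          ≡⟨ E-add G S₃ (S₃-x 2F (λ ()) (λ ())) ⟩
        E G S₃ + deg G (x 2F) S₃                        ≡⟨ cong (_+ deg G (x 2F) S₃) (E-add G S₂ (S₂-x 1F (λ ()))) ⟩
        E G S₂ + deg G (x 1F) S₂ + deg G (x 2F) S₃      ≡⟨ cong (λ t → t + deg G (x 1F) S₂ + deg G (x 2F) S₃) (E-add G S₁ (S₁-x 0F))
            ⟩
        E G S₁ + deg G (x 0F) S₁ + deg G (x 1F) S₂ + deg G (x 2F) S₃
          ≡⟨ cong₂ _+_ (cong₂ _+_ (cong₂ _+_ (trans (E-add G (base Y) (base-rem-v X)) (cong (E G (base Y) +_) (deg-base (o v) Y)))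
              d₀) d₁) d₂ ⟩
        E G (base Y) + card P + (card (Q 0F) + 1) + (card (Q 1F) + 1 + 1) + (card (Q 2F) + 1 + 1 + 1)
          ≡⟨ l (E G (base Y)) (card P) (card (Q 0F)) (card (Q 1F)) (card (Q 2F)) ⟩
        E G (base Y) + (card P + (card (Q 0F) + (card (Q 1F) + card (Q 2F)))) + 6
          ≡⟨ cong (λ t → E G (base Y) + t + 6) (sym union) ⟩
        E G (base Y) + card (λ j → (p ∪ (q 0F ∪ (q 1F ∪ q 2F))) j ∧ Y j) + 6      ≡⟨ cong (_+ 6) (sym (E-on X Xv)) ⟩
        E contracted X + 6 ∎
      where
      open ≡-Reasoning
      Y = rem v X
      S₁ = add (o v) (base Y)
      S₂ = add (x 0F) S₁
      S₃ = add (x 1F) S₂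
      S₄ = add (x 2F) S₃
      P : VSet m
      P j = p j ∧ Y j
      Q : Fin 3 → VSet m
      Q i j = q i j ∧ Y j
      l : ∀ e a b c d → e + a + (b + 1) + (c + 1 + 1) + (d + 1 + 1 + 1) ≡ e + (a + (b + (c + d))) + 6
      l = solve-∀
      S₁-x : ∀ i → S₁ (x i) ≡ false
      S₁-x i = add-out (base Y) (λ e → old≢new (sym e)) (base-x Y i)
      S₂-x : ∀ i → i ≢ 0F → S₂ (x i) ≡ false
      S₂-x i h = add-out S₁ (λ t → h (↑ʳ-inj {m} t)) (S₁-x i)
      S₃-x : ∀ i → i ≢ 0F → i ≢ 1F → S₃ (x i) ≡ false
      S₃-x i h h′ = add-out S₂ (λ t → h′ (↑ʳ-inj {m} t)) (S₂-x i h)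
      one : ∀ {a b} → adj G a b ≡ true → b2n (adj G a b) ≡ 1
      one e = cong b2n e
      d₀ : deg G (x 0F) S₁ ≡ card (Q 0F) + 1
      d₀ = trans (deg-add G (base Y) (base-rem-v X)) (cong₂ _+_ (deg-base (x 0F) Y) (one (adj-swap G (vx 0F))))
      d₁ : deg G (x 1F) S₂ ≡ card (Q 1F) + 1 + 1
      d₁ = trans (deg-add G S₁ (S₁-x 0F)) (cong₂ _+_ (trans (deg-add G (base Y) (base-rem-v X))
          (cong₂ _+_ (deg-base (x 1F) Y) (one (adj-swap G (vx 1F))))) (one (xx 1F 0F (λ ()))))
      d₂ : deg G (x 2F) S₃ ≡ card (Q 2F) + 1 + 1 + 1
      d₂ = trans (deg-add G S₂ (S₂-x 1F (λ ()))) (cong₂ _+_ (trans (deg-add G S₁ (S₁-x 0F))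
             (cong₂ _+_ (trans (deg-add G (base Y) (base-rem-v X)) (cong₂ _+_ (deg-base (x 2F) Y) (one (adj-swap G (vx 2F)))))
                 (one (xx 2F 0F (λ ()))))) (one (xx 2F 1F (λ ()))))
      Y≢v : ∀ {j} → Y j ≡ true → j ≢ v
      Y≢v e = proj₁ (rem-inv {X = X} e)
      distr : ∀ a b c d y → ((a ∧ y) ∨ ((b ∧ y) ∨ ((c ∧ y) ∨ (d ∧ y)))) ≡ ((a ∨ (b ∨ (c ∨ d))) ∧ y)
      distr a b c d y = sym (trans (∧-distribʳ-∨ y a _)
          (cong ((a ∧ y) ∨_) (trans (∧-distribʳ-∨ y b _) (cong ((b ∧ y) ∨_) (∧-distribʳ-∨ y c d)))))
      clash : ∀ i i′ → i ≢ i′ → ∀ j → Q i j ≡ true → Q i′ j ≡ true → ⊥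
      clash i i′ h j s t = let (a , y) = ∧-split {q i j} s ; (b , _) = ∧-split {q i′ j} t in clean-x h a b (Y≢v y)
      clash-v : ∀ i j → P j ≡ true → Q i j ≡ true → ⊥
      clash-v i j s t = let (a , y) = ∧-split {p j} s ; (b , _) = ∧-split {q i j} t in clean-v a b (Y≢v y)
      union : card (λ j → (p ∪ (q 0F ∪ (q 1F ∪ q 2F))) j ∧ Y j) ≡ card P + (card (Q 0F) + (card (Q 1F) + card (Q 2F)))
      union = trans (card-cong (λ j → sym (distr (p j) (q 0F j) (q 1F j) (q 2F j) (Y j))))
        (trans (card-disjoint P _ (λ j s t → [ clash-v 0F j s , (λ t → [ clash-v 1F j s , clash-v 2F j s ]′ (∨-split {Q 1F j} t)) ]′
            (∨-split {Q 0F j} t)))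
        (cong (card P +_) (trans (card-disjoint (Q 0F) _
            (λ j s t → [ clash 0F 1F (λ ()) j s , clash 0F 2F (λ ()) j s ]′ (∨-split {Q 1F j} t)))
        (cong (card (Q 0F) +_) (card-disjoint (Q 1F) (Q 2F) (clash 1F 2F (λ ())))))))
      grow : S₄ ≗ X ⊕ full
      grow i with side {m} {3} i
      ... | isNew 0F = trans (add-old (x 2F) S₃ (add-old (x 1F) S₂ (add-new (x 0F) S₁))) (sym (⊕-new {m = m} X full 0F))
      ... | isNew 1F = trans (add-old (x 2F) S₃ (add-new (x 1F) S₂)) (sym (⊕-new {m = m} X full 1F))
      ... | isNew 2F = trans (add-new (x 2F) S₃) (sym (⊕-new {m = m} X full 2F))
      ... | isOld a = trans (add-≢ S₃ old≢new) (trans (add-≢ S₂ old≢new)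
          (trans (add-≢ S₁ old≢new) (trans (go (a ≟ v)) (sym (⊕-old X full a)))))
        where
        go : Dec (a ≡ v) → S₁ (o a) ≡ X a
        go (yes refl) = trans (add-new (o a) (base Y)) (sym Xv)
        go (no h) = trans (add-≢ (base Y) (λ e → h (↑ˡ-inj e))) (trans (base-o Y a) (rem-≢ X h))

  tight-contractK4 : TightOn contracted
  tight-contractK4 = sp , arith (E-split full refl) (E-cong G full-⊕) (proj₂ T) card-m+k
    where
    arith : ∀ {e e₁ e₂ c c₁} → e₁ ≡ e + 6 → e₁ ≡ e₂ → e₂ + 1 ≡ 2 * c₁ → c₁ ≡ c + 3 → e + 1 ≡ 2 * c
    arith {e} {c = c} refl refl t refl = +-cancelʳ-≡ 6 _ _ (trans (l e) (trans t (r c)))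
      where
      l : ∀ e → e + 1 + 6 ≡ e + 6 + 1
      l = solve-∀
      r : ∀ c → 2 * (c + 3) ≡ 2 * c + 6
      r = solve-∀
    ar₁ : ∀ {e e₁ c c₁} → e₁ ≡ e + 6 → e₁ + 1 ≤ 2 * c₁ → c₁ ≡ c + 3 → e + 1 ≤ 2 * c
    ar₁ {e} {c = c} refl h refl = lin≤ 0 h (l e c)
      where
      l : ∀ e c → e + 1 + 2 * (c + 3) + 0 ≡ 2 * c + (e + 6 + 1)
      l = solve-∀
    sp : SparseOn contracted
    sp X h with dichotomy (X v)
    ... | inj₂ e = sparse-off X e h
    ... | inj₁ e = ar₁ (E-split X e) (proj₁ T (X ⊕ full) (card-∈ {i = o v} (trans (⊕-old X full v) e))) (card-⊕full X)

  reduce-vertexToK4 : Derivable contracted → Derivable G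
  reduce-vertexToK4 D = vertexToK4 D (v , (λ a b h k → sym (adj-off h k)) , vx , xx , sums)
    where
    sums : ∀ a → a ≢ v → b2n (adj G (o a) (o v)) + b2n (adj G (o a) (x 0F)) + b2n (adj G (o a) (x 1F)) + b2n (adj G (o a) (x 2F)) ≡
        b2n (adj contracted a v)
    sums a h rewrite adj-to-v h | adj-sym G (o a) (o v) | adj-sym G (o a) (x 0F) | adj-sym G (o a) (x 1F) | adj-sym G (o a) (x 2F)
      with adj G (o v) (o a) in e | adj G (x 0F) (o a) in e₀ | adj G (x 1F) (o a) in e₁ | adj G (x 2F) (o a) in e₂
    ... | true | true | _ | _ = ⊥-elim (clean-v e e₀ h)
    ... | true | false | true | _ = ⊥-elim (clean-v e e₁ h)
    ... | true | false | false | true = ⊥-elim (clean-v e e₂ h)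
    ... | true | false | false | false = refl
    ... | false | true | true | _ = ⊥-elim (clean-x (λ ()) e₀ e₁ h)
    ... | false | true | false | true = ⊥-elim (clean-x (λ ()) e₀ e₂ h)
    ... | false | true | false | false = refl
    ... | false | false | true | true = ⊥-elim (clean-x (λ ()) e₁ e₂ h)
    ... | false | false | true | false = refl
    ... | false | false | false | true = refl
    ... | false | false | false | false = refl

opaque
  unfolding vol

  vol-mono : ∀ {n} (G : Graph n) {X X′ Y} → X ⊆ X′ → vol G X Y ≤ vol G X′ Y
  vol-mono G {X} {X′} {Y} h = ∑-mono λ i → pt (X i) (X′ i) (h i)
    where
    pt : ∀ {k} a b → (a ≡ true → b ≡ true) → (if a then k else 0) ≤ (if b then k else 0)
    pt false b f = z≤n
    pt true b f rewrite f refl = ≤-refl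

  vol-deg : ∀ {n} (G : Graph n) {X Y i} → X i ≡ true → deg G i Y ≤ vol G X Y
  vol-deg G {X} {Y} {i} e = ≤-trans (≤-reflexive (cong (λ b → if b then deg G i Y else 0) (sym e)))
      (∑-≥ (λ i → if X i then deg G i Y else 0) i)

E-cut : ∀ {n} (G : Graph n) (A : VSet n) → E G full ≡ E G A + E G (∁ A) + vol G A (∁ A)
E-cut G A = arith {f = E G A} {E G (∁ A)} (trans (sym (handshake G full))
    (trans (vol-partˡ G full A full) (cong₂ _+_ (vol-partʳ G A full A) (vol-partʳ G (∁ A) full A))))
                (handshake G A) (vol-sym G (∁ A) A) (handshake G (∁ A))
  where
  arith : ∀ {e a b c d f f′ : ℕ} → e + e ≡ (a + c) + (d + b) → a ≡ f + f → d ≡ c → b ≡ f′ + f′ → e ≡ f + f′ + c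
  arith {e} {c = c} {f = f} {f′} h refl refl refl = *-cancelˡ-≡ e (f + f′ + c) 2 (trans (l e) (trans h (r f f′ c)))
    where
    l : ∀ e → 2 * e ≡ e + e
    l = solve-∀
    r : ∀ f f′ c → f + f + c + (c + (f′ + f′)) ≡ 2 * (f + f′ + c)
    r = solve-∀

card-∁ : ∀ {n} (A : VSet n) → card (full {n}) ≡ card A + card (∁ A)
card-∁ A = card-part full A

Smaller : ℕ → Set
Smaller n = ∀ {m} (H : Graph m) → m < n → TightOn H → Derivable H

module _ {n} {G : Graph n} (T : TightOn G) (A : VSet n) (tA : E G A + 1 ≡ 2 * card A) (tB : E G (∁ A) + 1 ≡ 2 * card (∁ A)) where

  -- Adding up, `2n - 1` edges are `2n - 2` edges inside the two sides and those across.
  cut≡1 : vol G A (∁ A) ≡ 1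
  cut≡1 = arith {k₁ = card A} {card (∁ A)} (E-cut G A) (proj₂ T) (card-∁ A) tA tB
    where
    arith : ∀ {e a b c k k₁ k₂} → e ≡ a + b + c → e + 1 ≡ 2 * k → k ≡ k₁ + k₂ → a + 1 ≡ 2 * k₁ → b + 1 ≡ 2 * k₂ → c ≡ 1
    arith {a = a} {b} {c} {k₁ = k₁} {k₂} refl t refl ta tb = +-cancelˡ-≡ (a + b + 1) c 1
        (trans (l a b c) (trans t (trans (r k₁ k₂) (trans (cong₂ _+_ (sym ta) (sym tb)) (s a b)))))
      where
      l : ∀ a b c → a + b + 1 + c ≡ a + b + c + 1
      l = solve-∀
      r : ∀ k₁ k₂ → 2 * (k₁ + k₂) ≡ 2 * k₁ + 2 * k₂
      r = solve-∀
      s : ∀ a b → a + 1 + (b + 1) ≡ a + b + 1 + 1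
      s = solve-∀

  private
    crossing : Σ[ u ∈ Fin n ] A u ≡ true × 1 ≤ deg G u (∁ A)
    crossing with pick (λ u → A u ∧ does (1 ≤? deg G u (∁ A)))
    ... | inj₂ (u , e) = let (a , d) = ∧-split {A u} e in u , a , does-true (1 ≤? deg G u (∁ A)) d
    ... | inj₁ none = ⊥-elim (1+n≰n (≤-trans (≤-reflexive (sym cut≡1))
        (≤-trans (vol≤ G A (∁ A) 0 low) (≤-reflexive (*-zeroʳ (card A))))))
      where
      low : ∀ i → A i ≡ true → deg G i (∁ A) ≤ 0
      low i a = ≤-pred (≰⇒> (does-false (1 ≤? deg G i (∁ A)) (trans (cong (_∧ does (1 ≤? deg G i (∁ A))) (sym a)) (none i))))

    unique-crossing : ∀ {u v a b} → A u ≡ true → A a ≡ true → ∁ A v ≡ true → ∁ A b ≡ true → adj G u v ≡ true → adj G a b ≡ true → a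
        ≡ u × b ≡ v
    unique-crossing {u} {v} {a} {b} Au Aa Bv Bb uv ab with a ≟ u | b ≟ v
    ... | yes p | yes q = p , q
    ... | yes refl | no q = ⊥-elim (1+n≰n (≤-trans (list≤deg G (∁ A) ((q ∷ []) ∷ ([] ∷ [])) ((ab , Bb) ∷ (uv , Bv) ∷ []))
                              (≤-trans (vol-deg G {A} Au) (≤-reflexive cut≡1))))
    ... | no p | _ = ⊥-elim (1+n≰n (≤-trans (≤-trans (≤-reflexive (sym two)) (vol≥ G X (∁ A) 1 hi))
        (≤-trans (vol-mono G {X} {A} sub) (≤-reflexive cut≡1))))
      where
      X = add a (add u ∅)
      two : card X * 1 ≡ 2
      two = trans (*-identityʳ _) (trans (card-add (add u ∅) (add-out ∅ p refl))
          (cong suc (trans (card-add {z = u} ∅ refl) (cong suc (card-∅ n)))))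
      cases : ∀ {i} → X i ≡ true → i ≡ a ⊎ i ≡ u
      cases e with add-inv {X = add u ∅} e
      ... | inj₁ q = inj₁ q
      ... | inj₂ e′ with add-inv {X = ∅} e′
      ...   | inj₁ q = inj₂ q
      hi : ∀ i → X i ≡ true → 1 ≤ deg G i (∁ A)
      hi i e with cases e
      ... | inj₁ refl = list≤deg G (∁ A) ([] ∷ []) ((ab , Bb) ∷ [])
      ... | inj₂ refl = list≤deg G (∁ A) ([] ∷ []) ((uv , Bv) ∷ [])
      sub : X ⊆ A
      sub i e with cases e
      ... | inj₁ refl = Aa
      ... | inj₂ refl = Au

  derive-edgeJoin : Smaller n → Derivable G
  derive-edgeJoin IH = iso {G = pullback G glue} (edgeJoin {n = m} {k} {K} {H} {G″} (IH K m<n tK) (IH H k<n tH) join) (relabel G)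
    where
    eA = enumerate A
    eB = enumerate (∁ A)
    m = Enum.size eA
    k = Enum.size eB
    φ = Enum.at eA
    ψ = Enum.at eB
    S : Split φ ψ
    S = record { φ-inj = Enum.at-inj eA ; ψ-inj = Enum.at-inj eB
               ; apart = λ {i} {j} e → T≢F (subst (λ v → A v ≡ true) e (Enum.at-∈ eA i)) (not-true (Enum.at-∈ eB j))
               ; cover = λ v → [ (λ e → inj₁ (Enum.at-onto eA v e)) , (λ e → inj₂ (Enum.at-onto eB v (cong not e))) ]′
                   (dichotomy (A v)) }
    open Split S
    G″ = pullback G glue
    T″ : TightOn G″
    T″ = tightOn-iso G″ G (relabel G) T
    open Extension {m} {k} G″
    K = pullback G″ o
    H = pullback G″ x
    Ao : ∀ a → A (glue (o a)) ≡ true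
    Ao a = trans (cong A (glue-old a)) (Enum.at-∈ eA a)
    Bx : ∀ i → ∁ A (glue (x i)) ≡ true
    Bx i = trans (cong (∁ A) (glue-new i)) (Enum.at-∈ eB i)
    A≗ : A ∘ glue ≗ base full
    A≗ w with side {m} {k} w
    ... | isOld a = trans (Ao a) (sym (base-o full a))
    ... | isNew i = trans (not-true (Bx i)) (sym (base-x full i))
    B≗ : ∁ A ∘ glue ≗ (∅ {m} ⊕ full {k})
    B≗ w with side {m} {k} w
    ... | isOld a = trans (cong not (Ao a)) (sym (⊕-old ∅ full a))
    ... | isNew i = trans (Bx i) (sym (⊕-new {m = m} ∅ full i))
    card-x : ∀ Y → card (∅ {m} ⊕ Y) ≡ card Y
    card-x Y = trans (card-↑ {m} {k} (∅ ⊕ Y)) (cong₂ _+_ (card-empty {X = λ a → (∅ ⊕ Y) (o a)} (⊕-old ∅ Y))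
        (card-cong (⊕-new {m = m} ∅ Y)))
    E-x : ∀ Y → E H Y ≡ E G″ (∅ ⊕ Y)
    E-x Y = sym (trans (E-new G″ (∅ ⊕ Y) (⊕-old ∅ Y)) (E-cong _ (⊕-new {m = m} ∅ Y)))
    tK : TightOn K
    tK = (λ X h → subst₂ (λ e c → e + 1 ≤ 2 * c) (sym (E-base X)) (card-base X)
        (proj₁ T″ (base X) (≤-trans h (≤-reflexive (sym (card-base X))))))
       , subst₂ (λ e c → e + 1 ≡ 2 * c) (trans (iso-E G″ G (relabel G) A) (trans (E-cong G″ A≗) (sym (E-base full))))
           (trans (iso-card G″ G (relabel G) A) (trans (card-cong A≗) (card-base full))) tA
    tH : TightOn H
    tH = (λ X h → subst₂ (λ e c → e + 1 ≤ 2 * c) (sym (E-x X)) (card-x X)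
        (proj₁ T″ (∅ ⊕ X) (≤-trans h (≤-reflexive (sym (card-x X))))))
       , subst₂ (λ e c → e + 1 ≡ 2 * c) (trans (iso-E G″ G (relabel G) (∁ A)) (trans (E-cong G″ B≗) (sym (E-x full))))
           (trans (iso-card G″ G (relabel G) (∁ A)) (trans (card-cong B≗) (card-x full))) tB
    u₀ = proj₁ crossing
    Au₀ = proj₁ (proj₂ crossing)
    v₀ = nbr G {u₀} {∁ A} (proj₂ (proj₂ crossing))
    u′ = Enum.at-onto eA u₀ Au₀
    v′ = Enum.at-onto eB (proj₁ v₀) (proj₂ (proj₂ v₀))
    join : EdgeJoin K H G″
    join = proj₁ u′ , proj₁ v′ , (λ a b → refl) , (λ i j → refl) , λ a j → bool-ext
      (λ e → let (p , q) = unique-crossing Au₀ (Ao a) (proj₂ (proj₂ v₀)) (Bx j) (proj₁ (proj₂ v₀)) e in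
        cong₂ _∧_ (≡⇒=ᵛ (φ-inj (trans (sym (glue-old a)) (trans p (sym (proj₂ u′))))))
            (≡⇒=ᵛ (ψ-inj (trans (sym (glue-new j)) (trans q (sym (proj₂ v′)))))))
      (λ e → let (p , q) = ∧-split {a =ᵛ proj₁ u′} e in subst₂ (λ s t → adj G s t ≡ true)
        (sym (trans (glue-old a) (trans (cong φ (=ᵛ⇒≡ {i = a} {proj₁ u′} p)) (proj₂ u′))))
            (sym (trans (glue-new j) (trans (cong ψ (=ᵛ⇒≡ {i = j} {proj₁ v′} q)) (proj₂ v′)))) (proj₁ (proj₂ v₀)))
    pos : ∀ {t} → Fin t → 1 ≤ t
    pos {suc t} _ = s≤s z≤n
    m<n : m < n
    m<n = ≤-trans (≤-reflexive (+-comm 1 m)) (≤-trans (+-monoʳ-≤ m (pos (proj₁ v′))) (≤-reflexive size))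
    k<n : k < n
    k<n = ≤-trans (+-monoˡ-≤ k (pos (proj₁ u′))) (≤-reflexive size)

-- The vertices to be removed, listed by `ψ`, are brought to the last positions, where the moves
-- create them. At least one is removed, which makes `m` smaller than `n`.
module Pullback {n k} {G : Graph n} (T : TightOn G) (ψ : Fin (suc k) → Fin n) (inj : Inj ψ) where

  private
    e = proj₁ (split-right ψ inj)
  m = Enum.size e
  φ = Enum.at e
  S : Split φ ψ
  S = proj₂ (split-right ψ inj)
  open Split S public

  G″ : Graph (m + suc k)
  G″ = pullback G glue

  T″ : TightOn G″
  T″ = tightOn-iso G″ G (relabel G) T

  m<n : m < n
  m<n = ≤-trans (≤-trans (s≤s (m≤m+n m k)) (≤-reflexive (sym (+-suc m k)))) (≤-reflexive size)

  old-of : ∀ {u} → (∀ i → u ≢ ψ i) → Σ[ a ∈ Fin m ] glue (a ↑ˡ suc k) ≡ u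
  old-of {u} h with cover u
  ... | inj₁ (a , q) = a , trans (glue-old a) q
  ... | inj₂ (i , q) = ⊥-elim (h i (sym q))

  unglue-glue : ∀ w → unglue (glue w) ≡ w
  unglue-glue w = glue-inj (glue-unglue (glue w))

  finish : Derivable G″ → Derivable G
  finish D = iso D (relabel G)

  transport-set : (X : VSet (m + suc k)) → (E G (X ∘ unglue) + 2 ≤ 2 * card (X ∘ unglue)) → E G″ X + 2 ≤ 2 * card X
  transport-set X h = subst₂ (λ e c → e + 2 ≤ 2 * c) (sym (iso-E G G″ (iso-sym G″ G (relabel G)) X))
      (sym (iso-card G G″ (iso-sym G″ G (relabel G)) X)) h

  at-glue : ∀ (X : VSet (m + suc k)) w {b} → X w ≡ b → X (unglue (glue w)) ≡ b
  at-glue X w h = trans (cong X (unglue-glue w)) h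

module InverseMoves {n} {G : Graph n} (T : TightOn G) (IH : Smaller n) where

  one-inj : ∀ (v : Fin n) → Inj {1} (λ _ → v)
  one-inj v {zero} {zero} _ = refl

  derive-henneberg1 : ∀ v → deg G v full ≡ 2 → Derivable G
  derive-henneberg1 v d = finish (OneVertex.reduce-henneberg1 G″ T″ d″ (IH _ m<n (OneVertex.tight-henneberg1 G″ T″ d″)))
    where
    open Pullback T (λ _ → v) (one-inj v)
    d″ : deg G″ (m ↑ʳ zero) full ≡ 2
    d″ = trans (sym (iso-deg G″ G (relabel G) (m ↑ʳ zero) full)) (trans (cong (λ w → deg G w full) (glue-new zero)) d)

  derive-henneberg2 : ∀ x u v w → u ≢ v → w ≢ u → w ≢ v → adj G x u ≡ true → adj G x v ≡ true → adj G x w ≡ true → deg G x full ≡ 3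
      →
    adj G u v ≡ false → (∀ X → X u ≡ true → X v ≡ true → X x ≡ false → E G X + 2 ≤ 2 * card X) → Derivable G
  derive-henneberg2 x u v w u≢v w≢u w≢v xu xv xw d uv free
    with Pullback.old-of T (λ _ → x) (one-inj x) {u} (λ _ p → adj-≢ G xu (sym p)) | Pullback.old-of T (λ _ → x) (one-inj x) {v}
        (λ _ p → adj-≢ G xv (sym p)) | Pullback.old-of T (λ _ → x) (one-inj x) {w} (λ _ p → adj-≢ G xw (sym p))
  ... | a , refl | b , refl | c , refl = finish (reduce-henneberg2 h₁ h₂ h₃ xu″ xv″ xw″ d″ uv free″
      (IH _ m<n (tight-henneberg2 h₁ h₂ h₃ xu″ xv″ xw″ d″ uv free″)))
    where
    open Pullback T (λ _ → x) (one-inj x)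
    x₁ : Fin (m + 1)
    x₁ = m ↑ʳ zero
    to : ∀ {y} → adj G x y ≡ true → adj G (glue x₁) y ≡ true
    to h = trans (cong (λ t → adj G t _) (glue-new zero)) h
    xu″ = to xu
    xv″ = to xv
    xw″ = to xw
    d″ : deg G″ x₁ full ≡ 3
    d″ = trans (sym (iso-deg G″ G (relabel G) x₁ full)) (trans (cong (λ w → deg G w full) (glue-new zero)) d)
    free″ : ∀ X → X (a ↑ˡ 1) ≡ true → X (b ↑ˡ 1) ≡ true → X x₁ ≡ false → E G″ X + 2 ≤ 2 * card X
    free″ X p q r = transport-set X (free (X ∘ unglue) (at-glue X (a ↑ˡ 1) p) (at-glue X (b ↑ˡ 1) q)
      (trans (cong (X ∘ unglue) (sym (glue-new zero))) (at-glue X x₁ r)))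
    open OneVertex G″ T″
    glue-≢ : ∀ {s t} → glue (s ↑ˡ 1) ≢ glue (t ↑ˡ 1) → s ≢ t
    glue-≢ h e = h (cong (λ t → glue (t ↑ˡ 1)) e)
    h₁ = glue-≢ u≢v
    h₂ = glue-≢ w≢u
    h₃ = glue-≢ w≢v

  derive-edgeToK3 : ∀ u v x → adj G v x ≡ true → adj G u v ≡ true → adj G u x ≡ true →
      (∀ {j} → adj G v j ≡ true → adj G x j ≡ true → j ≡ u) →
    (∀ X → X v ≡ true → X x ≡ true → X u ≡ false → E G X + 2 ≤ 2 * card X) → Derivable G
  derive-edgeToK3 u v x vx uv ux common free
    with Pullback.old-of T (λ _ → x) (one-inj x) {u} (λ _ → adj-≢ G ux) | Pullback.old-of T (λ _ → x) (one-inj x) {v}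
        (λ _ → adj-≢ G vx)
  ... | a , refl | b , refl = finish (reduce-edgeToK3 (IH _ m<n tight-contractEdge))
    where
    open Pullback T (λ _ → x) (one-inj x)
    x₁ : Fin (m + 1)
    x₁ = m ↑ʳ zero
    to : ∀ {y} → adj G y x ≡ true → adj G y (glue x₁) ≡ true
    to h = trans (cong (adj G _) (glue-new zero)) h
    from : ∀ {y} → adj G (glue x₁) y ≡ true → adj G x y ≡ true
    from h = trans (cong (λ t → adj G t _) (sym (glue-new zero))) h
    open ContractEdge G″ T″ a b (λ e → adj-≢ G uv (cong (λ t → glue (t ↑ˡ 1)) e)) (to vx) uv (to ux)
      (λ p q → ↑ˡ-inj (glue-inj (common p (from q))))
      (λ X p q r → transport-set X (free (X ∘ unglue) (at-glue X (b ↑ˡ 1) p)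
          (trans (cong (X ∘ unglue) (sym (glue-new zero))) (at-glue X x₁ q)) (at-glue X (a ↑ˡ 1) r)))

  derive-vertexToK4 : (F : Fin 4 → Fin n) → (∀ i j → i ≢ j → adj G (F i) (F j) ≡ true) →
    (∀ {w i j} → i ≢ j → (∀ l → w ≢ F l) → adj G (F i) w ≡ true → adj G (F j) w ≡ true → ⊥) → Derivable G
  derive-vertexToK4 F FF clean = go (old-of {F 0F} (λ i → adj-≢ G (FF 0F (suc i) (λ ()))))
    where
    F-inj : Inj F
    F-inj {i} {j} e with i ≟ j
    ... | yes p = p
    ... | no h = ⊥-elim (adj-≢ G (FF i j h) e)
    -- `F 0F` stays and becomes the vertex to which the K4 is contracted.
    open Pullback T (F ∘ suc) (λ e → Fin-suc-injective (F-inj e))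
    go : Σ[ v ∈ Fin m ] glue (v ↑ˡ 3) ≡ F 0F → Derivable G
    go (v , ev) = finish (reduce-vertexToK4 (IH _ m<n tight-contractK4))
      where
      at : Fin 4 → Fin (m + 3)
      at zero = v ↑ˡ 3
      at (suc i) = m ↑ʳ i
      at-F : ∀ i → glue (at i) ≡ F i
      at-F zero = ev
      at-F (suc i) = glue-new i
      pairs : ∀ i j → i ≢ j → adj G″ (at i) (at j) ≡ true
      pairs i j h = trans (cong₂ (adj G) (at-F i) (at-F j)) (FF i j h)
      clean″ : ∀ {w i j} → i ≢ j → adj G″ (at i) (w ↑ˡ 3) ≡ true → adj G″ (at j) (w ↑ˡ 3) ≡ true → w ≢ v → ⊥
      clean″ {w} {i} {j} h p q w≢v = clean h off (trans (cong (λ t → adj G t _) (sym (at-F i))) p)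
          (trans (cong (λ t → adj G t _) (sym (at-F j))) q)
        where
        off : ∀ l → glue (w ↑ˡ 3) ≢ F l
        off zero e = w≢v (↑ˡ-inj (glue-inj (trans e (sym ev))))
        off (suc l) e = old≢new (glue-inj (trans e (sym (glue-new l))))
      suc-≢ : ∀ {i j : Fin 3} → i ≢ j → suc i ≢ suc j
      suc-≢ h e = h (Fin-suc-injective e)
      open ContractK4 G″ T″ v (λ i → pairs 0F (suc i) (λ ())) (λ i j h → pairs (suc i) (suc j) (suc-≢ h))
        (λ {j} {i} p q h → clean″ {i = 0F} {suc i} (λ ()) p q h)
            (λ {j} {i} {i′} h p q k → clean″ {i = suc i} {suc i′} (suc-≢ h) p q k)

-- Tight graphs are reducible

module Freedom {n} {G : Graph n} (sp : SparseOn G) where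

  E≤ : ∀ X → E G X ≤ 2 * card X
  E≤ X with card X in e
  ... | zero = ≤-reflexive (E-empty G (card≡0 {X = X} e))
  ... | suc k = subst (λ c → E G X ≤ 2 * c) e (≤-trans (m≤m+n _ 1) (sp X (≤-trans (s≤s z≤n) (≤-reflexive (sym e)))))

  opaque
    -- By `E≤` the truncated subtraction is exact, on the empty set too.
    f : VSet n → ℕ
    f X = 2 * card X ∸ E G X

    f-E : ∀ X → f X + E G X ≡ 2 * card X
    f-E X = m∸n+n≡m (E≤ X)

    f-cong : ∀ {X Y} → X ≗ Y → f X ≡ f Y
    f-cong h = cong₂ (λ c e → 2 * c ∸ e) (card-cong h) (E-cong G h)

  f-pos : ∀ {X i} → X i ≡ true → 1 ≤ f X
  f-pos {X} h = +-cancelʳ-≤ (E G X) 1 (f X) (≤-trans (≤-reflexive (+-comm 1 _))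
      (≤-trans (sp X (card-∈ {X = X} h)) (≤-reflexive (sym (f-E X)))))

  f-sub : ∀ X Y → f (X ∪ Y) + f (X ∩ Y) ≤ f X + f Y
  f-sub X Y = arith {f X} {f Y} {f (X ∪ Y)} {f (X ∩ Y)} {E G X} {E G Y} {E G (X ∪ Y)} {E G (X ∩ Y)} {card X} {card Y} {card (X ∪ Y)}
      {card (X ∩ Y)} (f-E X) (f-E Y) (f-E (X ∪ Y)) (f-E (X ∩ Y)) (E-sub G X Y) (card-∪-∩ X Y)
    where
    arith : ∀ {a b c d e₁ e₂ e₃ e₄ k₁ k₂ k₃ k₄} → a + e₁ ≡ 2 * k₁ → b + e₂ ≡ 2 * k₂ → c + e₃ ≡ 2 * k₃ → d + e₄ ≡ 2 * k₄ →
            e₁ + e₂ ≤ e₃ + e₄ → k₃ + k₄ ≡ k₁ + k₂ → c + d ≤ a + b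
    arith {a} {b} {c} {d} {e₁} {e₂} {e₃} {e₄} {k₁} {k₂} {k₃} {k₄} p q r s h k = lin≤ 0 h
      (trans (l c d e₃ e₄) (trans (cong₂ _+_ r s) (trans (sym (*-distribˡ-+ 2 k₃ k₄))
          (trans (cong (2 *_) k) (trans (*-distribˡ-+ 2 k₁ k₂) (trans (cong₂ _+_ (sym p) (sym q)) (l′ a b e₁ e₂)))))))
      where
      l : ∀ c d e₃ e₄ → c + d + (e₃ + e₄) + 0 ≡ c + e₃ + (d + e₄)
      l = solve-∀
      l′ : ∀ a b e₁ e₂ → a + e₁ + (b + e₂) ≡ a + b + (e₁ + e₂)
      l′ = solve-∀

  f-add : ∀ {z} X → X z ≡ false → f (add z X) + deg G z X ≡ f X + 2
  f-add {z} X h = arith (f-E (add z X)) (f-E X) (E-add G X h) (card-add X h)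
    where
    arith : ∀ {a b d e e₁ k k₁} → a + e₁ ≡ 2 * k₁ → b + e ≡ 2 * k → e₁ ≡ e + d → k₁ ≡ suc k → a + d ≡ b + 2
    arith {a} {b} {d} {e} {k = k} p q refl refl = +-cancelʳ-≡ e _ _
        (trans (l a d e) (trans p (trans (l′ k) (trans (cong (_+ 2) (sym q)) (l″ b e)))))
      where
      l : ∀ a d e → a + d + e ≡ a + (e + d)
      l = solve-∀
      l′ : ∀ k → 2 * (1 + k) ≡ 2 * k + 2
      l′ = solve-∀
      l″ : ∀ b e → b + e + 2 ≡ b + 2 + e
      l″ = solve-∀

  f-rem : ∀ {z} X → X z ≡ true → f X + deg G z (rem z X) ≡ f (rem z X) + 2
  f-rem {z} X h = trans (cong (_+ deg G z (rem z X)) (f-cong (λ i → sym (add-rem {z = z} X h i)))) (f-add (rem z X) (rem-self z X))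

  f-add≤ : ∀ {z} X j → X z ≡ false → j ≤ deg G z X → f (add z X) + j ≤ f X + 2
  f-add≤ {z} X j h p = ≤-trans (+-monoʳ-≤ (f (add z X)) p) (≤-reflexive (f-add X h))

  f-empty : ∀ {X} → (∀ i → X i ≡ false) → f X ≡ 0
  f-empty {X} h = m+n≡0⇒m≡0 _ (trans (f-E X) (cong (2 *_) (card-empty {X = X} h)))

  -- A set of `c` vertices spans at most `c (c - 1) / 2` edges, which is at most `2 (c - 1)` as long
  -- as `c ≤ 4`. So nonempty tight sets have five vertices or more.
  f-small : ∀ X → 1 ≤ card X → card X ≤ 4 → 2 ≤ f X
  f-small X h₁ h₄ with card X in e
  f-small X () h₄ | zero
  ... | suc k = arith (trans (f-E X) (cong (2 *_) e)) (≤-trans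
      (≤-trans (≤-reflexive (sym (handshake G X))) (≤-trans (vol≤ G X X k low) (≤-reflexive (cong (_* k) e)))) (*-monoˡ-≤ k h₄))
    where
    low : ∀ i → X i ≡ true → deg G i X ≤ k
    low i p = ≤-trans (≤-reflexive (trans (sym (deg-rem G)) (deg-def G i (rem i X))))
      (≤-trans (card-mono {X = λ j → adj G i j ∧ rem i X j} {rem i X} (λ j q → proj₂ (∧-split {adj G i j} q)))
          (≤-reflexive (suc-injective (trans (sym (card-rem X p)) e))))
    arith : ∀ {a b} → a + b ≡ 2 * suc k → b + b ≤ 4 * k → 2 ≤ a
    arith {a} {b} p q = lin≤ 0 (*-cancelˡ-≤ {b} {2 * k} 2 (≤-trans (≤-reflexive (l₀ b)) (≤-trans q (≤-reflexive (l₁ k)))))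
        (trans (l₂ k) (sym p))
      where
      l₀ : ∀ b → 2 * b ≡ b + b
      l₀ = solve-∀
      l₁ : ∀ k → 4 * k ≡ 2 * (2 * k)
      l₁ = solve-∀
      l₂ : ∀ k → 2 + 2 * k + 0 ≡ 2 * (1 + k)
      l₂ = solve-∀

  tight : ∀ {X} → f X ≡ 1 → E G X + 1 ≡ 2 * card X
  tight {X} h = trans (+-comm (E G X) 1) (trans (cong (_+ E G X) (sym h)) (f-E X))

  slack : ∀ {X} → 2 ≤ f X → E G X + 2 ≤ 2 * card X
  slack {X} h = ≤-trans (≤-reflexive (+-comm (E G X) 2)) (≤-trans (+-monoˡ-≤ (E G X) h) (≤-reflexive (f-E X)))

  f≡1 : ∀ {X i} → X i ≡ true → f X ≤ 1 → f X ≡ 1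
  f≡1 h p = ≤-antisym p (f-pos h)

-- Rigid sets, chains of triangles and atoms

module Structure {n} (G : Graph n) (T : TightOn G) (IH : Smaller n) where

  open Freedom (proj₁ T)
  open InverseMoves T IH

  f-full : f full ≡ 1
  f-full = +-cancelʳ-≡ (E G full) _ _ (trans (f-E full) (trans (sym (proj₂ T)) (+-comm (E G full) 1)))

  _~_ : Fin n → Fin n → Set
  i ~ j = adj G i j ≡ true

  ~-sym : ∀ {i j} → i ~ j → j ~ i
  ~-sym = adj-swap G

  ~-≢ : ∀ {i j} → i ~ j → i ≢ j
  ~-≢ = adj-≢ G

  two≤ : ∀ {z a b X} → a ≢ b → z ~ a → z ~ b → X a ≡ true → X b ≡ true → 2 ≤ deg G z X
  two≤ {X = X} h p q s t = list≤deg G X ((h ∷ []) ∷ ([] ∷ [])) ((p , s) ∷ (q , t) ∷ [])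

  three≤ : ∀ {z a b c X} → a ≢ b → a ≢ c → b ≢ c → z ~ a → z ~ b → z ~ c → X a ≡ true → X b ≡ true → X c ≡ true → 3 ≤ deg G z X
  three≤ {X = X} h₁ h₂ h₃ p q r s t u = list≤deg G X ((h₁ ∷ h₂ ∷ []) ∷ ((h₃ ∷ []) ∷ ([] ∷ []))) ((p , s) ∷ (q , t) ∷ (r , u) ∷ [])

  four≤ : ∀ {z a b c d X} → a ≢ b → a ≢ c → a ≢ d → b ≢ c → b ≢ d → c ≢ d → z ~ a → z ~ b → z ~ c → z ~ d →
          X a ≡ true → X b ≡ true → X c ≡ true → X d ≡ true → 4 ≤ deg G z X
  four≤ {X = X} h₁ h₂ h₃ h₄ h₅ h₆ p q r s t u v w =
    list≤deg G X ((h₁ ∷ h₂ ∷ h₃ ∷ []) ∷ ((h₄ ∷ h₅ ∷ []) ∷ ((h₆ ∷ []) ∷ ([] ∷ [])))) ((p , t) ∷ (q , u) ∷ (r , v) ∷ (s , w) ∷ [])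

  -- More neighbours in `X` would push `f` of the enlarged set below 1.
  deg≤ : ∀ {z X} k → X z ≡ false → f X + 1 ≤ k → deg G z X ≤ k
  deg≤ {z} {X} k h p = ≤-trans (lin≤ 0 (f-pos {add z X} (add-new z X))
      (trans (l (deg G z X)) (trans (cong (deg G z X +_) refl) (r (f (add z X)) (deg G z X) (f X) (f-add X h))))) p
    where
    l : ∀ d → d + (f (add z X)) + 0 ≡ d + f (add z X)
    l d = +-identityʳ _
    r : ∀ a d b → a + d ≡ b + 2 → d + a ≡ b + 1 + 1
    r a d b e = trans (+-comm d a) (trans e (sym (+-assoc b 1 1)))

  -- Under the last hypothesis only a second common neighbour of `z` and `p` can obstruct the
  -- contraction of `zp`, and a finite search finds it.
  contract : ∀ z p q → z ~ p → z ~ q → p ~ q → (∀ X → X z ≡ true → X p ≡ true → X q ≡ false → 2 ≤ f X) →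
             Derivable G ⊎ Σ[ x ∈ Fin n ] x ≢ q × z ~ x × p ~ x
  contract z p q zp zq pq free with pick (λ j → (adj G p j ∧ adj G z j) ∧ not (j == q))
  ... | inj₂ (j , e) = let (a , b) = ∧-split {adj G p j ∧ adj G z j} e ; (a₁ , a₂) = ∧-split {adj G p j} a
                       in inj₂ (j , ==⇒≢ (not-true b) , a₂ , a₁)
  ... | inj₁ none = inj₁ (derive-edgeToK3 q p z (~-sym zp) (~-sym pq) (~-sym zq)
          (λ {j} a b → ==⇒≡ (not-false (trans (cong (_∧ not (j == q)) (sym (cong₂ _∧_ a b))) (none j))))
          (λ X Xp Xz Xq → slack (free X Xz Xp Xq)))

  -- Used with `t = 1` for tight sets, where heredity is automatic, and with `t = 2` for a K4 and
  -- the sets grown from it.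
  record Rigid (t : ℕ) (M : VSet n) : Set where
    constructor rigid
    field
      value : f M ≡ t
      hereditary : ∀ Y {i} → Y ⊆ M → Y i ≡ true → t ≤ f Y

  rigid₁ : ∀ {M} → f M ≡ 1 → Rigid 1 M
  rigid₁ e = rigid e (λ Y _ h → f-pos h)

  -- Adding a vertex with `d` neighbours changes `f` by `2 - d`, which is not negative for subsets
  -- of `M` as `d ≤ 2`. The bound `t ≤ 2` covers the set consisting of `z` alone.
  rigid-add : ∀ {t M z} → t ≤ 2 → Rigid t M → M z ≡ false → deg G z M ≡ 2 → Rigid t (add z M)
  rigid-add {t} {M} {z} t≤2 (rigid v h) Mz d = rigid (trans (+-cancelʳ-≡ 2 _ _ (trans (cong (f (add z M) +_) (sym d)) (f-add M Mz)))
      v) her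
    where
    her : ∀ Y {i} → Y ⊆ add z M → Y i ≡ true → t ≤ f Y
    her Y {i} s Yi with dichotomy (Y z)
    ... | inj₂ Yz = h Y (λ j e → [ (λ { refl → ⊥-elim (T≢F e Yz) }) , id ]′ (add-inv {X = M} (s j e))) Yi
    ... | inj₁ Yz = go (pick Y′)
      where
      Y′ = rem z Y
      sub : Y′ ⊆ M
      sub j e = let (j≢z , y) = rem-inv {X = Y} e in [ (λ p → ⊥-elim (j≢z p)) , id ]′ (add-inv {X = M} (s j y))
      dY : deg G z Y′ ≤ 2
      dY = ≤-trans (deg-mono G sub) (≤-reflexive d)
      go : (∀ i → Y′ i ≡ false) ⊎ Σ[ i ∈ Fin n ] Y′ i ≡ true → t ≤ f Y
      go (inj₂ (j , e)) = +-cancelʳ-≤ 2 t (f Y) (≤-trans (+-monoˡ-≤ 2 (h Y′ sub e))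
          (≤-trans (≤-reflexive (sym (f-rem Y Yz))) (+-monoʳ-≤ (f Y) dY)))
      go (inj₁ none) = ≤-trans t≤2 (≤-trans (m≤n+m 2 (f Y′))
          (≤-reflexive (trans (sym (f-rem Y Yz)) (trans (cong (f Y +_) d0) (+-identityʳ _)))))
        where
        d0 : deg G z Y′ ≡ 0
        d0 = trans (deg-def G z Y′) (card-empty (λ j → trans (cong (adj G z j ∧_) (none j)) (∧-zeroʳ _)))

  -- The triangle zpq can only be blocked by a second common neighbour of z and p: a tight set containing z, p but not q
  -- would meet M in a set that is too dense.
  second-triangle : ∀ {t M z p q} → Rigid t M → M z ≡ false → deg G z M ≡ 2 → M p ≡ true → M q ≡ true → p ~ q → z ~ p → z ~ q →
         Derivable G ⊎ Σ[ x ∈ Fin n ] add z M x ≡ false × z ~ x × p ~ x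
  second-triangle {t} {M} {z} {p} {q} (rigid v h) Mz d Mp Mq pq zp zq = [ inj₁ ,
      (λ { (x , x≢q , zx , px) → inj₂ (x , out x≢q zx px , zx , px) }) ]′ (contract z p q zp zq pq free)
    where
    M′ = add z M
    fM′ : f M′ ≡ t
    fM′ = trans (+-cancelʳ-≡ 2 _ _ (trans (cong (f M′ +_) (sym d)) (f-add M Mz))) v
    out : ∀ {x} → x ≢ q → z ~ x → p ~ x → M′ x ≡ false
    out {x} x≢q zx px = add-out M (≢-sym (~-≢ zx)) (≢true λ Mx →
      1+n≰n (≤-trans (three≤ {X = M} (~-≢ pq) (~-≢ px) (≢-sym x≢q) zp zq zx Mp Mq Mx) (≤-reflexive d)))
    free : ∀ X → X z ≡ true → X p ≡ true → X q ≡ false → 2 ≤ f X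
    free X Xz Xp Xq with 2 ≤? f X
    ... | yes r = r
    ... | no r = ⊥-elim (1+n≰n (arith (f-sub X M′) (≤-pred (≰⇒> r)) (≤-reflexive fM′) (f-pos {X ∪ M′} {z} (cong (_∨ M′ z) Xz))
        (f-rem W Wz) dW (h W′ sub W′p)))
      where
      -- If `f X` were 1, submodularity would give `f W ≤ t`. But `q` is missing from `W`, so `z`
      -- has at most one neighbour in `W′` and `f W ≥ f W′ + 1 ≥ t + 1`.
      W = X ∩ M′
      Wz : W z ≡ true
      Wz = cong₂ _∧_ Xz (add-new z M)
      W′ = rem z W
      sub : W′ ⊆ M
      sub j e = let (j≢z , w) = rem-inv {X = W} e in [ (λ r → ⊥-elim (j≢z r)) , id ]′ (add-inv {X = M} (proj₂ (∧-split {X j} w)))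
      W′p : W′ p ≡ true
      W′p = rem-in W (≢-sym (~-≢ zp)) (cong₂ _∧_ Xp (add-old z M Mp))
      dW : deg G z W′ ≤ 1
      dW = ≤-trans (deg-mono G {z} {W′} {rem q M} (λ j e → rem-in M
          (λ { refl → T≢F (proj₁ (∧-split {X j} (proj₂ (rem-inv {X = W} e)))) Xq }) (sub j e)))
             (≤-reflexive (suc-injective (trans (sym (deg-rem-nbr G M zq Mq)) d)))
      arith : ∀ {a b c e g k} → a + b ≤ c + e → c ≤ 1 → e ≤ t → 1 ≤ a → b + k ≡ g + 2 → k ≤ 1 → t ≤ g → suc t ≤ t
      arith {a} {b} {c} {e} {g} {k} s c≤1 e≤t 1≤a eq k≤1 t≤g = lin≤ 0
        (+-mono-≤ s (+-mono-≤ c≤1 (+-mono-≤ e≤t (+-mono-≤ 1≤a (+-mono-≤ (≤-reflexive (sym eq)) (+-mono-≤ k≤1 t≤g))))))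
            (l t a b c e g k)
        where
        l : ∀ t a b c e g k → 1 + t + (c + e + (1 + (t + (a + (b + k + (1 + g)))))) + 0 ≡ t +
            (a + b + (c + (e + (1 + (g + 2 + (k + t))))))
        l = solve-∀

  -- Each new triangle over a tight set has to be continued by another one, which cannot go on forever.
  tight-triangle : ∀ k {M y p q} → n ≤ k + card M → f M ≡ 1 → M y ≡ false → M p ≡ true → M q ≡ true → p ~ q → y ~ p → y ~ q →
      Derivable G
  tight-triangle k {M} {y} {p} {q} fuel fM My Mp Mq pq yp yq = go k fuel
    where
    d : deg G y M ≡ 2
    d = ≤-antisym (deg≤ 2 My (≤-reflexive (cong (_+ 1) fM))) (two≤ {X = M} (~-≢ pq) yp yq Mp Mq)
    go : ∀ k → n ≤ k + card M → Derivable G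
    go zero h = ⊥-elim (1+n≰n (≤-trans (≤-reflexive (sym (card-add M My))) (≤-trans (card≤n (add y M)) h)))
    go (suc k) h with second-triangle (rigid₁ fM) My d Mp Mq pq yp yq
    ... | inj₁ D = D
    ... | inj₂ (x , out , yx , px) = tight-triangle k (≤-trans h
        (≤-reflexive (trans (sym (+-suc k (card M))) (cong (k +_) (sym (card-add M My))))))
            (Rigid.value (rigid-add (s≤s z≤n) (rigid₁ fM) My d)) out (add-new y M) (add-old y M Mp) yp (~-sym yx) (~-sym px)

  triangle-over-tight : ∀ {M y p q} → f M ≡ 1 → M y ≡ false → M p ≡ true → M q ≡ true → p ~ q → y ~ p → y ~ q → Derivable G
  triangle-over-tight {M} = tight-triangle n (m≤m+n n (card M))

  private
    tightened : ∀ {M x} → f M ≡ 2 → M x ≡ false → 3 ≤ deg G x M → f (add x M) ≡ 1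
    tightened {M} {x} e h d = f≡1 (add-new x M) (+-cancelʳ-≤ 3 _ 1 (≤-trans (f-add≤ M 3 h d) (≤-reflexive (cong (_+ 2) e))))

    two-or-more : ∀ {d} → 2 ≤ d → d ≡ 2 ⊎ 3 ≤ d
    two-or-more {suc (suc zero)} _ = inj₁ refl
    two-or-more {suc (suc (suc d))} _ = inj₂ (s≤s (s≤s (s≤s z≤n)))
    two-or-more {suc zero} (s≤s ())

  -- A triangle ywb over M survives while a chain of triangles grows away from it; the chain ends in a tight set.
  module Chain {w b y : Fin n} (wb : w ~ b) (yw : y ~ w) (yb : y ~ b) where

    -- `M` contains the edge `wb` under the reserved triangle, and `z` is the apex of the next
    -- triangle, over an edge `pq` of `M`. That `z` is not adjacent to both `w` and `b` matters when
    -- the chain runs into `y`: otherwise `y`, `z`, `w`, `b` could be a second K4, as in `K4⊔K4`.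
    grow : ∀ k {M z p q} → n ≤ k + card M → Rigid 2 M → M z ≡ false → deg G z M ≡ 2 → M p ≡ true → M q ≡ true → p ~ q → z ~ p → z ~
        q →
           M w ≡ true → M b ≡ true → add z M y ≡ false → ¬ (z ~ w × z ~ b) → Derivable G
    extend : ∀ k {M z p x} → n ≤ k + card M → Rigid 2 M → M z ≡ true → M p ≡ true → z ~ p → M x ≡ false → x ~ z → x ~ p →
             M w ≡ true → M b ≡ true → M y ≡ false → x ≢ y → (x ~ w → x ~ b → 3 ≤ deg G x M) → Derivable G
    extend k {M} {z} {p} {x} fuel R Mz Mp zp Mx xz xp Mw Mb My x≢y h with two-or-more (two≤ {x} {z} {p} {M} (~-≢ zp) xz xp Mz Mp)
    ... | inj₁ d = grow k fuel R Mx d Mz Mp zp xz xp Mw Mb (add-out M (≢-sym x≢y) My)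
        (λ { (a , c) → 1+n≰n (≤-trans (h a c) (≤-reflexive d)) })
    ... | inj₂ d = triangle-over-tight (tightened (Rigid.value R) Mx d) (add-out M (≢-sym x≢y) My) (add-old x M Mw) (add-old x M Mb)
        wb yw yb
    grow k {M} {z} {p} {q} fuel R Mz d Mp Mq pq zp zq Mw Mb y∉ nzb with second-triangle R Mz d Mp Mq pq zp zq
    ... | inj₁ D = D
    ... | inj₂ (x , x∉ , zx , px) with x ≟ y
    ...   | no x≢y = go k fuel
      where
      z≢ : ∀ {i} → M i ≡ true → z ≢ i
      z≢ m refl = T≢F m Mz
      go : ∀ k → n ≤ k + card M → Derivable G
      go zero h = ⊥-elim (1+n≰n (≤-trans (≤-reflexive (sym (card-add M Mz))) (≤-trans (card≤n (add z M)) h)))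
      go (suc k) h = extend k (≤-trans h (≤-reflexive (trans (sym (+-suc k (card M))) (cong (k +_) (sym (card-add M Mz))))))
        (rigid-add ≤-refl R Mz d) (add-new z M) (add-old z M Mp) zp x∉ (~-sym zx) (~-sym px) (add-old z M Mw) (add-old z M Mb) y∉
            x≢y
        (λ xw xb → three≤ {X = add z M} (z≢ Mw) (z≢ Mb) (~-≢ wb) (~-sym zx) xw xb (add-new z M) (add-old z M Mw) (add-old z M Mb))
    -- The chain has run into `y`, whose neighbours `z`, `w`, `b` make `add y (add z M)` tight. The
    -- other edge `zq` is tried now: a second triangle on it with an apex other than `y` stands over
    -- this tight set.
    ...   | yes refl with second-triangle R Mz d Mq Mp (~-sym pq) zq zp
    ...     | inj₁ D = D
    ...     | inj₂ (x′ , x′∉ , zx′ , qx′) = go (x′ ≟ y)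
      where
      M′ = add z M
      z≢ : ∀ {i} → M i ≡ true → z ≢ i
      z≢ m refl = T≢F m Mz
      yz = ~-sym zx
      fD : f (add y M′) ≡ 1
      fD = tightened (Rigid.value (rigid-add ≤-refl R Mz d)) y∉
             (three≤ {X = M′} (z≢ Mw) (z≢ Mb) (~-≢ wb) yz yw yb (add-new z M) (add-old z M Mw) (add-old z M Mb))
      dy : deg G y M′ ≤ 3
      dy = deg≤ 3 y∉ (≤-reflexive (cong (_+ 1) (Rigid.value (rigid-add ≤-refl R Mz d))))
      end : ∀ {i} → M i ≡ true → y ~ i → i ≡ w ⊎ i ≡ b
      end {i} Mi yi with i ≟ w | i ≟ b
      ... | yes e | _ = inj₁ e
      ... | no _ | yes e = inj₂ e
      ... | no h₁ | no h₂ = ⊥-elim (1+n≰n (≤-trans (four≤ {X = M′} (z≢ Mi) (z≢ Mw) (z≢ Mb) h₁ h₂ (~-≢ wb) yz yi yw yb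
                              (add-new z M) (add-old z M Mi) (add-old z M Mw) (add-old z M Mb)) dy))
      go : Dec (x′ ≡ y) → Derivable G
      go (no x′≢y) = triangle-over-tight fD (add-out M′ x′≢y x′∉) (add-old y M′ (add-new z M)) (add-old y M′ (add-old z M Mq)) zq
          (~-sym zx′) (~-sym qx′)
      -- Here `y` is adjacent to `p` and `q` too, but it has at most three neighbours in `M′`, so
      -- `p` and `q` must be `w` and `b` in some order.
      go (yes refl) with end Mp (~-sym px) | end Mq (~-sym qx′)
      ... | inj₁ refl | inj₁ refl = ⊥-elim (~-≢ pq refl)
      ... | inj₂ refl | inj₂ refl = ⊥-elim (~-≢ pq refl)
      ... | inj₁ refl | inj₂ refl = ⊥-elim (nzb (zp , zq))
      ... | inj₂ refl | inj₁ refl = ⊥-elim (nzb (zq , zp))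

  -- What the degree count needs to know about a copy of `K5-e` or `K4⊔K4`; `whole` covers the base
  -- cases of the derivation.
  record Atom (D : VSet n) : Set where
    field
      value : f D ≡ 1
      minimal : ∀ Y {i} → Y ⊆ D → Y i ≡ true → f Y ≡ 1 → D ⊆ Y
      whole : (∀ i → D i ≡ true) → Derivable G

  -- By submodularity two tight sets with a common vertex have a tight intersection, and minimality
  -- does the rest.
  atoms-disjoint : ∀ {D D′ i} → Atom D → Atom D′ → D i ≡ true → D′ i ≡ true → D′ ⊆ D
  atoms-disjoint {D} {D′} {i} a a′ Di D′i j e = proj₁ (∧-split {D j}
      (Atom.minimal a′ (D ∩ D′) {i} (λ j p → proj₂ (∧-split {D j} p)) (cong₂ _∧_ Di D′i) one j e))
    where
    one : f (D ∩ D′) ≡ 1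
    one = f≡1 {D ∩ D′} {i} (cong₂ _∧_ Di D′i) (+-cancelˡ-≤ 1 _ 1
        (≤-trans (+-monoˡ-≤ (f (D ∩ D′)) (f-pos {D ∪ D′} {i} (cong (_∨ D′ i) Di)))
            (≤-trans (f-sub D D′) (≤-reflexive (cong₂ _+_ (Atom.value a) (Atom.value a′))))))

  card-tight : ∀ {Y i} → Y i ≡ true → f Y ≡ 1 → 5 ≤ card Y
  card-tight {Y} h e with 5 ≤? card Y
  ... | yes p = p
  ... | no p = ⊥-elim (1+n≰n (≤-trans (f-small Y (card-∈ {X = Y} h) (≤-pred (≰⇒> p))) (≤-reflexive e)))

  base-iso : ∀ {m} (B : Graph m) (g : Fin m → Fin n) → Inj g → (∀ j → Σ[ i ∈ Fin m ] g i ≡ j) →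
      (∀ i j → adj G (g i) (g j) ≡ adj B i j) → Iso B G
  base-iso B g inj sur e = g , (λ j → proj₁ (sur j)) , (λ i → inj (proj₂ (sur (g i)))) , (λ j → proj₂ (sur j)) , e

  record Quad : Set where
    field
      {v a b c} : Fin n
      va : v ~ a
      vb : v ~ b
      vc : v ~ c
      ab : a ~ b
      ac : a ~ c
      bc : b ~ c

    K : VSet n
    K = add v (add a (add b (add c ∅)))

    Kv : K v ≡ true
    Kv = add-new v _
    Ka : K a ≡ true
    Ka = add-old v _ (add-new a _)
    Kb : K b ≡ true
    Kb = add-old v _ (add-old a _ (add-new b _))
    Kc : K c ≡ true
    Kc = add-old v _ (add-old a _ (add-old b _ (add-new c _)))

    K-cases : ∀ {i} → K i ≡ true → i ≡ v ⊎ i ≡ a ⊎ i ≡ b ⊎ i ≡ c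
    K-cases e with add-inv {X = add a (add b (add c ∅))} e
    ... | inj₁ p = inj₁ p
    ... | inj₂ e with add-inv {X = add b (add c ∅)} e
    ...   | inj₁ p = inj₂ (inj₁ p)
    ...   | inj₂ e with add-inv {X = add c ∅} e
    ...     | inj₁ p = inj₂ (inj₂ (inj₁ p))
    ...     | inj₂ e with add-inv {X = ∅} e
    ...       | inj₁ p = inj₂ (inj₂ (inj₂ p))

    private
      b∉ : add c ∅ b ≡ false
      b∉ = add-out ∅ (~-≢ bc) refl
      a∉ : add b (add c ∅) a ≡ false
      a∉ = add-out (add c ∅) (~-≢ ab) (add-out ∅ (~-≢ ac) refl)
      v∉ : add a (add b (add c ∅)) v ≡ false
      v∉ = add-out (add b (add c ∅)) (~-≢ va) (add-out (add c ∅) (~-≢ vb) (add-out ∅ (~-≢ vc) refl))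

    card-K : card K ≡ 4
    card-K = trans (card-add _ v∉) (cong suc (trans (card-add _ a∉)
        (cong suc (trans (card-add _ b∉) (cong suc (trans (card-add {z = c} ∅ refl) (cong suc (card-∅ n))))))))

    deg-K : ∀ w → deg G w K ≡ b2n (adj G w c) + b2n (adj G w b) + b2n (adj G w a) + b2n (adj G w v)
    deg-K w = trans (deg-add G _ v∉) (cong (_+ b2n (adj G w v))
        (trans (deg-add G _ a∉) (cong (_+ b2n (adj G w a)) (trans (deg-add G _ b∉) (cong (_+ b2n (adj G w b))
      (trans (deg-add G {w} {c} ∅ refl) (cong (_+ b2n (adj G w c)) (trans (deg-def G w ∅) (card-empty (λ j → ∧-zeroʳ _))))))))))

    -- A K4 has `f = 8 - 6`, and its nonempty subsets have at most four vertices, so `f-small`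
    -- applies to them.
    rigid-K : Rigid 2 K
    rigid-K = rigid (≤-antisym upper (f-small K (≤-trans (s≤s z≤n) (≤-reflexive (sym card-K))) (≤-reflexive card-K)))
      (λ Y s h → f-small Y (card-∈ {X = Y} h) (≤-trans (card-mono s) (≤-reflexive card-K)))
      where
      X₁ = add c ∅
      X₂ = add b X₁
      X₃ = add a X₂
      u₁ : f X₁ ≤ 2
      u₁ = ≤-trans (≤-trans (≤-reflexive (sym (+-identityʳ _))) (f-add≤ {c} ∅ 0 refl z≤n))
          (≤-reflexive (cong (_+ 2) (f-empty {∅} (λ _ → refl))))
      u₂ : f X₂ ≤ 3
      u₂ = +-cancelʳ-≤ 1 _ 3 (≤-trans (f-add≤ X₁ 1 b∉ (list≤deg G X₁ ([] ∷ []) ((bc , add-new c ∅) ∷ []))) (+-monoˡ-≤ 2 u₁))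
      u₃ : f X₃ ≤ 3
      u₃ = +-cancelʳ-≤ 2 _ 3 (≤-trans (f-add≤ X₂ 2 a∉ (two≤ {X = X₂} (~-≢ bc) ab ac (add-new b X₁) (add-old b X₁ (add-new c ∅))))
          (+-monoˡ-≤ 2 u₂))
      upper : f K ≤ 2
      upper = +-cancelʳ-≤ 3 _ 2 (≤-trans (f-add≤ X₃ 3 v∉
          (three≤ {X = X₃} (~-≢ ab) (~-≢ ac) (~-≢ bc) va vb vc (add-new a X₂) (add-old a X₂ (add-new b X₁))
                (add-old a X₂ (add-old b X₁ (add-new c ∅))))) (+-monoˡ-≤ 2 u₃))

    module K5 {w} (w∉ : K w ≡ false) (wa : w ~ a) (wb : w ~ b) (wc : w ~ c) (vw : adj G v w ≡ false) where

      D : VSet n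
      D = add w K

      w≢ : ∀ {i} → K i ≡ true → w ≢ i
      w≢ m refl = T≢F m w∉

      g : Fin 5 → Fin n
      g = lookup (v ∷ w ∷ a ∷ b ∷ c ∷ [])

      table : ∀ i j → adj G (g i) (g j) ≡ adj K5-e i j
      table 0F 0F = adj-irr G _
      table 0F 1F = vw
      table 0F 2F = va
      table 0F 3F = vb
      table 0F 4F = vc
      table 1F 0F = trans (adj-sym G _ _) vw
      table 1F 1F = adj-irr G _
      table 1F 2F = wa
      table 1F 3F = wb
      table 1F 4F = wc
      table 2F 0F = ~-sym va
      table 2F 1F = ~-sym wa
      table 2F 2F = adj-irr G _
      table 2F 3F = ab
      table 2F 4F = ac
      table 3F 0F = ~-sym vb
      table 3F 1F = ~-sym wb
      table 3F 2F = ~-sym ab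
      table 3F 3F = adj-irr G _
      table 3F 4F = bc
      table 4F 0F = ~-sym vc
      table 4F 1F = ~-sym wc
      table 4F 2F = ~-sym ac
      table 4F 3F = ~-sym bc
      table 4F 4F = adj-irr G _

      atom : Atom D
      atom = record
        { value = tightened (Rigid.value rigid-K) w∉ (three≤ {X = K} (~-≢ ab) (~-≢ ac) (~-≢ bc) wa wb wc Ka Kb Kc)
        -- `D` has five vertices, the least possible number for a nonempty tight set.
        ; minimal = λ Y s h e i m → trans (⊆-card-≗ {X = Y} {D} s
            (≤-trans (≤-reflexive (trans (card-add K w∉) (cong suc card-K))) (card-tight {Y} h e)) i) m
        ; whole = λ all → base-K5-e (base-iso K5-e g inj (sur all) table) }
        where
        inj : Inj g
        inj = lookup-inj ((≢-sym (w≢ Kv) ∷ ~-≢ va ∷ ~-≢ vb ∷ ~-≢ vc ∷ []) ∷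
            ((~-≢ wa ∷ ~-≢ wb ∷ ~-≢ wc ∷ []) ∷ ((~-≢ ab ∷ ~-≢ ac ∷ []) ∷ ((~-≢ bc ∷ []) ∷ ([] ∷ [])))))
        sur : (∀ i → D i ≡ true) → ∀ j → Σ[ i ∈ Fin 5 ] g i ≡ j
        sur all j with add-inv {X = K} (all j)
        ... | inj₁ p = 1F , sym p
        ... | inj₂ m with K-cases m
        ...   | inj₁ p = 0F , sym p
        ...   | inj₂ (inj₁ p) = 2F , sym p
        ...   | inj₂ (inj₂ (inj₁ p)) = 3F , sym p
        ...   | inj₂ (inj₂ (inj₂ p)) = 4F , sym p

    module K44 {w x} (w∉ : K w ≡ false) (wa : w ~ a) (wb : w ~ b) (wd : deg G w K ≡ 2) (x∉ : add w K x ≡ false) (xw : x ~ w)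
        (xa : x ~ a) (xb : x ~ b)
      (vw : adj G v w ≡ false) (cw : adj G c w ≡ false) (vx : adj G v x ≡ false) (cx : adj G c x ≡ false) where

      M D : VSet n
      M = add w K
      D = add x M

      in-K : ∀ {i} → K i ≡ true → D i ≡ true
      in-K m = add-old x M (add-old w K m)

      Dw : D w ≡ true
      Dw = add-old x M (add-new w K)

      g : Fin 6 → Fin n
      g = lookup (v ∷ c ∷ a ∷ b ∷ w ∷ x ∷ [])

      table : ∀ i j → adj G (g i) (g j) ≡ adj K4⊔K4 i j
      table 0F 0F = adj-irr G _
      table 0F 1F = vc
      table 0F 2F = va
      table 0F 3F = vb
      table 0F 4F = vw
      table 0F 5F = vx
      table 1F 0F = ~-sym vc
      table 1F 1F = adj-irr G _
      table 1F 2F = ~-sym ac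
      table 1F 3F = ~-sym bc
      table 1F 4F = cw
      table 1F 5F = cx
      table 2F 0F = ~-sym va
      table 2F 1F = ac
      table 2F 2F = adj-irr G _
      table 2F 3F = ab
      table 2F 4F = ~-sym wa
      table 2F 5F = ~-sym xa
      table 3F 0F = ~-sym vb
      table 3F 1F = bc
      table 3F 2F = ~-sym ab
      table 3F 3F = adj-irr G _
      table 3F 4F = ~-sym wb
      table 3F 5F = ~-sym xb
      table 4F 0F = trans (adj-sym G _ _) vw
      table 4F 1F = trans (adj-sym G _ _) cw
      table 4F 2F = wa
      table 4F 3F = wb
      table 4F 4F = adj-irr G _
      table 4F 5F = ~-sym xw
      table 5F 0F = trans (adj-sym G _ _) vx
      table 5F 1F = trans (adj-sym G _ _) cx
      table 5F 2F = xa
      table 5F 3F = xb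
      table 5F 4F = xw
      table 5F 5F = adj-irr G _

      D-cases : ∀ {i} → D i ≡ true → Σ[ j ∈ Fin 6 ] g j ≡ i
      D-cases e with add-inv {X = M} e
      ... | inj₁ p = 5F , sym p
      ... | inj₂ e with add-inv {X = K} e
      ...   | inj₁ p = 4F , sym p
      ...   | inj₂ m with K-cases m
      ...     | inj₁ p = 0F , sym p
      ...     | inj₂ (inj₁ p) = 2F , sym p
      ...     | inj₂ (inj₂ (inj₁ p)) = 3F , sym p
      ...     | inj₂ (inj₂ (inj₂ p)) = 1F , sym p

      high : ∀ j → 3 ≤ deg G (g j) D
      high 0F = three≤ {X = D} (~-≢ ab) (~-≢ ac) (~-≢ bc) va vb vc (in-K Ka) (in-K Kb) (in-K Kc)
      high 1F = three≤ {X = D} (~-≢ va) (~-≢ vb) (~-≢ ab) (~-sym vc) (~-sym ac) (~-sym bc) (in-K Kv) (in-K Ka) (in-K Kb)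
      high 2F = three≤ {X = D} (~-≢ vb) (~-≢ vc) (~-≢ bc) (~-sym va) ab ac (in-K Kv) (in-K Kb) (in-K Kc)
      high 3F = three≤ {X = D} (~-≢ va) (~-≢ vc) (~-≢ ac) (~-sym vb) (~-sym ab) bc (in-K Kv) (in-K Ka) (in-K Kc)
      high 4F = three≤ {X = D} (~-≢ ab) (≢-sym (~-≢ xa)) (≢-sym (~-≢ xb)) wa wb (~-sym xw) (in-K Ka) (in-K Kb) (add-new x M)
      high 5F = three≤ {X = D} (~-≢ ab) (≢-sym (~-≢ wa)) (≢-sym (~-≢ wb)) xa xb xw (in-K Ka) (in-K Kb) Dw

      fD : f D ≡ 1
      fD = tightened (Rigid.value (rigid-add ≤-refl rigid-K w∉ wd)) x∉
             (three≤ {X = M} (~-≢ wa) (~-≢ wb) (~-≢ ab) xw xa xb (add-new w K) (add-old w K Ka) (add-old w K Kb))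

      card-D : card D ≡ 6
      card-D = trans (card-add M x∉) (cong suc (trans (card-add K w∉) (cong suc card-K)))

      atom : Atom D
      atom = record { value = fD ; minimal = minimal ; whole = λ all → base-K4⊔K4
          (base-iso K4⊔K4 g inj (λ j → D-cases (all j)) table) }
        where
        x≢K : ∀ {i} → K i ≡ true → i ≢ x
        x≢K m refl = T≢F (add-old w K m) x∉
        w≢K : ∀ {i} → K i ≡ true → i ≢ w
        w≢K m refl = T≢F m w∉
        inj : Inj g
        inj = lookup-inj ((~-≢ vc ∷ ~-≢ va ∷ ~-≢ vb ∷ w≢K Kv ∷ x≢K Kv ∷ []) ∷
            ((≢-sym (~-≢ ac) ∷ ≢-sym (~-≢ bc) ∷ w≢K Kc ∷ x≢K Kc ∷ []) ∷
          ((~-≢ ab ∷ w≢K Ka ∷ x≢K Ka ∷ []) ∷ ((w≢K Kb ∷ x≢K Kb ∷ []) ∷ ((≢-sym (~-≢ xw) ∷ []) ∷ ([] ∷ []))))))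
        minimal : ∀ Y {i} → Y ⊆ D → Y i ≡ true → f Y ≡ 1 → D ⊆ Y
        minimal Y s h e i Di with dichotomy (Y i)
        ... | inj₁ Yi = Yi
        -- A tight proper subset has at least five of the six vertices, so it arises by deleting
        -- `i`. Both sets being tight, `i` would have exactly two neighbours in `D`, but every
        -- vertex of `D` has three or more there.
        ... | inj₂ Yi = ⊥-elim (1+n≰n (≤-trans d3 (≤-reflexive d2)))
          where
          Y′ = rem i D
          same : Y ≗ Y′
          same = ⊆-card-≗ {X = Y} {Y′} (λ j m → rem-in D (λ { refl → T≢F m Yi }) (s j m))
                   (≤-trans (≤-reflexive (suc-injective (trans (sym (card-rem D Di)) card-D))) (card-tight {Y} h e))
          d2 : deg G i Y′ ≡ 2
          d2 = +-cancelˡ-≡ 1 _ _ (trans (cong (_+ deg G i Y′) (sym fD))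
              (trans (f-rem D Di) (cong (_+ 2) (trans (sym (f-cong same)) e))))
          d3 : 3 ≤ deg G i Y′
          d3 = ≤-trans (let (j , q) = D-cases Di in subst (λ t → 3 ≤ deg G t D) q (high j)) (≤-reflexive (sym (deg-rem G)))

  record AtomAt (v : Fin n) : Set where
    constructor atomAt
    field
      {D} : VSet n
      contains : D v ≡ true
      isAtom : Atom D

-- Vertices of degree at most three and the degree count

module Reduction {n} (G : Graph n) (T : TightOn G) (IH : Smaller n) where

  open Freedom (proj₁ T)
  open InverseMoves T IH
  open Structure G T IH

  module _ (Q : Quad) (d3 : deg G (Quad.v Q) full ≡ 3) where
    open Quad Q

    v-nonadj : ∀ {x} → x ≢ a → x ≢ b → x ≢ c → adj G v x ≡ false
    v-nonadj h₁ h₂ h₃ = ≢true λ e → 1+n≰n (≤-trans (four≤ {X = full} h₁ h₂ h₃ (~-≢ ab) (~-≢ ac) (~-≢ bc) e va vb vc refl refl refl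
        refl) (≤-reflexive d3))

    private
      outside : ∀ {w} → w ≢ v → w ≢ a → w ≢ b → w ≢ c → K w ≡ false
      outside h h₁ h₂ h₃ = ≢true λ e → [ h , [ h₁ , [ h₂ , h₃ ]′ ]′ ]′ (K-cases e)

    -- Over the rigid K4, the edges `wa` and `wb` of the triangle `wab` are both contractible unless
    -- they lie in further triangles, with apexes `x` and `y`. If these coincide, a second K4 on
    -- `ab` appears.
    atom-or-derive₂ : ∀ {w} → w ≢ v → w ≢ c → w ~ a → w ~ b → adj G w c ≡ false → Derivable G ⊎ AtomAt v
    atom-or-derive₂ {w} w≢v w≢c wa wb wc = go (second-triangle rigid-K w∉ wd Ka Kb ab wa wb)
        (second-triangle rigid-K w∉ wd Kb Ka (~-sym ab) wb wa)
      where
      w≢a = ~-≢ wa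
      w≢b = ~-≢ wb
      w∉ = outside w≢v w≢a w≢b w≢c
      vw = v-nonadj w≢a w≢b w≢c
      wd : deg G w K ≡ 2
      wd = trans (deg-K w) (cong₂ _+_ (cong₂ _+_ (cong₂ _+_ (cong b2n wc) (cong b2n wb)) (cong b2n wa))
          (cong b2n (trans (adj-sym G w v) vw)))
      M = add w K
      RM : Rigid 2 M
      RM = rigid-add ≤-refl rigid-K w∉ wd
      go : Derivable G ⊎ Σ[ x ∈ Fin n ] M x ≡ false × w ~ x × a ~ x → Derivable G ⊎ Σ[ y ∈ Fin n ] M y ≡ false × w ~ y × b ~ y →
          Derivable G ⊎ AtomAt v
      go (inj₁ D) _ = inj₁ D
      go (inj₂ _) (inj₁ D) = inj₁ D
      go (inj₂ (x , x∉ , wx , ax)) (inj₂ (y , y∉ , wy , by)) with x ≟ y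
      -- The chain starts with `x`, and the triangle `ywb` is kept in reserve until the growing set
      -- becomes tight.
      ... | no x≢y = inj₁ (Chain.extend wb (~-sym wy) (~-sym by) n (m≤m+n n _) RM (add-new w K) (add-old w K Ka) wa x∉ (~-sym wx)
          (~-sym ax)
              (add-new w K) (add-old w K Kb) y∉ x≢y
              (λ xw xb → three≤ {X = M} w≢a w≢b (~-≢ ab) xw (~-sym ax) xb (add-new w K) (add-old w K Ka) (add-old w K Kb)))
      ... | yes refl = inj₂ (atomAt (in-K Kv) atom)
        where
        x≢ : ∀ {i} → M i ≡ true → x ≢ i
        x≢ m refl = T≢F m x∉
        xa = ~-sym ax
        xb = ~-sym by
        xw = ~-sym wx
        vx = v-nonadj (~-≢ xa) (~-≢ xb) (x≢ (add-old w K Kc))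
        cx : adj G c x ≡ false
        cx = ≢true λ e → 1+n≰n (≤-trans (four≤ {X = M} w≢a w≢b w≢c (~-≢ ab) (~-≢ ac) (~-≢ bc) xw xa xb (~-sym e)
               (add-new w K) (add-old w K Ka) (add-old w K Kb) (add-old w K Kc))
                   (deg≤ 3 x∉ (≤-reflexive (cong (_+ 1) (Rigid.value RM)))))
        open K44 w∉ wa wb wd x∉ xw xa xb vw (trans (adj-sym G c w) wc) vx cx

    atom-or-derive₃ : ∀ {w} → w ≢ v → w ~ a → w ~ b → w ~ c → AtomAt v
    atom-or-derive₃ w≢v wa wb wc = atomAt (add-old _ K Kv) (K5.atom w∉ wa wb wc (v-nonadj (~-≢ wa) (~-≢ wb) (~-≢ wc)))
      where w∉ = outside w≢v (~-≢ wa) (~-≢ wb) (~-≢ wc)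

    -- The only obstacle to contracting a K4 is an outside vertex adjacent to two of its vertices.
    uncontractible : Derivable G ⊎ Σ[ w ∈ Fin n ] K w ≡ false × 2 ≤ deg G w K
    uncontractible with pick (λ w → not (K w) ∧ does (2 ≤? deg G w K))
    ... | inj₂ (w , e) = let (p , q) = ∧-split {not (K w)} e in inj₂ (w , not-true p , does-true (2 ≤? deg G w K) q)
    ... | inj₁ none = inj₁ (derive-vertexToK4 F FF clean)
      where
      F : Fin 4 → Fin n
      F = lookup (v ∷ a ∷ b ∷ c ∷ [])
      FF : ∀ i j → i ≢ j → F i ~ F j
      FF 0F 0F h = ⊥-elim (h refl)
      FF 0F 1F h = va
      FF 0F 2F h = vb
      FF 0F 3F h = vc
      FF 1F 0F h = ~-sym va
      FF 1F 1F h = ⊥-elim (h refl)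
      FF 1F 2F h = ab
      FF 1F 3F h = ac
      FF 2F 0F h = ~-sym vb
      FF 2F 1F h = ~-sym ab
      FF 2F 2F h = ⊥-elim (h refl)
      FF 2F 3F h = bc
      FF 3F 0F h = ~-sym vc
      FF 3F 1F h = ~-sym ac
      FF 3F 2F h = ~-sym bc
      FF 3F 3F h = ⊥-elim (h refl)
      KF : ∀ i → K (F i) ≡ true
      KF 0F = Kv
      KF 1F = Ka
      KF 2F = Kb
      KF 3F = Kc
      clean : ∀ {w i j} → i ≢ j → (∀ l → w ≢ F l) → F i ~ w → F j ~ w → ⊥
      clean {w} {i} {j} h off p q = does-false (2 ≤? deg G w K)
          (trans (cong (_∧ does (2 ≤? deg G w K)) (sym (cong not (outside (off 0F) (off 1F) (off 2F) (off 3F))))) (none w))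
        (two≤ {X = K} (~-≢ (FF i j h)) (~-sym p) (~-sym q) (KF i) (KF j))

  atom-or-derive-K4 : (Q : Quad) → deg G (Quad.v Q) full ≡ 3 → Derivable G ⊎ AtomAt (Quad.v Q)
  atom-or-derive-K4 Q d3 with uncontractible Q d3
  ... | inj₁ D = inj₁ D
  ... | inj₂ (w , w∉ , d) = go (adj G w a) (adj G w b) (adj G w c) refl refl refl
    where
    open Quad Q
    w≢ : ∀ {i} → K i ≡ true → w ≢ i
    w≢ m refl = T≢F m w∉
    wv : adj G w v ≡ false
    wv = trans (adj-sym G w v) (v-nonadj Q d3 (w≢ Ka) (w≢ Kb) (w≢ Kc))
    few : ∀ {p q r} → adj G w a ≡ p → adj G w b ≡ q → adj G w c ≡ r → b2n r + b2n q + b2n p + 0 ≤ 1 → Derivable G ⊎ AtomAt v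
    few refl refl refl h = ⊥-elim (1+n≰n (≤-trans d (≤-trans
        (≤-reflexive (trans (deg-K w) (cong (λ t → b2n (adj G w c) + b2n (adj G w b) + b2n (adj G w a) + b2n t) wv))) h)))
    go : ∀ p q r → adj G w a ≡ p → adj G w b ≡ q → adj G w c ≡ r → Derivable G ⊎ AtomAt v
    go true true true e₁ e₂ e₃ = inj₂ (atom-or-derive₃ Q d3 (w≢ Kv) e₁ e₂ e₃)
    go true true false e₁ e₂ e₃ = atom-or-derive₂ Q d3 (w≢ Kv) (w≢ Kc) e₁ e₂ e₃
    go true false true e₁ e₂ e₃ = atom-or-derive₂ (record { va = va ; vb = vc ; vc = vb ; ab = ac ; ac = ab ; bc = ~-sym bc }) d3
        (w≢ Kv) (w≢ Kb) e₁ e₃ e₂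
    go false true true e₁ e₂ e₃ = atom-or-derive₂ (record { va = vb ; vb = vc ; vc = va ; ab = bc ; ac = ~-sym ab ; bc = ~-sym ac })
        d3 (w≢ Kv) (w≢ Ka) e₂ e₃ e₁
    go true false false e₁ e₂ e₃ = few e₁ e₂ e₃ ≤-refl
    go false true false e₁ e₂ e₃ = few e₁ e₂ e₃ ≤-refl
    go false false true e₁ e₂ e₃ = few e₁ e₂ e₃ ≤-refl
    go false false false e₁ e₂ e₃ = few e₁ e₂ e₃ z≤n

  Blocked : Fin n → Fin n → Fin n → VSet n → Set
  Blocked u w x X = X u ≡ true × X w ≡ true × X x ≡ false × f X ≡ 1

  -- The case distinction on blocking sets is made constructive by searching all subsets; `f-cong`
  -- transfers the result between a set and its table of values.
  blocked? : ∀ u w x → Dec (Σ[ X ∈ VSet n ] Blocked u w x X)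
  blocked? u w x with anySubset? {P = λ p → Blocked u w x (Vec.lookup p)}
                        (λ p → (Vec.lookup p u Bool.≟ true) ×-dec (Vec.lookup p w Bool.≟ true) ×-dec (Vec.lookup p x Bool.≟ false)
                            ×-dec (f (Vec.lookup p) ℕ.≟ 1))
  ... | yes (p , h) = yes (Vec.lookup p , h)
  ... | no h = no λ { (X , p , q , r , s) → let e = VecP.lookup∘tabulate X in
                       h (Vec.tabulate X , trans (e u) p , trans (e w) q , trans (e x) r , trans (f-cong e) s) }

  module _ {x : Fin n} (d3 : deg G x full ≡ 3) where

    no-tight-nbhd : ∀ {u v w X} → u ≢ v → u ≢ w → v ≢ w → x ~ u → x ~ v → x ~ w → X u ≡ true → X v ≡ true → X w ≡ true → X x ≡ false
        → f X ≢ 1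
    no-tight-nbhd {X = X} h₁ h₂ h₃ p q r Xu Xv Xw Xx e = 1+n≰n (≤-trans (f-pos (add-new x X))
      (+-cancelʳ-≤ 3 _ 0 (≤-trans (f-add≤ X 3 Xx (three≤ {X = X} h₁ h₂ h₃ p q r Xu Xv Xw)) (≤-reflexive (cong (_+ 2) e)))))

    private
      free : ∀ {u v} → ¬ (Σ[ X ∈ VSet n ] Blocked u v x X) → ∀ X → X u ≡ true → X v ≡ true → X x ≡ false → E G X + 2 ≤ 2 * card X
      free h X p q r with 2 ≤? f X
      ... | yes s = slack s
      ... | no s = ⊥-elim (h (X , p , q , r , f≡1 p (≤-pred (≰⇒> s))))

    -- A tight set `X` blocking `uv` misses `w`. If `w` is not adjacent to one of `u`, `v`, that
    -- pair is tried instead; a set blocking it as well meets `X`, so their union is tight and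
    -- contains all three neighbours of `x`.
    nonadjacent-nbrs : ∀ u v w → u ≢ v → u ≢ w → v ≢ w → x ~ u → x ~ v → x ~ w → adj G u v ≡ false → Derivable G
    nonadjacent-nbrs u v w u≢v u≢w v≢w xu xv xw uv with blocked? u v x
    ... | no h = derive-henneberg2 x u v w u≢v (≢-sym u≢w) (≢-sym v≢w) xu xv xw d3 uv (free h)
    ... | yes (X , Xu , Xv , Xx , fX) = go (dichotomy (adj G u w)) (dichotomy (adj G v w))
      where
      Xw : X w ≡ false
      Xw = ≢true λ e → no-tight-nbhd u≢v u≢w v≢w xu xv xw Xu Xv e Xx fX
      via : ∀ {s t} → X s ≡ true → X t ≡ true → s ≢ t → s ≢ w → t ≢ w → x ~ s → x ~ t → adj G s w ≡ false → Derivable G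
      via {s} {t} Xs Xt s≢t s≢w t≢w xs xt sw with blocked? s w x
      ... | no h = derive-henneberg2 x s w t s≢w (≢-sym s≢t) t≢w xs xw xt d3 sw (free h)
      ... | yes (Y , Ys , Yw , Yx , fY) = ⊥-elim (no-tight-nbhd {X = X ∪ Y} s≢t s≢w t≢w xs xt xw (cong (_∨ Y s) Xs)
          (cong (_∨ Y t) Xt)
              (trans (cong (X w ∨_) Yw) (∨-zeroʳ (X w))) (cong₂ _∨_ Xx Yx)
              (f≡1 {X ∪ Y} {s} (cong (_∨ Y s) Xs) (+-cancelʳ-≤ 1 _ 1
                  (≤-trans (+-monoʳ-≤ (f (X ∪ Y)) (f-pos {X ∩ Y} {s} (cong₂ _∧_ Xs Ys)))
                (≤-trans (f-sub X Y) (≤-reflexive (cong₂ _+_ fX fY)))))))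
      go : adj G u w ≡ true ⊎ adj G u w ≡ false → adj G v w ≡ true ⊎ adj G v w ≡ false → Derivable G
      go (inj₂ h) _ = via Xu Xv u≢v u≢w v≢w xu xv h
      go (inj₁ _) (inj₂ h) = via Xv Xu (≢-sym u≢v) v≢w u≢w xv xu h
      -- With `w` adjacent to both, no other pair is available, but then `w` has two neighbours in
      -- `X`, so `add w X` is already tight and contains all three.
      go (inj₁ uw) (inj₁ vw) = ⊥-elim (no-tight-nbhd {X = add w X} u≢v u≢w v≢w xu xv xw (add-old w X Xu) (add-old w X Xv)
          (add-new w X)
          (add-out X (~-≢ xw) Xx)
          (f≡1 (add-new w X) (+-cancelʳ-≤ 2 _ 1 (≤-trans (f-add≤ X 2 Xw (two≤ {X = X} u≢v (~-sym uw) (~-sym vw) Xu Xv))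
              (≤-reflexive (cong (_+ 2) fX))))))

    atom-or-derive : Derivable G ⊎ AtomAt x
    atom-or-derive with nbr G {x} {full} (≤-trans (s≤s z≤n) (≤-reflexive (sym d3)))
    ... | a , xa , _ with nbr-≢ G {x} {full} a (≤-trans (s≤s (s≤s z≤n)) (≤-reflexive (sym d3)))
    ...   | b , b≢a , xb , _ with nbr-≢≢ G {x} {full} a b (≤-reflexive (sym d3))
    ...     | c , c≢a , c≢b , xc , _ with dichotomy (adj G a b) | dichotomy (adj G a c) | dichotomy (adj G b c)
    ...       | inj₂ h | _ | _ = inj₁ (nonadjacent-nbrs a b c (≢-sym b≢a) (≢-sym c≢a) (≢-sym c≢b) xa xb xc h)
    ...       | inj₁ _ | inj₂ h | _ = inj₁ (nonadjacent-nbrs a c b (≢-sym c≢a) (≢-sym b≢a) c≢b xa xc xb h)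
    ...       | inj₁ _ | inj₁ _ | inj₂ h = inj₁ (nonadjacent-nbrs b c a (≢-sym c≢b) b≢a c≢a xb xc xa h)
    ...       | inj₁ ab | inj₁ ac | inj₁ bc = atom-or-derive-K4
        (record { va = xa ; vb = xb ; vc = xc ; ab = ab ; ac = ac ; bc = bc }) d3

  -- Deleting `v` gives `1 + deg v = f (rem v full) + 2`, and `f` is positive on what remains.
  min-degree : ∀ v → 2 ≤ deg G v full
  min-degree v = go (pick (rem v full))
    where
    key : 1 + deg G v full ≡ f (rem v full) + 2
    key = trans (cong₂ _+_ (sym f-full) (sym (deg-rem G))) (f-rem {v} full refl)
    go : (∀ i → rem v full i ≡ false) ⊎ Σ[ i ∈ Fin n ] rem v full i ≡ true → 2 ≤ deg G v full
    go (inj₂ (i , e)) = ≤-pred (≤-trans (+-monoˡ-≤ 2 (f-pos e)) (≤-reflexive (sym key)))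
    -- A single vertex has `f = 2`, so a tight graph has another vertex.
    go (inj₁ none) = ⊥-elim (1+n≢0 (suc-injective (trans (cong (_+ 2) (sym (f-empty {rem v full} none)))
        (trans (sym key) (cong suc d0)))))
      where
      d0 : deg G v full ≡ 0
      d0 = trans (sym (deg-rem G)) (trans (deg-def G v (rem v full))
          (card-empty (λ j → trans (cong (adj G v j ∧_) (none j)) (∧-zeroʳ _))))

  low-vertex : ∀ {v} → deg G v full ≤ 3 → Derivable G ⊎ AtomAt v
  low-vertex {v} h with m≤n⇒m<n∨m≡n h
  ... | inj₂ e = atom-or-derive e
  ... | inj₁ lt = inj₁ (derive-henneberg1 v (≤-antisym (≤-pred lt) (min-degree v)))

  -- Since `f full` and `f D` are both 1, the number of edges leaving `D` equals `f (∁ D)`. The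
  -- value 1 means an edge joining; from 2 on, the degrees in `D` average at least 4.
  atom-volume : ∀ {D v} → D v ≡ true → Atom D → Derivable G ⊎ card D * 4 ≤ vol G D full
  atom-volume {D} {v} Dv A with pick (∁ D)
  ... | inj₁ none = inj₁ (Atom.whole A (λ i → not-false (none i)))
  ... | inj₂ (w , w∉) with m≤n⇒m<n∨m≡n (f-pos {∁ D} w∉)
  ...   | inj₂ e = inj₁ (derive-edgeJoin T D (tight (Atom.value A)) (tight (sym e)) IH)
  ...   | inj₁ s = inj₂ (arith {k₁ = card D} {card (∁ D)} (E-cut G D) (proj₂ T) (card-∁ D) (tight (Atom.value A)) (slack s)
      (handshake G D)
                     (trans (vol-partʳ G D full D) refl))
    where
    arith : ∀ {e a b c k k₁ k₂ h t} → e ≡ a + b + c → e + 1 ≡ 2 * k → k ≡ k₁ + k₂ → a + 1 ≡ 2 * k₁ → b + 2 ≤ 2 * k₂ → h ≡ a + a → t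
        ≡ h + c → k₁ * 4 ≤ t
    arith {a = a} {b} {c} {k₁ = k₁} {k₂} refl q refl r s refl refl = lin≤ 0 s
        (trans (l₁ k₁ k₂) (trans (cong₂ _+_ (sym q) (sym r)) (l₂ a b c)))
      where
      l₁ : ∀ k₁ k₂ → k₁ * 4 + 2 * k₂ + 0 ≡ 2 * (k₁ + k₂) + 2 * k₁
      l₁ = solve-∀
      l₂ : ∀ a b c → a + b + c + 1 + (a + 1) ≡ a + a + c + (b + 2)
      l₂ = solve-∀

  -- No atom is cut by `Y`, so the atom of a vertex of low degree can be split off as a whole.
  Saturated : VSet n → Set
  Saturated Y = ∀ {D i} → Atom D → D i ≡ true → Y i ≡ true → D ⊆ Y

  -- Vertices of degree at most 3 lie in atoms, and within an atom the others make up for them.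
  -- Removing one atom leaves a saturated set because atoms are disjoint.
  volume : ∀ k {Y} → card Y ≤ k → Saturated Y → Derivable G ⊎ card Y * 4 ≤ vol G Y full
  volume k {Y} h sat with pick (λ v → Y v ∧ does (deg G v full ≤? 3))
  ... | inj₁ none = inj₂ (vol≥ G Y full 4 (λ i Yi → ≰⇒>
      (does-false (deg G i full ≤? 3) (trans (cong (_∧ does (deg G i full ≤? 3)) (sym Yi)) (none i)))))
  ... | inj₂ (v , e) with low-vertex (does-true (deg G v full ≤? 3) (proj₂ (∧-split {Y v} e)))
  ...   | inj₁ D = inj₁ D
  ...   | inj₂ (atomAt {D} Dv A) with atom-volume Dv A
  ...     | inj₁ D = inj₁ D
  ...     | inj₂ vD = go k h
    where
    Yv : Y v ≡ true
    Yv = proj₁ (∧-split {Y v} e)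
    Y′ = Y ∖ D
    Y∩D : Y ∩ D ≗ D
    Y∩D i with D i in q
    ... | true = cong (_∧ true) (sat A Dv Yv i q)
    ... | false = ∧-zeroʳ _
    cY : card Y ≡ card D + card Y′
    cY = trans (card-part Y D) (cong (_+ card Y′) (card-cong Y∩D))
    sat′ : Saturated Y′
    sat′ {D′} {i} A′ D′i Y′i j D′j with dichotomy (D j)
    ... | inj₂ q = cong₂ _∧_ (sat A′ D′i (proj₁ (∧-split {Y i} Y′i)) j D′j) (cong not q)
    ... | inj₁ q = ⊥-elim (T≢F (atoms-disjoint A A′ q D′j i D′i) (not-true (proj₂ (∧-split {Y i} Y′i))))
    go : ∀ k → card Y ≤ k → Derivable G ⊎ card Y * 4 ≤ vol G Y full
    go zero h = ⊥-elim (1+n≰n (≤-trans (card-∈ {X = Y} Yv) h))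
    go (suc k) h with volume k {Y′} (≤-pred (≤-trans (≤-trans (+-monoˡ-≤ (card Y′) (card-∈ {X = D} Dv)) (≤-reflexive (sym cY))) h))
        sat′
    ... | inj₁ D = inj₁ D
    ... | inj₂ vY′ = inj₂ (≤-trans (≤-reflexive (trans (cong (_* 4) cY) (*-distribʳ-+ 4 (card D) (card Y′))))
            (≤-trans (+-mono-≤ vD vY′) (≤-reflexive (sym
                (trans (vol-partˡ G Y D full) (cong (_+ vol G Y′ full) (vol-cong G Y∩D (λ _ → refl))))))))

  -- All degrees together give `2 (2n - 1) = 4n - 2`, too little for an average of 4; so the count
  -- must have ended in a derivation.
  derivable : Derivable G
  derivable with volume _ {full} ≤-refl (λ _ _ _ _ _ → refl)
  ... | inj₁ D = D
  ... | inj₂ h = ⊥-elim (1+n≰n (arith {k = card (full {n})} (proj₂ T) (≤-trans h (≤-reflexive (handshake G full)))))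
    where
    arith : ∀ {e k} → e + 1 ≡ 2 * k → k * 4 ≤ e + e → suc e ≤ e
    arith {e} {k} p q = lin≤ 1 q (trans (l₁ e) (cong (e +_) (trans (cong₂ _+_ p p) (l₂ k))))
      where
      l₁ : ∀ e → 1 + e + (e + e) + 1 ≡ e + (e + 1 + (e + 1))
      l₁ = solve-∀
      l₂ : ∀ k → 2 * k + 2 * k ≡ k * 4
      l₂ = solve-∀

-- Induction on the number of vertices and the equivalences

TightOn⇒Derivable : ∀ {n} → Acc _<_ n → (G : Graph n) → TightOn G → Derivable G
TightOn⇒Derivable (acc rs) G T = Reduction.derivable G T (λ H lt TH → TightOn⇒Derivable (rs lt) H TH)

Derivable⇒TreePlusUnicyclic : ∀ {n} {G : Graph n} → Derivable G → TreePlusUnicyclic G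
Derivable⇒TreePlusUnicyclic D = Cert⇒TreePlusUnicyclic (Derivable⇒Cert D)

TreePlusUnicyclic⇒Tight : ∀ {n} {G : Graph n} → TreePlusUnicyclic G → Tight 1 G
TreePlusUnicyclic⇒Tight {G = G} t = let (s , e) = TreePlusUnicyclic⇒sparse {G = G} t in sparse⇒Tight s e

theorem1p4 : (n : ℕ) (G : Graph n) →
    (Tight 1 G ⇔ Derivable G) × (Tight 1 G ⇔ TreePlusUnicyclic G)
theorem1p4 n G = mk⇔ derive (λ D → TreePlusUnicyclic⇒Tight {G = G} (Derivable⇒TreePlusUnicyclic D))
               , mk⇔ (λ t → Derivable⇒TreePlusUnicyclic (derive t)) (TreePlusUnicyclic⇒Tight {G = G})
  where
  derive : Tight 1 G → Derivable G
  derive t = TightOn⇒Derivable (<-wellFounded n) G (Tight⇒sparse t)
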